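{- Let $k\geqslant 2$ and let $H$ be a $k$-uniform hypergraph on the vertex set $[n]=\{1,\ldots,n\}$ with degree sequence $d_1,\ldots,d_n$. Let $\mathcal{L}_H$ and $\mathcal{Q}_H$ be its Laplacian and signless Laplacian tensors. Then \[ Tr_t(\mathcal{L}_H)=Tr_t(\mathcal{Q}_H)=(k-1)^{n-1}\sum_{i=1}^n d_i^t,\qquad t=1,\ldots,k-1, \] \[ Tr_k(\mathcal{L}_H)=(-1)^k k^{k-1}(k-1)^{n-k}|E(H)|+(k-1)^{n-1}\sum_{i=1}^n d_i^k, \] \[ Tr_k(\mathcal{Q}_H)=k^{k-1}(k-1)^{n-k}|E(H)|+(k-1)^{n-1}\sum_{i=1}^n d_i^k. \]
   Context: A $k$-uniform hypergraph $H$ has a finite vertex set $V(H)$ and an edge set $E(H)$ consisting of $k$-element subsets of $V(H)$; the degree $d_i$ of vertex $i$ is the number of edges containing $i$. The adjacency tensor $\mathcal{A}_H$ is the order $k$, dimension $n=|V(H)|$ tensor with entries $a_{i_1\cdots i_k}=\frac{1}{(k-1)!}$ if $\{i_1,\ldots,i_k\}\in E(H)$ (in particular the indices are distinct) and $a_{i_1\cdots i_k}=0$ otherwise. $\mathcal{D}_H$ is the order $k$ dimension $n$ diagonal tensor whose entry at $(i,i,\ldots,i)$ is $d_i$ and all other entries are $0$. The Laplacian tensor is $\mathcal{L}_H=\mathcal{D}_H-\mathcal{A}_H$ and the signless Laplacian tensor is $\mathcal{Q}_H=\mathcal{D}_H+\mathcal{A}_H$. For an order $k\geqslant2$ dimension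 $n$ tensor $\mathcal{T}=(t_{i_1\cdots i_k})$ and an integer $d\geqslant1$, the $d$-th order trace is \[ Tr_d(\mathcal{T})=(k-1)^{n-1}\sum_{\substack{d_1+\cdots+d_n=d\\ d_i\geqslant 0}}\prod_{i=1}^n\frac{1}{(d_i(k-1))!}\Big(\sum_{y\in[n]^{k-1}}t_{iy}\frac{\partial}{\partial a_{iy}}\Big)^{d_i}\operatorname{tr}(A^{d(k-1)}), \] where $A=(a_{ij})$ is an $n\times n$ matrix of indeterminates, $t_{iy}=t_{ii_2\cdots i_k}$ and $\frac{\partial}{\partial a_{iy}}=\frac{\partial}{\partial a_{ii_2}}\cdots\frac{\partial}{\partial a_{ii_k}}$ for $y=i_2\cdots i_k$. -}

module Defs where

open import Data.Nat as ℕ using (ℕ; zero; suc; _∸_; _!)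
open import Data.Nat.Properties using (_!≢0)
open import Data.Integer as ℤ using (ℤ; +_)
open import Data.Rational as ℚ using (ℚ; 0ℚ; 1ℚ)
open import Data.Bool using (Bool; true; false; if_then_else_; _∧_)
open import Data.Fin as Fin using (Fin)
open import Data.Fin.Subset using (Subset; ⁅_⁆; ⋃; ∣_∣)
open import Data.Product using (_×_; _,_)
open import Data.List as List using (List; []; _∷_; _++_; map; concatMap; foldr; allFin; upTo; length; filterᵇ; null; zip)
open import Data.Bool.ListAction using (any)
import Data.Nat.ListAction as NLA
open import Data.List.Relation.Unary.All using (All)
open import Data.List.Relation.Unary.Unique.Propositional using (Unique)
open import Data.Vec.Functional as VF using (Vector)
import Data.Vec.Properties as VecP
open import Relation.Binary.PropositionalEquality using (_≡_)
open import Relation.Nullary using (does)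

ℕ→ℚ : ℕ → ℚ
ℕ→ℚ n = (+ n) ℚ./ 1

ℤ→ℚ : ℤ → ℚ
ℤ→ℚ z = z ℚ./ 1

sumℚ : List ℚ → ℚ
sumℚ = foldr ℚ._+_ 0ℚ

prodℚ : List ℚ → ℚ
prodℚ = foldr ℚ._*_ 1ℚ

inv! : ℕ → ℚ
inv! m = ((+ 1) ℚ./ (m !)) {{m !≢0}}

Tensor : ℕ → ℕ → Set
Tensor k n = Vector (Fin n) k → ℚ

allVecs : (m n : ℕ) → List (Vector (Fin n) m)
allVecs zero    n = VF.[] ∷ []
allVecs (suc m) n = concatMap (λ i → map (i VF.∷_) (allVecs m n)) (allFin n)

allLists : (l n : ℕ) → List (List (Fin n))
allLists zero    n = [] ∷ []
allLists (suc l) n = concatMap (λ i → map (i ∷_) (allLists l n)) (allFin n)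

compositions : (n d : ℕ) → List (Vector ℕ n)
compositions zero    zero    = VF.[] ∷ []
compositions zero    (suc d) = []
compositions (suc n) d =
  concatMap (λ j → map (j VF.∷_) (compositions n (d ∸ j))) (upTo (suc d))

-- Polynomials in the n² commuting indeterminates a_{ij}.
-- A monomial is a word (list) of variables, read as their product;
-- a polynomial is a formal sum of (coefficient , monomial).

Var : ℕ → Set
Var n = Fin n × Fin n

Word : ℕ → Set
Word n = List (Var n)

Poly : ℕ → Set
Poly n = List (ℚ × Word n)

_==ᵥ_ : ∀ {n} → Var n → Var n → Bool
(i , j) ==ᵥ (i' , j') = does (i Fin.≟ i') ∧ does (j Fin.≟ j')

-- ∂/∂v of a product x₁⋯x_m (product rule): Σ_j [x_j = v] ∏_{l≠j} x_l
derivWord : ∀ {n} → Var n → Word n → List (Word n)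
derivWord v []      = []
derivWord v (x ∷ w) =
  (if x ==ᵥ v then w ∷ [] else []) ++ map (x ∷_) (derivWord v w)

derivPoly : ∀ {n} → Var n → Poly n → Poly n
derivPoly v p = concatMap (λ { (c , w) → map (c ,_) (derivWord v w) }) p

derivs : ∀ {n} → List (Var n) → Poly n → Poly n
derivs vs p = foldr derivPoly p vs

scale : ∀ {n} → ℚ → Poly n → Poly n
scale c p = map (λ { (c' , w) → (c ℚ.* c' , w) }) p

constTerm : ∀ {n} → Poly n → ℚ
constTerm p = sumℚ (map (λ { (c , w) → if null w then c else 0ℚ }) p)

-- the closed walk i₀ → i₁ → ⋯ → i_{L-1} → i₀ as the word a_{i₀i₁}⋯a_{i_{L-1}i₀}
cycleWord : ∀ {n} → Fin n → List (Fin n) → Word n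
cycleWord s path = zip (s ∷ path) (path ++ (s ∷ []))

-- tr(A^L) = Σ over closed walks of length L
trPow : (n L : ℕ) → Poly n
trPow n zero    = map (λ s → (1ℚ , [])) (allFin n)
trPow n (suc l) =
  concatMap (λ s → map (λ path → (1ℚ , cycleWord s path)) (allLists l n)) (allFin n)

-- the operator Σ_{y ∈ [n]^{k-1}} t_{iy} ∂/∂a_{iy}, for k = suc m
opT : ∀ {m n} → Tensor (suc m) n → Fin n → Poly n → Poly n
opT {m} {n} T i p =
  concatMap (λ y → scale (T (i VF.∷ y)) (derivs (map (λ j → (i , y j)) (allFin m)) p))
            (allVecs m n)

opPow : ∀ {m n} → Tensor (suc m) n → Fin n → ℕ → Poly n → Poly n
opPow T i zero    p = p
opPow T i (suc r) p = opT T i (opPow T i r p)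

applyAll : ∀ {m n} → Tensor (suc m) n → Vector ℕ n → Poly n → Poly n
applyAll {n = n} T ds p = foldr (λ i q → opPow T i (ds i) q) p (allFin n)

-- The d-th order trace Tr_d(T) of an order-k dimension-n tensor.
-- (Only meaningful for k ≥ 2; for k = 0 it is set to 0.)

Tr : (k n d : ℕ) → Tensor k n → ℚ
Tr zero    n d T = 0ℚ
Tr (suc m) n d T =
  ℕ→ℚ (m ℕ.^ (n ∸ 1)) ℚ.*
  sumℚ (map (λ ds →
              prodℚ (map (λ i → inv! (ds i ℕ.* m)) (allFin n)) ℚ.*
              constTerm (applyAll T ds (trPow n (d ℕ.* m))))
            (compositions n d))

record Hypergraph (k n : ℕ) : Set where
  field
    edges      : List (Subset n)
    edgesDistinct : Unique edges
    uniform    : All (λ e → ∣ e ∣ ≡ k) edges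
open Hypergraph public

_==ₛ_ : ∀ {n} → Subset n → Subset n → Bool
s ==ₛ t = does (VecP.≡-dec Data.Bool._≟_ s t)
  where import Data.Bool

isEdge : ∀ {k n} → Hypergraph k n → Subset n → Bool
isEdge H s = any (s ==ₛ_) (edges H)

numEdges : ∀ {k n} → Hypergraph k n → ℕ
numEdges H = length (edges H)

degree : ∀ {k n} → Hypergraph k n → Fin n → ℕ
degree H i = length (filterᵇ (λ e → Data.Vec.lookup e i) (edges H))
  where import Data.Vec

indexSet : ∀ {k n} → Vector (Fin n) k → Subset n
indexSet {k} f = ⋃ (map (λ j → ⁅ f j ⁆) (allFin k))

-- a_{i₁⋯i_k} = 1/(k-1)! if {i₁,…,i_k} ∈ E(H) with the iⱼ distinct, else 0
adjTensor : ∀ {k n} → Hypergraph k n → Tensor k n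
adjTensor {k} H f =
  if (does (∣ indexSet f ∣ ℕ.≟ k) ∧ isEdge H (indexSet f)) then inv! (k ∸ 1) else 0ℚ

-- D_H: d_i on the diagonal (i,…,i), 0 elsewhere
degTensor : ∀ {k n} → Hypergraph k n → Tensor k n
degTensor {zero}  H f = 0ℚ
degTensor {suc m} H f =
  if does (∣ indexSet f ∣ ℕ.≟ 1) then ℕ→ℚ (degree H (f Fin.zero)) else 0ℚ

laplacian : ∀ {k n} → Hypergraph k n → Tensor k n
laplacian H f = degTensor H f ℚ.- adjTensor H f

signlessLaplacian : ∀ {k n} → Hypergraph k n → Tensor k n
signlessLaplacian H f = degTensor H f ℚ.+ adjTensor H f

degPowSum : ∀ {k n} → Hypergraph k n → ℕ → ℕ
degPowSum {n = n} H t = NLA.sum (map (λ i → degree H i ℕ.^ t) (allFin n))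

-- Expanding the operators, a choice of one tensor entry t_{iy} for each factor contributes the
-- number of closed walks that use each of the arcs i → y_j exactly once. Every vertex entered
-- by such a walk must be left again, and the walk cannot stay at a vertex while other arcs
-- remain. A factor coming from an edge e at i forces a factor at every vertex of e, so at least
-- k factors are needed: for d < k only the pure powers of the diagonal entries d_i survive, and
-- for d = k there is one more possibility per edge e, where each vertex of e takes the
-- entry of e. The latter counts Eulerian circuits of the complete digraph on k vertices, which
-- by the BEST theorem and Cayley's formula gives k · k^(k-2) · (k-1)! · ((k-2)!)^(k-1).
--
-- The BEST theorem is proved by induction on the number of arcs: removing the first arc of a
-- trail that starts at s ≠ t turns the recursion into Euler's identity for the number of spanning
-- trees directed towards t, which is linear in the row of arcs leaving s.
{-# OPTIONS --safe #-}
module Submission where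

open import Defs
open import Algebra.Structures using (IsCommutativeRing; IsCommutativeMonoid; IsCommutativeSemiring)
import Data.Bool
open import Data.Bool using (Bool; true; false; if_then_else_; _∧_; not)
open import Data.Bool.ListAction using (any)
open import Data.Bool.Properties using (T?)
open import Data.Empty using (⊥)
open import Data.Fin as Fin using (Fin)
import Data.Fin.Properties as FinP
open import Data.Fin.Subset as Subset using (Subset; ⁅_⁆; ⋃; ∣_∣)
import Data.Fin.Subset.Properties as SubsetP
open import Data.Integer using (+_; -1ℤ; ℤ)
import Data.Integer as ℤ
import Data.Integer.Properties as ℤP
open import Data.List as List using (List; []; _∷_; _++_; map; concatMap; foldr; foldl; allFin; upTo; length; null; zip; replicate; reverse; filterᵇ)
open import Data.List.Membership.Propositional using (_∈_; _∉_; find; lose)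
open import Data.List.Membership.Propositional.Properties using (∈-++⁺ˡ; ∈-++⁺ʳ; ∈-++⁻; ∈-map⁺; ∈-map⁻; ∈-allFin; ∈-concat⁻′; ∈-concat⁺′; ∈-upTo⁺; ∈-upTo⁻)
import Data.List.Properties as ListP
open import Data.List.Relation.Binary.Permutation.Propositional using (_↭_; ↭-refl; ↭-sym; ↭-trans; prep; swap; ↭-reflexive)
import Data.List.Relation.Binary.Permutation.Propositional as ↭
import Data.List.Relation.Binary.Permutation.Propositional.Properties as ↭P
open import Data.List.Relation.Unary.All as All using (All; []; _∷_)
import Data.List.Relation.Unary.All.Properties as AllP
open import Data.List.Relation.Unary.AllPairs using ([]; _∷_)
import Data.List.Relation.Unary.Any as AnyList
open import Data.List.Relation.Unary.Any using (here; there; _─_)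
open import Data.List.Relation.Unary.Unique.Propositional using (Unique)
import Data.List.Relation.Unary.Unique.Propositional.Properties as UniqueP
open import Data.Nat using (ℕ; zero; suc; _≤_; _<_; _∸_; _^_; _*_; _+_; _!; z≤n; s≤s)
import Data.Nat as ℕ
import Data.Nat.Properties as ℕP
open import Data.Nat.Tactic.RingSolver using (solve-∀)
open import Data.Product using (_×_; _,_; proj₁; proj₂; ∃)
open import Data.Rational using (ℚ; 0ℚ; 1ℚ)
import Data.Rational as ℚ
import Data.Rational.Properties as ℚP
import Data.Rational.Unnormalised as ℚᵘ
import Data.Rational.Unnormalised.Properties as ℚᵘP
open import Data.Rational.Solver using (module +-*-Solver)
open import Data.Sum using (_⊎_; inj₁; inj₂)
import Data.Vec as Vec
import Data.Vec.Properties as VecP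
open import Data.Vec.Functional as VF using (Vector)
open import Function using (_∘_; flip; id; case_of_)
open import Relation.Binary.PropositionalEquality using (_≡_; _≢_; refl; sym; trans; cong; cong₂; subst; subst₂; module ≡-Reasoning)
open import Relation.Nullary using (¬_; Dec; yes; no; does; contradiction)
open import Relation.Nullary.Decidable using (_×-dec_; ¬?; dec-true; dec-false; decidable-stable)

-- Finite sums and products

-- Polynomials are never simplified: each is only paired with functionals on words, and the
-- derivatives act on these functionals. The resulting count of matchings is symmetric in
-- derivatives and letters, so the arcs of a walk may differentiate the word of tensor arcs instead;
-- this gives a recursion along the walk. Forests are counted by contraction, within ℕ and without
-- determinants. Contraction adds up vertex weights, which is why Cayley's formula is proved in a
-- weighted form. The exponents decide which terms survive: an edge factor e demands a positive
-- exponent at each vertex of e, and as the exponents sum to d ≤ k = |e| they must form the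
-- indicator of e. With m = k - 1, the k exponents 1 contribute (1/m!)^k. The circuit count k^m
-- ((m-1)!)^m m! times the prefactor m^(n-1) equals (m!)^k k^m m^(n-k), which leaves k^m m^(n-k) per
-- edge. The factor 1/m! of an adjacency entry is absorbed by the m! orderings of an edge at a fixed
-- vertex.

private variable
  X Y : Set

-- Abstract because the same reindexing laws serve sums and products, over ℕ and over ℚ.
module MonoidSum {A : Set} {_∙_ : A → A → A} {ε : A} (isCM : IsCommutativeMonoid _≡_ _∙_ ε) where
  open IsCommutativeMonoid isCM using (assoc; comm; identityˡ; identityʳ)
  open ≡-Reasoning

  ⨁ : List X → (X → A) → A
  ⨁ []       f = ε
  ⨁ (x ∷ xs) f = f x ∙ ⨁ xs f

  foldr-map : ∀ (f : X → A) xs → foldr _∙_ ε (map f xs) ≡ ⨁ xs f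
  foldr-map f []       = refl
  foldr-map f (x ∷ xs) = cong (f x ∙_) (foldr-map f xs)

  interchange : ∀ a b c d → (a ∙ b) ∙ (c ∙ d) ≡ (a ∙ c) ∙ (b ∙ d)
  interchange a b c d = begin
    (a ∙ b) ∙ (c ∙ d) ≡⟨ assoc a b (c ∙ d) ⟩
    a ∙ (b ∙ (c ∙ d)) ≡⟨ cong (a ∙_) (assoc b c d) ⟨
    a ∙ ((b ∙ c) ∙ d) ≡⟨ cong (λ z → a ∙ (z ∙ d)) (comm b c) ⟩
    a ∙ ((c ∙ b) ∙ d) ≡⟨ cong (a ∙_) (assoc c b d) ⟩
    a ∙ (c ∙ (b ∙ d)) ≡⟨ assoc a c (b ∙ d) ⟨
    (a ∙ c) ∙ (b ∙ d) ∎

  ⨁-cong-∈ : ∀ (xs : List X) {f g} → (∀ x → x ∈ xs → f x ≡ g x) → ⨁ xs f ≡ ⨁ xs g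
  ⨁-cong-∈ []       eq = refl
  ⨁-cong-∈ (x ∷ xs) eq = cong₂ _∙_ (eq x (here refl)) (⨁-cong-∈ xs λ y y∈ → eq y (there y∈))

  ⨁-cong : ∀ (xs : List X) {f g} → (∀ x → f x ≡ g x) → ⨁ xs f ≡ ⨁ xs g
  ⨁-cong xs eq = ⨁-cong-∈ xs λ x _ → eq x

  ⨁-ε-∈ : ∀ (xs : List X) {f} → (∀ x → x ∈ xs → f x ≡ ε) → ⨁ xs f ≡ ε
  ⨁-ε-∈ []       eq = refl
  ⨁-ε-∈ (x ∷ xs) eq =
    trans (cong₂ _∙_ (eq x (here refl)) (⨁-ε-∈ xs λ y y∈ → eq y (there y∈))) (identityˡ ε)

  ⨁-ε : ∀ (xs : List X) {f} → (∀ x → f x ≡ ε) → ⨁ xs f ≡ ε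
  ⨁-ε xs eq = ⨁-ε-∈ xs λ x _ → eq x

  ⨁-++ : ∀ (xs ys : List X) f → ⨁ (xs ++ ys) f ≡ ⨁ xs f ∙ ⨁ ys f
  ⨁-++ []       ys f = sym (identityˡ _)
  ⨁-++ (x ∷ xs) ys f = trans (cong (f x ∙_) (⨁-++ xs ys f)) (sym (assoc _ _ _))

  ⨁-map : ∀ (h : Y → X) ys f → ⨁ (map h ys) f ≡ ⨁ ys (λ y → f (h y))
  ⨁-map h []       f = refl
  ⨁-map h (y ∷ ys) f = cong (f (h y) ∙_) (⨁-map h ys f)

  ⨁-concatMap : ∀ (h : Y → List X) ys f → ⨁ (concatMap h ys) f ≡ ⨁ ys (λ y → ⨁ (h y) f)
  ⨁-concatMap h []       f = refl
  ⨁-concatMap h (y ∷ ys) f =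
    trans (⨁-++ (h y) (concatMap h ys) f) (cong (⨁ (h y) f ∙_) (⨁-concatMap h ys f))

  ⨁-∙ : ∀ (xs : List X) f g → ⨁ xs (λ x → f x ∙ g x) ≡ ⨁ xs f ∙ ⨁ xs g
  ⨁-∙ []       f g = sym (identityˡ ε)
  ⨁-∙ (x ∷ xs) f g = trans (cong ((f x ∙ g x) ∙_) (⨁-∙ xs f g)) (interchange _ _ _ _)

  ⨁-swap : ∀ (xs : List X) (ys : List Y) (f : X → Y → A) →
           ⨁ xs (λ x → ⨁ ys (f x)) ≡ ⨁ ys (λ y → ⨁ xs (λ x → f x y))
  ⨁-swap []       ys f = sym (⨁-ε ys λ _ → refl)
  ⨁-swap (x ∷ xs) ys f =
    trans (cong (⨁ ys (f x) ∙_) (⨁-swap xs ys f)) (sym (⨁-∙ ys (f x) (λ y → ⨁ xs (λ x → f x y))))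

  ⨁-single : ∀ {xs : List X} {x₀} {f} → Unique xs → x₀ ∈ xs →
             (∀ x → x ∈ xs → x ≢ x₀ → f x ≡ ε) → ⨁ xs f ≡ f x₀
  ⨁-single {xs = x ∷ xs} (x∉ ∷ _) (here refl) eq =
    trans (cong (_ ∙_) (⨁-ε-∈ xs λ y y∈ → eq y (there y∈) λ { refl → All.lookup x∉ y∈ refl })) (identityʳ _)
  ⨁-single {xs = x ∷ xs} (x∉ ∷ u) (there p) eq =
    trans (cong₂ _∙_ (eq x (here refl) λ { refl → All.lookup x∉ p refl })
                     (⨁-single u p λ y y∈ → eq y (there y∈)))
          (identityˡ _)

  ⨁-─ : ∀ {xs : List X} {x} (p : x ∈ xs) f → ⨁ xs f ≡ f x ∙ ⨁ (xs ─ p) f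
  ⨁-─ (here refl) f = refl
  ⨁-─ {xs = y ∷ xs} {x} (there p) f = begin
    f y ∙ ⨁ xs f               ≡⟨ cong (f y ∙_) (⨁-─ p f) ⟩
    f y ∙ (f x ∙ ⨁ (xs ─ p) f) ≡⟨ assoc _ _ _ ⟨
    (f y ∙ f x) ∙ ⨁ (xs ─ p) f ≡⟨ cong (_∙ ⨁ (xs ─ p) f) (comm _ _) ⟩
    (f x ∙ f y) ∙ ⨁ (xs ─ p) f ≡⟨ assoc _ _ _ ⟩
    f x ∙ (f y ∙ ⨁ (xs ─ p) f) ∎

module SemiringSum {A : Set} {_⊕_ _⊗_ : A → A → A} {0# 1# : A}
                   (isCS : IsCommutativeSemiring _≡_ _⊕_ _⊗_ 0# 1#) where
  open IsCommutativeSemiring isCS using (+-isCommutativeMonoid; distribˡ; distribʳ; zeroˡ; zeroʳ)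
  open MonoidSum +-isCommutativeMonoid public

  ⨁-*ˡ : ∀ (xs : List X) a f → ⨁ xs (λ x → a ⊗ f x) ≡ a ⊗ ⨁ xs f
  ⨁-*ˡ []       a f = sym (zeroʳ a)
  ⨁-*ˡ (x ∷ xs) a f = trans (cong ((a ⊗ f x) ⊕_) (⨁-*ˡ xs a f)) (sym (distribˡ a (f x) _))

  ⨁-*ʳ : ∀ (xs : List X) a f → ⨁ xs (λ x → f x ⊗ a) ≡ ⨁ xs f ⊗ a
  ⨁-*ʳ []       a f = sym (zeroˡ a)
  ⨁-*ʳ (x ∷ xs) a f = trans (cong ((f x ⊗ a) ⊕_) (⨁-*ʳ xs a f)) (sym (distribʳ a (f x) _))

open SemiringSum ℕP.+-*-isCommutativeSemiring using (foldr-map) renaming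
  ( ⨁ to ∑;  ⨁-cong-∈ to ∑-cong-∈; ⨁-cong to ∑-cong; ⨁-ε-∈ to ∑-zero-∈; ⨁-ε to ∑-zero; ⨁-++ to ∑-++
  ; ⨁-map to ∑-map; ⨁-concatMap to ∑-concatMap; ⨁-∙ to ∑-+; ⨁-swap to ∑-swap; ⨁-single to ∑-single
  ; ⨁-*ˡ to ∑-*ˡ; ⨁-*ʳ to ∑-*ʳ)

open MonoidSum ℕP.*-1-isCommutativeMonoid using () renaming
  (⨁ to ∏; ⨁-cong-∈ to ∏-cong-∈; ⨁-─ to ∏-─)

module ∑ℚ = SemiringSum (IsCommutativeRing.isCommutativeSemiring ℚP.+-*-isCommutativeRing)
open ∑ℚ using () renaming (⨁ to ∑ℚ)

module ∏ℚ = MonoidSum ℚP.*-1-isCommutativeMonoid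
open ∏ℚ using () renaming (⨁ to ∏ℚ)

-- Indicators and Kronecker deltas

ind : Bool → ℕ
ind b = if b then 1 else 0

δ : ∀ {n} → Fin n → Fin n → ℕ
δ i j = ind (does (i Fin.≟ j))

δ-refl : ∀ {n} (i : Fin n) → δ i i ≡ 1
δ-refl i with i Fin.≟ i
... | yes _ = refl
... | no ne = contradiction refl ne

δ-≢ : ∀ {n} {i j : Fin n} → i ≢ j → δ i j ≡ 0
δ-≢ {i = i} {j} ne with i Fin.≟ j
... | yes eq = contradiction eq ne
... | no _   = refl

δ-sym : ∀ {n} (i j : Fin n) → δ i j ≡ δ j i
δ-sym i j with i Fin.≟ j
... | yes refl = sym (δ-refl i)
... | no ne    = sym (δ-≢ (ne ∘ sym))

-- A factor that deletes the term j = i, so that sums over j ≠ i remain sums over `allFin`. The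
-- truncated subtraction is exact since `δ` is 0 or 1.
δ̅ : ∀ {n} → Fin n → Fin n → ℕ
δ̅ i j = 1 ∸ δ i j

δ̅-≢ : ∀ {n} {i j : Fin n} → i ≢ j → δ̅ i j ≡ 1
δ̅-≢ ne = cong (1 ∸_) (δ-≢ ne)

δ+δ̅ : ∀ {n} (i j : Fin n) → δ i j + δ̅ i j ≡ 1
δ+δ̅ i j with does (i Fin.≟ j)
... | true  = refl
... | false = refl

allFin-unique : ∀ n → Unique (allFin n)
allFin-unique n = UniqueP.allFin⁺ n

∑-δ : ∀ {n} (i : Fin n) (f : Fin n → ℕ) → ∑ (allFin n) (λ j → δ i j * f j) ≡ f i
∑-δ {n} i f = trans
  (∑-single {f = λ j → δ i j * f j} (allFin-unique n) (∈-allFin i)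
     λ j _ j≢i → cong (_* f j) (δ-≢ (j≢i ∘ sym)))
  (trans (cong (_* f i) (δ-refl i)) (ℕP.*-identityˡ (f i)))

∑-δ̅ : ∀ {n} (i : Fin n) (f : Fin n → ℕ) → ∑ (allFin n) (λ j → δ̅ i j * f j) + f i ≡ ∑ (allFin n) f
∑-δ̅ {n} i f = begin
  ∑ (allFin n) (λ j → δ̅ i j * f j) + f i                               ≡⟨ cong (∑ (allFin n) (λ j → δ̅ i j * f j) ℕ.+_) (∑-δ i f) ⟨
  ∑ (allFin n) (λ j → δ̅ i j * f j) + ∑ (allFin n) (λ j → δ i j * f j)  ≡⟨ ∑-+ (allFin n) (λ j → δ̅ i j * f j) _ ⟨
  ∑ (allFin n) (λ j → δ̅ i j * f j + δ i j * f j)                       ≡⟨ ∑-cong (allFin n) split ⟩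
  ∑ (allFin n) f                                                       ∎
  where
  open ≡-Reasoning
  split : ∀ j → δ̅ i j * f j + δ i j * f j ≡ f j
  split j = begin
    δ̅ i j * f j + δ i j * f j ≡⟨ ℕP.*-distribʳ-+ (f j) (δ̅ i j) (δ i j) ⟨
    (δ̅ i j + δ i j) * f j     ≡⟨ cong (_* f j) (trans (ℕP.+-comm (δ̅ i j) _) (δ+δ̅ i j)) ⟩
    1 * f j                   ≡⟨ ℕP.*-identityˡ (f j) ⟩
    f j                       ∎

-- Forests in weighted digraphs

Matrix : ℕ → Set
Matrix n = Fin n → Fin n → ℕ

outdeg indeg : ∀ {n} → Matrix n → Fin n → ℕ
outdeg {n} c v = ∑ (allFin n) (c v)
indeg  {n} c v = ∑ (allFin n) (λ i → c i v)

-- Contraction of v into w on the level of arc multiplicities.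
merge : ∀ {n} → Matrix n → Fin n → Fin n → Matrix n
merge c v w i j = δ̅ v j * (c i j + δ w j * c i v)

-- The number of forests in which every vertex of A has exactly one outgoing
-- arc and whose roots are the vertices outside A; the arc leaving the first
-- vertex of A is chosen and contracted.
forests : ∀ {n} → List (Fin n) → Matrix n → ℕ
forests         []      c = 1
forests {n} (v ∷ A) c = ∑ (allFin n) (λ w → c v w * (δ̅ v w * forests A (merge c v w)))

forests-cong : ∀ {n} (A : List (Fin n)) {c c′ : Matrix n} →
               (∀ i → i ∈ A → ∀ j → c i j ≡ c′ i j) → forests A c ≡ forests A c′
forests-cong []      eq = refl
forests-cong {n} (v ∷ A) {c} {c′} eq = ∑-cong (allFin n) λ w →
  cong₂ _*_ (eq v (here refl) w)
    (cong (δ̅ v w ℕ.*_) (forests-cong A λ i i∈ j →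
      cong₂ (λ a b → δ̅ v j * (a + δ w j * b)) (eq i (there i∈) j) (eq i (there i∈) v)))

-- Each forest uses exactly one arc leaving s, and a contraction acts linearly on row s. The
-- coefficients α depend only on the other rows, so the same α serves before and after an arc out of
-- s is removed.
forests-linear : ∀ {n} {A : List (Fin n)} {s} → Unique A → s ∈ A → (c : Matrix n) →
  ∃ λ (α : Fin n → ℕ) → ∀ (c′ : Matrix n) → (∀ i → i ≢ s → ∀ j → c′ i j ≡ c i j) →
  forests A c′ ≡ ∑ (allFin n) (λ j → c′ s j * α j)
forests-linear {n} {v ∷ A} {s} (v∉ ∷ u) (here refl) c =
  (λ w → δ̅ v w * forests A (merge c v w)) , λ c′ eq → ∑-cong (allFin n) λ w →
    cong (λ z → c′ v w * (δ̅ v w * z)) (forests-cong A λ i i∈ j →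
      let i≢v = λ { refl → All.lookup v∉ i∈ refl } in
      cong₂ (λ a b → δ̅ v j * (a + δ w j * b)) (eq i i≢v j) (eq i i≢v v))
forests-linear {n} {v ∷ A} {s} (v∉ ∷ u) (there s∈A) c = β , λ c′ eq → lin c′ eq
  where
  open ≡-Reasoning
  v≢s : v ≢ s
  v≢s refl = All.lookup v∉ s∈A refl
  rec : ∀ w → _
  rec w = forests-linear u s∈A (merge c v w)
  α : Fin n → Fin n → ℕ
  α w = proj₁ (rec w)
  -- The transpose of the effect of `merge` on a row: the weight of an arc into v moves to w, so v
  -- inherits the coefficient of w.
  γ : Fin n → Fin n → ℕ
  γ w j = δ̅ v j * α w j + δ v j * (δ̅ v w * α w w)
  β : Fin n → ℕ
  β j = ∑ (allFin n) λ w → c v w * δ̅ v w * γ w j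
  row : ∀ (r : Fin n → ℕ) w →
        ∑ (allFin n) (λ j → δ̅ v j * (r j + δ w j * r v) * α w j) ≡ ∑ (allFin n) (λ j → r j * γ w j)
  row r w = begin
    ∑ (allFin n) (λ j → δ̅ v j * (r j + δ w j * r v) * α w j)
      ≡⟨ ∑-cong (allFin n) (λ j → expand (δ̅ v j) (r j) (δ w j) (r v) (α w j)) ⟩
    ∑ (allFin n) (λ j → r j * (δ̅ v j * α w j) + δ w j * (r v * (δ̅ v j * α w j)))
      ≡⟨ ∑-+ (allFin n) _ _ ⟩
    ∑ (allFin n) (λ j → r j * (δ̅ v j * α w j)) + ∑ (allFin n) (λ j → δ w j * (r v * (δ̅ v j * α w j)))
      ≡⟨ cong (∑ (allFin n) (λ j → r j * (δ̅ v j * α w j)) ℕ.+_)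
           (trans (∑-δ w (λ j → r v * (δ̅ v j * α w j))) (sym (∑-δ v (λ j → r j * (δ̅ v w * α w w))))) ⟩
    ∑ (allFin n) (λ j → r j * (δ̅ v j * α w j)) + ∑ (allFin n) (λ j → δ v j * (r j * (δ̅ v w * α w w)))
      ≡⟨ ∑-+ (allFin n) _ _ ⟨
    ∑ (allFin n) (λ j → r j * (δ̅ v j * α w j) + δ v j * (r j * (δ̅ v w * α w w)))
      ≡⟨ ∑-cong (allFin n) (λ j → collect (r j) (δ̅ v j * α w j) (δ v j) (δ̅ v w * α w w)) ⟩
    ∑ (allFin n) (λ j → r j * γ w j) ∎
    where
    expand : ∀ a b c d e → a * (b + c * d) * e ≡ b * (a * e) + c * (d * (a * e))
    expand = solve-∀
    collect : ∀ a b c d → a * b + c * (a * d) ≡ a * (b + c * d)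
    collect = solve-∀
  lin : ∀ (c′ : Matrix n) → (∀ i → i ≢ s → ∀ j → c′ i j ≡ c i j) →
        forests (v ∷ A) c′ ≡ ∑ (allFin n) (λ j → c′ s j * β j)
  lin c′ eq = begin
    ∑ (allFin n) (λ w → c′ v w * (δ̅ v w * forests A (merge c′ v w)))
      ≡⟨ ∑-cong (allFin n) (λ w → cong₂ (λ a b → a * (δ̅ v w * b)) (eq v v≢s w)
           (trans (proj₂ (rec w) (merge c′ v w)
                     (λ i i≢s j → cong₂ (λ a b → δ̅ v j * (a + δ w j * b)) (eq i i≢s j) (eq i i≢s v)))
                  (row (c′ s) w))) ⟩
    ∑ (allFin n) (λ w → c v w * (δ̅ v w * ∑ (allFin n) (λ j → c′ s j * γ w j)))
      ≡⟨ ∑-cong (allFin n) (λ w → trans (sym (ℕP.*-assoc (c v w) (δ̅ v w) _))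
           (sym (∑-*ˡ (allFin n) (c v w * δ̅ v w) (λ j → c′ s j * γ w j)))) ⟩
    ∑ (allFin n) (λ w → ∑ (allFin n) (λ j → c v w * δ̅ v w * (c′ s j * γ w j)))
      ≡⟨ ∑-swap (allFin n) (allFin n) _ ⟩
    ∑ (allFin n) (λ j → ∑ (allFin n) (λ w → c v w * δ̅ v w * (c′ s j * γ w j)))
      ≡⟨ ∑-cong (allFin n) (λ j → trans
           (∑-cong (allFin n) (λ w → commute (c v w * δ̅ v w) (c′ s j) (γ w j)))
           (∑-*ˡ (allFin n) (c′ s j) _)) ⟩
    ∑ (allFin n) (λ j → c′ s j * β j) ∎
    where
    commute : ∀ a b c → a * (b * c) ≡ b * (a * c)
    commute = solve-∀

-- Contraction only redirects the weight entering v to w; for v = w that weight would be lost with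
-- column v.
∑-merge : ∀ {n} {v w : Fin n} → v ≢ w → (r : Fin n → ℕ) →
          ∑ (allFin n) (λ j → δ̅ v j * (r j + δ w j * r v)) ≡ ∑ (allFin n) r
∑-merge {n} {v} {w} v≢w r = begin
  ∑ (allFin n) (λ j → δ̅ v j * (r j + δ w j * r v))
    ≡⟨ ∑-cong (allFin n) (λ j → expand (δ̅ v j) (r j) (δ w j) (r v)) ⟩
  ∑ (allFin n) (λ j → δ̅ v j * r j + δ w j * (δ̅ v j * r v))
    ≡⟨ ∑-+ (allFin n) _ _ ⟩
  ∑ (allFin n) (λ j → δ̅ v j * r j) + ∑ (allFin n) (λ j → δ w j * (δ̅ v j * r v))
    ≡⟨ cong (∑ (allFin n) (λ j → δ̅ v j * r j) ℕ.+_) (trans (∑-δ w (λ j → δ̅ v j * r v))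
         (trans (cong (_* r v) (δ̅-≢ v≢w)) (ℕP.*-identityˡ (r v)))) ⟩
  ∑ (allFin n) (λ j → δ̅ v j * r j) + r v
    ≡⟨ ∑-δ̅ v r ⟩
  ∑ (allFin n) r ∎
  where
  open ≡-Reasoning
  expand : ∀ a b c d → a * (b + c * d) ≡ a * b + c * (a * d)
  expand = solve-∀

-- Deleting one element from a duplicate-free list, and leaves of forests

─-⊆ : ∀ {A : List X} {x y} (p : x ∈ A) → y ∈ (A ─ p) → y ∈ A
─-⊆ (here _)  q         = there q
─-⊆ (there p) (here eq) = here eq
─-⊆ (there p) (there q) = there (─-⊆ p q)

─-∉ : ∀ {A : List X} {x} → Unique A → (p : x ∈ A) → x ∉ (A ─ p)
─-∉ (x∉ ∷ u) (here refl) q           = All.lookup x∉ q refl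
─-∉ (y∉ ∷ u) (there p)   (here refl) = All.lookup y∉ p refl
─-∉ (y∉ ∷ u) (there p)   (there q)   = ─-∉ u p q

─-unique : ∀ {A : List X} {x} → Unique A → (p : x ∈ A) → Unique (A ─ p)
─-unique (x∉ ∷ u) (here refl) = u
─-unique (y∉ ∷ u) (there p)   = All.tabulate (λ q → All.lookup y∉ (─-⊆ p q)) ∷ ─-unique u p

∈-─ : ∀ {A : List X} {x y} (p : x ∈ A) → y ∈ A → y ≢ x → y ∈ (A ─ p)
∈-─ (here refl) (here refl) y≢x = contradiction refl y≢x
∈-─ (here refl) (there q)   y≢x = q
∈-─ (there p)   (here eq)   y≢x = here eq
∈-─ (there p)   (there q)   y≢x = there (∈-─ p q y≢x)

-- Nothing in A points to s, so s is a leaf: its own arc is chosen freely and the rest is a forest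
-- on the other vertices. Contracting another v into w preserves this, because w = s has weight 0
-- and otherwise column s stays zero and the out-weight of s is kept.
forests-leaf : ∀ {n} {A : List (Fin n)} {s} → Unique A → (p : s ∈ A) → (c : Matrix n) →
               (∀ i → i ∈ A → c i s ≡ 0) → forests A c ≡ outdeg c s * forests (A ─ p) c
forests-leaf {n} {s ∷ A} (s∉ ∷ u) (here refl) c col0 = trans (∑-cong (allFin n) term) (∑-*ʳ (allFin n) _ (c s))
  where
  open ≡-Reasoning
  same : ∀ w → forests A (merge c s w) ≡ forests A c
  same w = forests-cong A λ i i∈ j → entry i i∈ j
    where
    entry : ∀ i → i ∈ A → ∀ j → merge c s w i j ≡ c i j
    entry i i∈ j rewrite col0 i (there i∈) | ℕP.*-zeroʳ (δ w j) | ℕP.+-identityʳ (c i j) with s Fin.≟ j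
    ... | yes refl = sym (col0 i (there i∈))
    ... | no _     = ℕP.*-identityˡ (c i j)
  term : ∀ w → c s w * (δ̅ s w * forests A (merge c s w)) ≡ c s w * forests A c
  term w rewrite same w with s Fin.≟ w
  ... | yes refl rewrite col0 s (here refl) = refl
  ... | no _     = cong (c s w ℕ.*_) (ℕP.*-identityˡ (forests A c))
forests-leaf {n} {v ∷ A} {s} (v∉ ∷ u) (there p) c col0 =
  trans (∑-cong (allFin n) term) (∑-*ˡ (allFin n) (outdeg c s) _)
  where
  v≢s : v ≢ s
  v≢s refl = All.lookup v∉ p refl
  commute : ∀ a b x y → a * (b * (x * y)) ≡ x * (a * (b * y))
  commute = solve-∀
  term : ∀ w → c v w * (δ̅ v w * forests A (merge c v w)) ≡
               outdeg c s * (c v w * (δ̅ v w * forests (A ─ p) (merge c v w)))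
  term w with w Fin.≟ s
  ... | yes refl rewrite col0 v (here refl) = sym (ℕP.*-zeroʳ (outdeg c s))
  ... | no w≢s with v Fin.≟ w
  ...   | yes refl rewrite ℕP.*-zeroʳ (c v v) = sym (ℕP.*-zeroʳ (outdeg c s))
  ...   | no v≢w = trans
    (cong (λ z → c v w * (1 * z)) (trans
      (forests-leaf u p (merge c v w) λ i i∈ → col i i∈)
      (cong (_* forests (A ─ p) (merge c v w)) (∑-merge v≢w (c s)))))
    (commute (c v w) 1 (outdeg c s) _)
    where
    col : ∀ i → i ∈ A → merge c v w i s ≡ 0
    col i i∈ rewrite col0 i (there i∈) | δ-≢ w≢s = ℕP.*-zeroʳ (δ̅ v s)

-- Following arcs inside a closed nonempty set never reaches a root. Contraction of v into some w in
-- A keeps the set closed and nonempty, until a single vertex is left whose arcs are all loops.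
forests-noExit : ∀ {n} {A : List (Fin n)} {a} → a ∈ A → (c : Matrix n) →
                 (∀ i → i ∈ A → ∀ j → j ∉ A → c i j ≡ 0) → forests A c ≡ 0
forests-noExit {n} {v ∷ A} _ c closed = ∑-zero (allFin n) term
  where
  open import Data.List.Membership.DecPropositional (Fin._≟_ {n}) using (_∈?_)
  term : ∀ w → c v w * (δ̅ v w * forests A (merge c v w)) ≡ 0
  term w with v Fin.≟ w
  ... | yes refl = ℕP.*-zeroʳ (c v v)
  ... | no v≢w with w ∈? A
  ...   | no w∉  = cong (_* (1 * forests A (merge c v w)))
                     (closed v (here refl) w λ { (here refl) → v≢w refl ; (there q) → w∉ q })
  ...   | yes w∈ = trans (cong (λ z → c v w * (1 * z)) (forests-noExit w∈ (merge c v w) entry)) (ℕP.*-zeroʳ (c v w))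
    where
    entry : ∀ i → i ∈ A → ∀ j → j ∉ A → merge c v w i j ≡ 0
    entry i i∈ j j∉ with v Fin.≟ j
    ... | yes refl = refl
    ... | no v≢j rewrite closed i (there i∈) j (λ { (here refl) → v≢j refl ; (there q) → j∉ q })
                       | δ-≢ {i = w} {j} (λ { refl → j∉ w∈ }) = refl

-- The indicator of the set of roots, as a product so that it follows the recursion on A.
outside : ∀ {n} → List (Fin n) → Fin n → ℕ
outside []      w = 1
outside (a ∷ A) w = δ̅ a w * outside A w

-- Cayley's formula with weight x j on every arc into j. Contraction of v into w turns the weight of
-- w into x w + x v and keeps the total, so the weighted form reproduces itself. The diagonal is
-- left free because contraction creates loops.
forests-cayley : ∀ {n} (v : Fin n) A → Unique (v ∷ A) → (c : Matrix n) (x : Fin n → ℕ) →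
  (∀ i → i ∈ v ∷ A → ∀ j → i ≢ j → c i j ≡ x j) →
  forests (v ∷ A) c ≡ ∑ (allFin n) (λ w → outside (v ∷ A) w * x w) * ∑ (allFin n) x ^ length A
forests-cayley {n} v [] u c x eq = trans (∑-cong (allFin n) term) (sym (ℕP.*-identityʳ _))
  where
  term : ∀ w → c v w * (δ̅ v w * 1) ≡ δ̅ v w * 1 * x w
  term w with v Fin.≟ w
  ... | yes refl = ℕP.*-zeroʳ (c v v)
  ... | no v≢w rewrite eq v (here refl) w v≢w = ℕP.*-comm (x w) 1
forests-cayley {n} v B@(v′ ∷ A) (v∉ ∷ u) c x eq = begin
  ∑ (allFin n) (λ w → c v w * (δ̅ v w * forests B (merge c v w)))
    ≡⟨ ∑-cong (allFin n) term ⟩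
  ∑ (allFin n) (λ w → (δ̅ v w * x w * R + δ̅ v w * outside B w * x w * x v) * S ^ length A)
    ≡⟨ ∑-*ʳ (allFin n) (S ^ length A) _ ⟩
  ∑ (allFin n) (λ w → δ̅ v w * x w * R + δ̅ v w * outside B w * x w * x v) * S ^ length A
    ≡⟨ cong (_* S ^ length A) (trans (∑-+ (allFin n) _ _) (cong₂ _+_
         (∑-*ʳ (allFin n) R (λ w → δ̅ v w * x w))
         (∑-*ʳ (allFin n) (x v) (λ w → δ̅ v w * outside B w * x w)))) ⟩
  (∑ (allFin n) (λ w → δ̅ v w * x w) * R + R * x v) * S ^ length A
    ≡⟨ collect (∑ (allFin n) (λ w → δ̅ v w * x w)) R (x v) (S ^ length A) ⟩
  R * ((∑ (allFin n) (λ w → δ̅ v w * x w) + x v) * S ^ length A)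
    ≡⟨ cong (λ z → R * (z * S ^ length A)) (∑-δ̅ v x) ⟩
  R * S ^ length B ∎
  where
  open ≡-Reasoning
  S R : ℕ
  S = ∑ (allFin n) x
  R = ∑ (allFin n) (λ w → outside (v ∷ B) w * x w)
  collect : ∀ a r y s → (a * r + r * y) * s ≡ r * ((a + y) * s)
  collect = solve-∀
  x′ : Fin n → Fin n → ℕ
  x′ w j = δ̅ v j * (x j + δ w j * x v)
  merged : ∀ w i → i ∈ B → ∀ j → i ≢ j → merge c v w i j ≡ x′ w j
  merged w i i∈ j i≢j = cong₂ (λ a b → δ̅ v j * (a + δ w j * b)) (eq i (there i∈) j i≢j)
    (eq i (there i∈) v λ { refl → All.lookup v∉ i∈ refl })
  -- The weight of v goes to w and joins the root weight only if w is a root. Summed over w, these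
  -- extra terms give `R * x v`, which completes the factor S.
  roots : ∀ w → v ≢ w → ∑ (allFin n) (λ u → outside B u * x′ w u) ≡ R + outside B w * x v
  roots w v≢w = begin
    ∑ (allFin n) (λ u → outside B u * x′ w u)
      ≡⟨ ∑-cong (allFin n) (λ u → expand (outside B u) (δ̅ v u) (x u) (δ w u) (x v)) ⟩
    ∑ (allFin n) (λ u → δ̅ v u * outside B u * x u + δ w u * (δ̅ v u * outside B u * x v))
      ≡⟨ ∑-+ (allFin n) _ _ ⟩
    R + ∑ (allFin n) (λ u → δ w u * (δ̅ v u * outside B u * x v))
      ≡⟨ cong (R ℕ.+_) (∑-δ w (λ u → δ̅ v u * outside B u * x v)) ⟩
    R + δ̅ v w * outside B w * x v
      ≡⟨ cong (λ z → R + z * outside B w * x v) (δ̅-≢ v≢w) ⟩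
    R + 1 * outside B w * x v
      ≡⟨ cong (λ z → R + z * x v) (ℕP.*-identityˡ (outside B w)) ⟩
    R + outside B w * x v ∎
    where
    expand : ∀ o d a e y → o * (d * (a + e * y)) ≡ d * o * a + e * (d * o * y)
    expand = solve-∀
  term : ∀ w → c v w * (δ̅ v w * forests B (merge c v w)) ≡
               (δ̅ v w * x w * R + δ̅ v w * outside B w * x w * x v) * S ^ length A
  term w with v Fin.≟ w
  ... | yes refl = ℕP.*-zeroʳ (c v v)
  ... | no v≢w = begin
    c v w * (1 * forests B (merge c v w))
      ≡⟨ cong₂ (λ a b → a * (1 * b)) (eq v (here refl) w v≢w)
           (trans (forests-cayley v′ A u (merge c v w) (x′ w) (merged w))
                  (cong₂ (λ a b → a * b ^ length A) (roots w v≢w) (∑-merge v≢w x))) ⟩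
    x w * (1 * ((R + outside B w * x v) * S ^ length A))
      ≡⟨ regroup (x w) R (outside B w) (x v) (S ^ length A) ⟩
    (1 * x w * R + 1 * outside B w * x w * x v) * S ^ length A ∎
    where
    regroup : ∀ a r o y s → a * (1 * ((r + o * y) * s)) ≡ (1 * a * r + 1 * o * a * y) * s
    regroup = solve-∀

-- Matchings of derivatives with closed walks

==ᵥ-refl : ∀ {n} (x : Var n) → (x ==ᵥ x) ≡ true
==ᵥ-refl (i , j) with i Fin.≟ i | j Fin.≟ j
... | yes _ | yes _ = refl
... | no ne | _     = contradiction refl ne
... | yes _ | no ne = contradiction refl ne

==ᵥ-sound : ∀ {n} (x y : Var n) → (x ==ᵥ y) ≡ true → x ≡ y
==ᵥ-sound (i , j) (i′ , j′) eq with i Fin.≟ i′ | j Fin.≟ j′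
==ᵥ-sound _ _ _  | yes refl | yes refl = refl
==ᵥ-sound _ _ () | yes _    | no _
==ᵥ-sound _ _ () | no _     | _

==ᵥ-sym : ∀ {n} (x y : Var n) → (x ==ᵥ y) ≡ (y ==ᵥ x)
==ᵥ-sym x y with x ==ᵥ y in p | y ==ᵥ x in q
... | true  | true  = refl
... | false | false = refl
... | true  | false with refl ← ==ᵥ-sound x y p = trans (sym p) q
... | false | true  with refl ← ==ᵥ-sound y x q = trans (sym p) q

ind-==ᵥ : ∀ {n} (i j i′ j′ : Fin n) → ind ((i , j) ==ᵥ (i′ , j′)) ≡ δ i i′ * δ j j′
ind-==ᵥ i j i′ j′ with does (i Fin.≟ i′) | does (j Fin.≟ j′)
... | true  | true  = refl
... | true  | false = refl
... | false | _     = refl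

-- The transpose of the derivative by v: it acts on functionals on words rather than on polynomials.
∂* : ∀ {n} → Var n → (Word n → ℕ) → Word n → ℕ
∂* v φ w = ∑ (derivWord v w) φ

∂*-∷ : ∀ {n} (v x : Var n) w φ → ∂* v φ (x ∷ w) ≡ ind (x ==ᵥ v) * φ w + ∂* v (φ ∘ (x ∷_)) w
∂*-∷ v x w φ = trans (∑-++ (if x ==ᵥ v then w ∷ [] else []) _ φ) (cong₂ _+_ (head (x ==ᵥ v)) (∑-map (x ∷_) (derivWord v w) φ))
  where
  head : ∀ b → ∑ (if b then w ∷ [] else []) φ ≡ ind b * φ w
  head true  = refl
  head false = refl

-- The constant term of ∂_{v₁} ⋯ ∂_{vᵣ} w, i.e. the number of bijections matching
-- the letters of w with the vᵢ.
matchings : ∀ {n} → List (Var n) → Word n → ℕ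
matchings vs = foldr ∂* (ind ∘ null) vs

derivWord-↭ : ∀ {n} (v : Var n) w u → u ∈ derivWord v w → w ↭ v ∷ u
derivWord-↭ v (x ∷ w) u u∈ with x ==ᵥ v in eq
derivWord-↭ v (x ∷ w) u (here refl) | true with refl ← ==ᵥ-sound x v eq = ↭-refl
derivWord-↭ v (x ∷ w) u (there u∈)  | true  with ∈-map⁻ (x ∷_) u∈
... | u′ , u′∈ , refl = ↭-trans (prep x (derivWord-↭ v w u′ u′∈)) (swap x v ↭-refl)
derivWord-↭ v (x ∷ w) u u∈          | false with ∈-map⁻ (x ∷_) u∈
... | u′ , u′∈ , refl = ↭-trans (prep x (derivWord-↭ v w u′ u′∈)) (swap x v ↭-refl)

∂*-↭ : ∀ {n} (v : Var n) (φ : Word n → ℕ) → (∀ {a b} → a ↭ b → φ a ≡ φ b) →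
       ∀ {w w′} → w ↭ w′ → ∂* v φ w ≡ ∂* v φ w′
∂*-↭ v φ inv ↭.refl = refl
∂*-↭ v φ inv (prep {w} {w′} x p)
  rewrite ∂*-∷ v x w φ | ∂*-∷ v x w′ φ | inv p | ∂*-↭ v (φ ∘ (x ∷_)) (inv ∘ prep x) p = refl
∂*-↭ v φ inv (swap {w} {w′} x y p)
  rewrite ∂*-∷ v x (y ∷ w) φ | ∂*-∷ v y (x ∷ w′) φ
        | ∂*-∷ v y w (φ ∘ (x ∷_)) | ∂*-∷ v x w′ (φ ∘ (y ∷_))
        | inv (prep y p) | inv (prep x p)
        | ∑-cong (derivWord v w) {f = λ u → φ (x ∷ y ∷ u)} {g = λ u → φ (y ∷ x ∷ u)} (λ u → inv (swap x y ↭-refl))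
        | ∂*-↭ v (λ u → φ (y ∷ x ∷ u)) (inv ∘ prep y ∘ prep x) p
  = exchange (ind (x ==ᵥ v) * φ (y ∷ w′)) (ind (y ==ᵥ v) * φ (x ∷ w′)) _
  where
  exchange : ∀ a b c → a + (b + c) ≡ b + (a + c)
  exchange = solve-∀
∂*-↭ v φ inv (↭.trans p q) = trans (∂*-↭ v φ inv p) (∂*-↭ v φ inv q)

matchings-↭ʳ : ∀ {n} (vs : List (Var n)) {w w′} → w ↭ w′ → matchings vs w ≡ matchings vs w′
matchings-↭ʳ [] {[]}    {[]}    p = refl
matchings-↭ʳ [] {[]}    {_ ∷ _} p = contradiction (↭P.↭-length p) λ ()
matchings-↭ʳ [] {_ ∷ _} {[]}    p = contradiction (↭P.↭-length p) λ ()
matchings-↭ʳ [] {_ ∷ _} {_ ∷ _} p = refl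
matchings-↭ʳ (v ∷ vs) p = ∂*-↭ v (matchings vs) (matchings-↭ʳ vs) p

-- A bijection between equal letters can be read from either side. The exchange allows the arcs of a
-- walk to be consumed one by one against the word of tensor arcs.
matchings-sym : ∀ {n} (vs w : List (Var n)) → matchings vs w ≡ matchings w vs
matchings-sym []       []      = refl
matchings-sym []       (x ∷ w) = refl
matchings-sym {n} (v ∷ vs) w = trans (∑-cong (derivWord v w) (matchings-sym vs)) (shift w vs)
  where
  open ≡-Reasoning
  -- The left side sorts the matchings by the partner of v, the right side by the partner of the
  -- first letter of w.
  shift : ∀ (w vs : Word n) → ∂* v (λ u → matchings u vs) w ≡ matchings w (v ∷ vs)
  shift []      vs = refl
  shift (x ∷ w) vs = begin
    ∂* v (λ u → matchings u vs) (x ∷ w)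
      ≡⟨ ∂*-∷ v x w (λ u → matchings u vs) ⟩
    ind (x ==ᵥ v) * matchings w vs + ∑ (derivWord v w) (λ u → ∑ (derivWord x vs) (matchings u))
      ≡⟨ cong₂ (λ a b → ind a * matchings w vs + b) (==ᵥ-sym x v) (∑-swap (derivWord v w) (derivWord x vs) matchings) ⟩
    ind (v ==ᵥ x) * matchings w vs + ∑ (derivWord x vs) (λ z → ∂* v (λ u → matchings u z) w)
      ≡⟨ cong (ind (v ==ᵥ x) * matchings w vs ℕ.+_) (∑-cong (derivWord x vs) (shift w)) ⟩
    ind (v ==ᵥ x) * matchings w vs + ∂* x (λ z → matchings w (v ∷ z)) vs
      ≡⟨ ∂*-∷ x v vs (matchings w) ⟨
    matchings (x ∷ w) (v ∷ vs) ∎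

matchings-↭ˡ : ∀ {n} {vs vs′ : List (Var n)} w → vs ↭ vs′ → matchings vs w ≡ matchings vs′ w
matchings-↭ˡ {vs = vs} {vs′} w p =
  trans (matchings-sym vs w) (trans (matchings-↭ʳ w p) (matchings-sym w vs′))

matchings-zero : ∀ {n} (vs w : List (Var n)) → ¬ (w ↭ vs) → matchings vs w ≡ 0
matchings-zero []       []      np = contradiction ↭-refl np
matchings-zero []       (_ ∷ _) np = refl
matchings-zero (v ∷ vs) w       np = ∑-zero-∈ (derivWord v w) λ u u∈ →
  matchings-zero vs u λ p → np (↭-trans (derivWord-↭ v w u u∈) (prep v p))

-- Defined through the letters that a derivative can delete, so that a constant summed over
-- `derivWord` gives the multiplicity as a factor.
multiplicity : ∀ {n} → Word n → Matrix n
multiplicity w i j = length (derivWord (i , j) w)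

∑-const : ∀ (xs : List X) a → ∑ xs (λ _ → a) ≡ length xs * a
∑-const []       a = refl
∑-const (x ∷ xs) a = cong (a ℕ.+_) (∑-const xs a)

length-∂* : ∀ {n} (v : Var n) w → length (derivWord v w) ≡ ∂* v (λ _ → 1) w
length-∂* v w = sym (trans (∑-const (derivWord v w) 1) (ℕP.*-identityʳ _))

multiplicity-∷ : ∀ {n} (a b : Fin n) w i j → multiplicity ((a , b) ∷ w) i j ≡ δ a i * δ b j + multiplicity w i j
multiplicity-∷ a b w i j = begin
  length (derivWord (i , j) ((a , b) ∷ w))                      ≡⟨ length-∂* (i , j) ((a , b) ∷ w) ⟩
  ∂* (i , j) (λ _ → 1) ((a , b) ∷ w)                            ≡⟨ ∂*-∷ (i , j) (a , b) w (λ _ → 1) ⟩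
  ind ((a , b) ==ᵥ (i , j)) * 1 + ∂* (i , j) (λ _ → 1) w        ≡⟨ cong₂ _+_ (trans (ℕP.*-identityʳ _) (ind-==ᵥ a b i j)) (sym (length-∂* (i , j) w)) ⟩
  δ a i * δ b j + multiplicity w i j ∎
  where open ≡-Reasoning

multiplicity-↭ : ∀ {n} {w w′ : Word n} → w ↭ w′ → ∀ i j → multiplicity w i j ≡ multiplicity w′ i j
multiplicity-↭ {w = w} {w′} p i j =
  trans (length-∂* (i , j) w) (trans (∂*-↭ (i , j) (λ _ → 1) (λ _ → refl) p) (sym (length-∂* (i , j) w′)))

multiplicity-++ : ∀ {n} (w w′ : Word n) i j → multiplicity (w ++ w′) i j ≡ multiplicity w i j + multiplicity w′ i j
multiplicity-++ []            w′ i j = refl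
multiplicity-++ ((a , b) ∷ w) w′ i j
  rewrite multiplicity-∷ a b (w ++ w′) i j | multiplicity-∷ a b w i j | multiplicity-++ w w′ i j
  = sym (ℕP.+-assoc (δ a i * δ b j) (multiplicity w i j) _)

multiplicity-∉ : ∀ {n} (w : Word n) i j → (i , j) ∉ w → multiplicity w i j ≡ 0
multiplicity-∉ w i j ∉w with derivWord (i , j) w in eq
... | []     = refl
... | u ∷ us = contradiction
  (↭P.∈-resp-↭ (↭-sym (derivWord-↭ (i , j) w u (subst (u ∈_) (sym eq) (here refl)))) (here refl)) ∉w

multiplicity-∈ : ∀ {n} {w : Word n} {i j} → (i , j) ∈ w → ∃ λ r → multiplicity w i j ≡ suc r
multiplicity-∈ {w = .((i , j) ∷ _)} {i} {j} (here {xs = w} refl)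
  rewrite multiplicity-∷ i j w i j | δ-refl i | δ-refl j = _ , refl
multiplicity-∈ {w = (a , b) ∷ w} {i} {j} (there p) with multiplicity-∈ p
... | r , eq rewrite multiplicity-∷ a b w i j | eq = _ , ℕP.+-suc (δ a i * δ b j) r

-- walks l s t w counts the walks s → t of length l traversing each arc of the
-- multiset w exactly once, parallel arcs being distinguished.
walks : ∀ {n} → ℕ → Fin n → Fin n → Word n → ℕ
walks         zero    s t w = δ s t * ind (null w)
walks {n} (suc l) s t w = ∑ (allFin n) λ j → ∑ (derivWord (s , j) w) (walks l j t)

∑-allLists : ∀ l n (f : List (Fin n) → ℕ) →
             ∑ (allLists (suc l) n) f ≡ ∑ (allFin n) (λ j → ∑ (allLists l n) (λ p → f (j ∷ p)))
∑-allLists l n f = trans (∑-concatMap _ (allFin n) f) (∑-cong (allFin n) λ j → ∑-map (j ∷_) (allLists l n) f)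

-- One step of `walks` chooses the next vertex and the copy of the arc that leads to it. The l inner
-- vertices of p make l + 1 arcs.
matchings-walks : ∀ {n} l (s t : Fin n) (w : Word n) →
  ∑ (allLists l n) (λ p → matchings (zip (s ∷ p) (p ++ (t ∷ []))) w) ≡ walks (suc l) s t w
matchings-walks {n} zero s t w = begin
  ∑ (derivWord (s , t) w) (ind ∘ null) + 0
    ≡⟨ ℕP.+-identityʳ _ ⟩
  ∑ (derivWord (s , t) w) (ind ∘ null)
    ≡⟨ ∑-δ t (λ j → ∑ (derivWord (s , j) w) (ind ∘ null)) ⟨
  ∑ (allFin n) (λ j → δ t j * ∑ (derivWord (s , j) w) (ind ∘ null))
    ≡⟨ ∑-cong (allFin n) (λ j → trans (cong (_* ∑ (derivWord (s , j) w) (ind ∘ null)) (δ-sym t j))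
         (sym (∑-*ˡ (derivWord (s , j) w) (δ j t) (ind ∘ null)))) ⟩
  walks 1 s t w ∎
  where open ≡-Reasoning
matchings-walks {n} (suc l) s t w = begin
  ∑ (allLists (suc l) n) (λ p → matchings (zip (s ∷ p) (p ++ (t ∷ []))) w)
    ≡⟨ ∑-allLists l n (λ p → matchings (zip (s ∷ p) (p ++ (t ∷ []))) w) ⟩
  ∑ (allFin n) (λ j → ∑ (allLists l n) (λ p → ∑ (derivWord (s , j) w) (matchings (zip (j ∷ p) (p ++ (t ∷ []))))))
    ≡⟨ ∑-cong (allFin n) (λ j → trans
         (∑-swap (allLists l n) (derivWord (s , j) w) (λ p → matchings (zip (j ∷ p) (p ++ (t ∷ [])))))
         (∑-cong (derivWord (s , j) w) (matchings-walks l j t))) ⟩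
  walks (suc (suc l)) s t w ∎
  where open ≡-Reasoning

module _ {n} {s j : Fin n} (w : Word n) {u : Word n} (u∈ : u ∈ derivWord (s , j) w) where

  private
    w↭ : w ↭ (s , j) ∷ u
    w↭ = derivWord-↭ (s , j) w u u∈

  step-multiplicity : ∀ a b → multiplicity w a b ≡ δ s a * δ j b + multiplicity u a b
  step-multiplicity a b = trans (multiplicity-↭ w↭ a b) (multiplicity-∷ s j u a b)

  step-outdeg : ∀ v → outdeg (multiplicity w) v ≡ δ s v + outdeg (multiplicity u) v
  step-outdeg v = begin
    ∑ (allFin n) (multiplicity w v)                                       ≡⟨ ∑-cong (allFin n) (step-multiplicity v) ⟩
    ∑ (allFin n) (λ b → δ s v * δ j b + multiplicity u v b)               ≡⟨ ∑-+ (allFin n) _ _ ⟩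
    ∑ (allFin n) (λ b → δ s v * δ j b) + outdeg (multiplicity u) v        ≡⟨ cong (_+ outdeg (multiplicity u) v) (trans (∑-cong (allFin n) λ b → ℕP.*-comm (δ s v) (δ j b)) (∑-δ j (λ _ → δ s v))) ⟩
    δ s v + outdeg (multiplicity u) v ∎
    where open ≡-Reasoning

  step-indeg : ∀ v → indeg (multiplicity w) v ≡ δ j v + indeg (multiplicity u) v
  step-indeg v = begin
    ∑ (allFin n) (λ a → multiplicity w a v)                               ≡⟨ ∑-cong (allFin n) (λ a → step-multiplicity a v) ⟩
    ∑ (allFin n) (λ a → δ s a * δ j v + multiplicity u a v)               ≡⟨ ∑-+ (allFin n) _ _ ⟩
    ∑ (allFin n) (λ a → δ s a * δ j v) + indeg (multiplicity u) v         ≡⟨ cong (_+ indeg (multiplicity u) v) (∑-δ s (λ _ → δ j v)) ⟩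
    δ j v + indeg (multiplicity u) v ∎
    where open ≡-Reasoning

  step-length : length w ≡ suc (length u)
  step-length = ↭P.↭-length w↭

-- Eulerian trails

∑≡0⇒ : ∀ (xs : List X) (f : X → ℕ) → ∑ xs f ≡ 0 → ∀ {x} → x ∈ xs → f x ≡ 0
∑≡0⇒ (x ∷ xs) f eq (here refl) = ℕP.m+n≡0⇒m≡0 (f x) eq
∑≡0⇒ (x ∷ xs) f eq (there p)   = ∑≡0⇒ xs f (ℕP.m+n≡0⇒n≡0 (f x) eq) p

module _ {n} (s : Fin n) (w : Word n) where

  ∑-arcs-const : ∀ (f : Fin n → Word n → ℕ) a → (∀ j u → u ∈ derivWord (s , j) w → f j u ≡ a) →
                 ∑ (allFin n) (λ j → ∑ (derivWord (s , j) w) (f j)) ≡ outdeg (multiplicity w) s * a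
  ∑-arcs-const f a eq = trans
    (∑-cong (allFin n) λ j → trans (∑-cong-∈ (derivWord (s , j) w) (eq j)) (∑-const (derivWord (s , j) w) a))
    (∑-*ʳ (allFin n) a (multiplicity w s))

  -- Euler's identity for the linear dependence on row s.
  forests-euler : ∀ {A} → Unique A → s ∈ A →
    ∑ (allFin n) (λ j → ∑ (derivWord (s , j) w) (λ u → forests A (multiplicity u))) + forests A (multiplicity w)
      ≡ outdeg (multiplicity w) s * forests A (multiplicity w)
  forests-euler {A} uA s∈A = begin
    ∑ (allFin n) (λ j → ∑ (derivWord (s , j) w) (λ u → forests A (multiplicity u))) + F
      ≡⟨ cong (∑ (allFin n) (λ j → ∑ (derivWord (s , j) w) (λ u → forests A (multiplicity u))) ℕ.+_)
           (trans (lin (multiplicity w) λ _ _ _ → refl)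
                  (∑-cong (allFin n) λ j → sym (∑-const (derivWord (s , j) w) (α j)))) ⟩
    ∑ (allFin n) (λ j → ∑ (derivWord (s , j) w) (λ u → forests A (multiplicity u)))
      + ∑ (allFin n) (λ j → ∑ (derivWord (s , j) w) (λ _ → α j))
      ≡⟨ ∑-+ (allFin n) _ _ ⟨
    ∑ (allFin n) (λ j → ∑ (derivWord (s , j) w) (λ u → forests A (multiplicity u)) + ∑ (derivWord (s , j) w) (λ _ → α j))
      ≡⟨ ∑-cong (allFin n) (λ j → sym (∑-+ (derivWord (s , j) w) _ _)) ⟩
    ∑ (allFin n) (λ j → ∑ (derivWord (s , j) w) (λ u → forests A (multiplicity u) + α j))
      ≡⟨ ∑-arcs-const _ F (λ j u u∈ → sym (split j u u∈)) ⟩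
    outdeg (multiplicity w) s * F ∎
    where
    open ≡-Reasoning
    F : ℕ
    F = forests A (multiplicity w)
    α : Fin n → ℕ
    α = proj₁ (forests-linear uA s∈A (multiplicity w))
    lin : ∀ c′ → (∀ i → i ≢ s → ∀ j → c′ i j ≡ multiplicity w i j) →
          forests A c′ ≡ ∑ (allFin n) (λ j → c′ s j * α j)
    lin = proj₂ (forests-linear uA s∈A (multiplicity w))
    -- Removing an arc s → j lowers row s by the unit vector at j, so by linearity the forest count
    -- drops by α j.
    split : ∀ j u → u ∈ derivWord (s , j) w → F ≡ forests A (multiplicity u) + α j
    split j u u∈ = begin
      F
        ≡⟨ lin (multiplicity w) (λ _ _ _ → refl) ⟩
      ∑ (allFin n) (λ b → multiplicity w s b * α b)
        ≡⟨ ∑-cong (allFin n) entry ⟩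
      ∑ (allFin n) (λ b → multiplicity u s b * α b + δ j b * α b)
        ≡⟨ ∑-+ (allFin n) _ _ ⟩
      ∑ (allFin n) (λ b → multiplicity u s b * α b) + ∑ (allFin n) (λ b → δ j b * α b)
        ≡⟨ cong₂ _+_ (sym (lin (multiplicity u) other)) (∑-δ j α) ⟩
      forests A (multiplicity u) + α j ∎
      where
      entry : ∀ b → multiplicity w s b * α b ≡ multiplicity u s b * α b + δ j b * α b
      entry b = trans
        (cong (_* α b) (trans (step-multiplicity w u∈ s b) (cong (λ z → z * δ j b + multiplicity u s b) (δ-refl s))))
        (distr (δ j b) (multiplicity u s b) (α b))
        where
        distr : ∀ a b c → (1 * a + b) * c ≡ b * c + a * c
        distr = solve-∀
      other : ∀ i → i ≢ s → ∀ b → multiplicity u i b ≡ multiplicity w i b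
      other i i≢s b = sym (trans (step-multiplicity w u∈ i b) (cong (λ z → z * δ j b + multiplicity u i b) (δ-≢ (i≢s ∘ sym))))

-- The arcs of w remain to be used by a trail that is at s and has to end at t;
-- A is the set of vertices other than t that still have to be left.
record Trail {n} (s t : Fin n) (A : List (Fin n)) (w : Word n) : Set where
  field
    unique   : Unique A
    t∉A      : t ∉ A
    start    : s ≡ t ⊎ s ∈ A
    positive : ∀ v → v ∈ A → outdeg (multiplicity w) v ≢ 0
    vanish   : ∀ v → v ∉ A → v ≢ t → outdeg (multiplicity w) v ≡ 0
    balanced : ∀ v → indeg (multiplicity w) v + δ s v ≡ outdeg (multiplicity w) v + δ t v

module _ {n} {s t : Fin n} {A : List (Fin n)} {w : Word n} (tr : Trail s t A w) where
  open Trail tr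
  open import Data.List.Membership.DecPropositional (Fin._≟_ {n}) using (_∈?_)

  -- In `balanced` the current position counts as an arrival and the end t as a departure. After the
  -- step the arrival at s is replaced by an arrival at j, while the arc s → j disappears from both
  -- degrees.
  step-balanced : ∀ {j u} → u ∈ derivWord (s , j) w →
                  ∀ v → indeg (multiplicity u) v + δ j v ≡ outdeg (multiplicity u) v + δ t v
  step-balanced {j} {u} u∈ v = ℕP.+-cancelˡ-≡ (δ s v) _ _
    (trans (rearrange (δ s v) (indeg (multiplicity u) v) (δ j v))
    (trans (cong (_+ δ s v) (sym (step-indeg w u∈ v)))
    (trans (balanced v)
    (trans (cong (_+ δ t v) (step-outdeg w u∈ v)) (ℕP.+-assoc (δ s v) _ _)))))
    where
    rearrange : ∀ a b c → a + (b + c) ≡ c + b + a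
    rearrange = solve-∀

  indeg-zero : ∀ v → outdeg (multiplicity w) v + δ t v ≡ δ s v → indeg (multiplicity w) v ≡ 0
  indeg-zero v eq = ℕP.+-cancelʳ-≡ (δ s v) _ 0 (trans (balanced v) eq)

  indeg-vanish : ∀ v → v ∉ A → v ≢ t → indeg (multiplicity w) v ≡ 0
  indeg-vanish v v∉ v≢t = indeg-zero v (trans (cong₂ _+_ (vanish v v∉ v≢t) (δ-≢ (v≢t ∘ sym))) (sym (δ-≢ s≢v)))
    where
    s≢v : s ≢ v
    s≢v refl with start
    ... | inj₁ s≡t = v≢t s≡t
    ... | inj₂ s∈A = v∉ s∈A

  -- The vertex j is entered by an arc, whereas balance gives in-degree 0 to every vertex other than
  -- t that has nothing left to leave it.
  step-start : ∀ {j u} → u ∈ derivWord (s , j) w → j ≡ t ⊎ j ∈ A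
  step-start {j} {u} u∈ with j Fin.≟ t | j ∈? A
  ... | yes eq | _      = inj₁ eq
  ... | no _   | yes j∈ = inj₂ j∈
  ... | no j≢t | no j∉  = contradiction
    (trans (sym (indeg-vanish j j∉ j≢t)) (trans (step-indeg w u∈ j) (cong (_+ indeg (multiplicity u) j) (δ-refl j)))) λ ()

  step-outdeg-≢ : ∀ {j u} → u ∈ derivWord (s , j) w → ∀ v → v ≢ s → outdeg (multiplicity u) v ≡ outdeg (multiplicity w) v
  step-outdeg-≢ u∈ v v≢s = sym (trans (step-outdeg w u∈ v) (cong (_+ _) (δ-≢ (v≢s ∘ sym))))

  step-forests : ∀ {j u} → u ∈ derivWord (s , j) w → ∀ B → s ∉ B → forests B (multiplicity u) ≡ forests B (multiplicity w)
  step-forests {j} {u} u∈ B s∉ = forests-cong B λ i i∈ b →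
    sym (trans (step-multiplicity w u∈ i b) (cong (λ z → z * δ j b + multiplicity u i b) (δ-≢ {i = s} {i} λ { refl → s∉ i∈ })))

  step-∏ : ∀ {j u} → u ∈ derivWord (s , j) w → ∀ B → s ∉ B →
           ∏ B (λ v → (outdeg (multiplicity u) v ∸ 1) !) ≡ ∏ B (λ v → (outdeg (multiplicity w) v ∸ 1) !)
  step-∏ u∈ B s∉ = ∏-cong-∈ B λ v v∈ → cong (λ z → (z ∸ 1) !) (step-outdeg-≢ u∈ v λ { refl → s∉ v∈ })

  step-keep : ∀ {j u} → u ∈ derivWord (s , j) w → (s ∈ A → outdeg (multiplicity u) s ≢ 0) → Trail j t A u
  step-keep {u = u} u∈ pos = record
    { unique   = unique
    ; t∉A      = t∉A
    ; start    = step-start u∈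
    ; positive = λ v v∈ → pos′ v v∈
    ; vanish   = λ v v∉ v≢t → trans (step-outdeg-≢ u∈ v (v≢s v v∉ v≢t)) (vanish v v∉ v≢t)
    ; balanced = step-balanced u∈
    }
    where
    pos′ : ∀ v → v ∈ A → outdeg (multiplicity u) v ≢ 0
    pos′ v v∈ with v Fin.≟ s
    ... | yes refl = pos v∈
    ... | no v≢s   = λ eq → positive v v∈ (trans (sym (step-outdeg-≢ u∈ v v≢s)) eq)
    v≢s : ∀ v → v ∉ A → v ≢ t → v ≢ s
    v≢s v v∉ v≢t refl with start
    ... | inj₁ eq = v≢t eq
    ... | inj₂ s∈ = v∉ s∈

  step-leave : ∀ {j u} → u ∈ derivWord (s , j) w → (p : s ∈ A) → outdeg (multiplicity u) s ≡ 0 → Trail j t (A ─ p) u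
  step-leave {j} {u} u∈ p out0 = record
    { unique   = ─-unique unique p
    ; t∉A      = λ q → t∉A (─-⊆ p q)
    ; start    = start′
    ; positive = λ v v∈ eq → positive v (─-⊆ p v∈)
                   (trans (sym (step-outdeg-≢ u∈ v λ { refl → ─-∉ unique p v∈ })) eq)
    ; vanish   = vanish′
    ; balanced = step-balanced u∈
    }
    where
    t≢s : t ≢ s
    t≢s refl = t∉A p
    -- If the last arc out of s were a loop, the trail would stand at s ≠ t without an exit, against
    -- balance.
    j≢s : j ≢ s
    j≢s refl = contradiction
      (trans (sym (cong (indeg (multiplicity u) s ℕ.+_) (δ-refl s)))
             (trans (step-balanced u∈ s) (cong₂ _+_ out0 (δ-≢ t≢s))))
      (λ eq → contradiction (ℕP.m+n≡0⇒n≡0 (indeg (multiplicity u) s) eq) λ ())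
    start′ : j ≡ t ⊎ j ∈ (A ─ p)
    start′ with step-start u∈
    ... | inj₁ eq = inj₁ eq
    ... | inj₂ j∈ = inj₂ (∈-─ p j∈ j≢s)
    vanish′ : ∀ v → v ∉ (A ─ p) → v ≢ t → outdeg (multiplicity u) v ≡ 0
    vanish′ v v∉ v≢t with v Fin.≟ s
    ... | yes refl = out0
    ... | no v≢s   = trans (step-outdeg-≢ u∈ v v≢s) (vanish v (λ q → v∉ (∈-─ p q v≢s)) v≢t)

-- The BEST theorem.
walks-forests : ∀ {n} l {s t : Fin n} {A w} → length w ≡ l → Trail s t A w →
  walks l s t w ≡ forests A (multiplicity w) * ∏ A (λ v → (outdeg (multiplicity w) v ∸ 1) !) * outdeg (multiplicity w) t !
walks-forests {n} zero {s} {t} {[]} {[]} _ tr with Trail.start tr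
... | inj₁ refl rewrite δ-refl s | ∑-zero (allFin n) {f = λ _ → 0} (λ _ → refl) = refl
walks-forests {n} zero {A = a ∷ A} {[]} _ tr =
  contradiction (∑-zero (allFin n) {f = λ _ → 0} λ _ → refl) (Trail.positive tr a (here refl))
walks-forests {n} (suc l) {s} {t} {A} {w} len tr with Trail.start tr
... | inj₁ refl = trans (∑-arcs-const s w (λ j → walks l j t) (F * P * (o ∸ 1) !) visit) (close o refl)
  where
  open ≡-Reasoning
  open Trail tr
  o F P : ℕ
  o = outdeg (multiplicity w) t
  F = forests A (multiplicity w)
  P = ∏ A (λ v → (outdeg (multiplicity w) v ∸ 1) !)
  -- `forests A` does not read row t, so leaving t changes nothing but the out-degree of t.
  visit : ∀ j u → u ∈ derivWord (s , j) w → walks l j t u ≡ F * P * (o ∸ 1) !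
  visit j u u∈ = trans
    (walks-forests l (ℕP.suc-injective (trans (sym (step-length w u∈)) len))
      (step-keep tr u∈ λ s∈ → contradiction s∈ t∉A))
    (cong₂ _*_ (cong₂ _*_ (step-forests tr u∈ A t∉A) (step-∏ tr u∈ A t∉A))
      (cong _! (sym (trans (cong (_∸ 1) (step-outdeg w u∈ t)) (cong (λ z → z + outdeg (multiplicity u) t ∸ 1) (δ-refl t))))))
  open import Data.List.Membership.DecPropositional (Fin._≟_ {n}) using (_∈?_)
  -- Here no walk exists although `o !` is 1, so the forest count must vanish. Arcs remain, all of
  -- their tails lie in A, and by balance no arc enters a vertex outside A.
  stuck : o ≡ 0 → F ≡ 0
  stuck o≡0 = helper w refl len
    where
    tail∈ : ∀ a b → (a , b) ∈ w → a ∈ A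
    tail∈ a b ab∈ with a ∈? A
    ... | yes a∈ = a∈
    ... | no a∉ with multiplicity-∈ ab∈
    ...   | r , eq = contradiction (trans (sym eq) (∑≡0⇒ (allFin n) (multiplicity w a) out0 (∈-allFin b))) λ ()
      where
      out0 : outdeg (multiplicity w) a ≡ 0
      out0 with a Fin.≟ t
      ... | yes refl = o≡0
      ... | no a≢t   = vanish a a∉ a≢t
    closed : ∀ i → i ∈ A → ∀ j → j ∉ A → multiplicity w i j ≡ 0
    closed i i∈ j j∉ = ∑≡0⇒ (allFin n) (λ i → multiplicity w i j) in0 (∈-allFin i)
      where
      in0 : indeg (multiplicity w) j ≡ 0
      in0 with j Fin.≟ t
      ... | yes refl = indeg-zero tr t (cong (_+ δ t t) o≡0)
      ... | no j≢t   = indeg-vanish tr j j∉ j≢t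
    helper : ∀ w′ → w′ ≡ w → length w′ ≡ suc l → F ≡ 0
    helper ((a , b) ∷ w′) refl _ = forests-noExit (tail∈ a b (here refl)) (multiplicity w) closed
  close : ∀ r → o ≡ r → r * (F * P * (r ∸ 1) !) ≡ F * P * r !
  close zero    o≡0 rewrite stuck o≡0 = refl
  close (suc r) _ = commute (suc r) (F * P) (r !)
    where
    commute : ∀ a b c → a * (b * c) ≡ b * (a * c)
    commute = solve-∀
... | inj₂ p = leave (outdeg (multiplicity w) s) refl
  where
  open ≡-Reasoning
  open Trail tr
  t≢s : t ≢ s
  t≢s refl = t∉A p
  F P Q : ℕ
  F = forests A (multiplicity w)
  P = ∏ (A ─ p) (λ v → (outdeg (multiplicity w) v ∸ 1) !)
  Q = outdeg (multiplicity w) t !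
  walked : ∀ {j u} → u ∈ derivWord (s , j) w → length u ≡ l
  walked u∈ = ℕP.suc-injective (trans (sym (step-length w u∈)) len)
  remaining : ∀ {j u r} → outdeg (multiplicity w) s ≡ suc r → u ∈ derivWord (s , j) w → outdeg (multiplicity u) s ≡ r
  remaining {u = u} eq u∈ = ℕP.suc-injective
    (trans (sym (trans (step-outdeg w u∈ s) (cong (_+ outdeg (multiplicity u) s) (δ-refl s)))) eq)
  product : ∀ {r} → outdeg (multiplicity w) s ≡ r → ∏ A (λ v → (outdeg (multiplicity w) v ∸ 1) !) ≡ (r ∸ 1) ! * P
  product eq = trans (∏-─ p _) (cong (λ z → (z ∸ 1) ! * P) eq)
  leave : ∀ r → outdeg (multiplicity w) s ≡ r →
          walks (suc l) s t w ≡ F * ∏ A (λ v → (outdeg (multiplicity w) v ∸ 1) !) * Q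
  leave zero o≡0 = contradiction o≡0 (positive s p)
  -- With a single exit left, balance at s ≠ t gives s in-degree 0, so s is a leaf of every forest
  -- and drops out of A.
  leave (suc zero) o≡1 = begin
    walks (suc l) s t w
      ≡⟨ ∑-arcs-const s w (λ j → walks l j t) (forests (A ─ p) (multiplicity w) * P * Q) visit ⟩
    outdeg (multiplicity w) s * (forests (A ─ p) (multiplicity w) * P * Q)
      ≡⟨ regroup (outdeg (multiplicity w) s) (forests (A ─ p) (multiplicity w)) P Q ⟩
    outdeg (multiplicity w) s * forests (A ─ p) (multiplicity w) * (1 * P) * Q
      ≡⟨ cong₂ (λ a b → a * b * Q) (forests-leaf unique p (multiplicity w) column) (product o≡1) ⟨
    F * ∏ A (λ v → (outdeg (multiplicity w) v ∸ 1) !) * Q ∎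
    where
    regroup : ∀ a b c d → a * (b * c * d) ≡ a * b * (1 * c) * d
    regroup = solve-∀
    column : ∀ i → i ∈ A → multiplicity w i s ≡ 0
    column i _ = ∑≡0⇒ (allFin n) (λ i → multiplicity w i s)
      (indeg-zero tr s (trans (cong₂ _+_ o≡1 (δ-≢ t≢s)) (sym (δ-refl s)))) (∈-allFin i)
    visit : ∀ j u → u ∈ derivWord (s , j) w → walks l j t u ≡ forests (A ─ p) (multiplicity w) * P * Q
    visit j u u∈ = trans (walks-forests l (walked u∈) (step-leave tr u∈ p (remaining o≡1 u∈)))
      (cong₂ _*_ (cong₂ _*_ (step-forests tr u∈ (A ─ p) (─-∉ unique p)) (step-∏ tr u∈ (A ─ p) (─-∉ unique p)))
        (cong _! (step-outdeg-≢ tr u∈ t t≢s)))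
  -- An exit of s remains after the step, so A is unchanged. Euler's identity gives `suc r * F`, and
  -- `suc r` extends the factor `r !` of the shorter words to the one that s has in w.
  leave (suc (suc r)) o≡ = begin
    walks (suc l) s t w
      ≡⟨ ∑-cong (allFin n) (λ j → ∑-cong-∈ (derivWord (s , j) w) (visit j)) ⟩
    ∑ (allFin n) (λ j → ∑ (derivWord (s , j) w) (λ u → forests A (multiplicity u) * (r ! * P * Q)))
      ≡⟨ ∑-cong (allFin n) (λ j → ∑-*ʳ (derivWord (s , j) w) (r ! * P * Q) (λ u → forests A (multiplicity u))) ⟩
    ∑ (allFin n) (λ j → ∑ (derivWord (s , j) w) (λ u → forests A (multiplicity u)) * (r ! * P * Q))
      ≡⟨ ∑-*ʳ (allFin n) (r ! * P * Q) _ ⟩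
    E * (r ! * P * Q)
      ≡⟨ cong (_* (r ! * P * Q)) euler ⟩
    suc r * F * (r ! * P * Q)
      ≡⟨ regroup (suc r) F (r !) P Q ⟩
    F * (suc r * r ! * P) * Q
      ≡⟨ cong (λ z → F * z * Q) (product o≡) ⟨
    F * ∏ A (λ v → (outdeg (multiplicity w) v ∸ 1) !) * Q ∎
    where
    E : ℕ
    E = ∑ (allFin n) (λ j → ∑ (derivWord (s , j) w) (λ u → forests A (multiplicity u)))
    euler : E ≡ suc r * F
    euler = ℕP.+-cancelʳ-≡ F E (suc r * F)
      (trans (forests-euler s w unique p) (trans (cong (_* F) o≡) (ℕP.+-comm F (suc r * F))))
    regroup : ∀ a b c d e → a * b * (c * d * e) ≡ b * (a * c * d) * e
    regroup = solve-∀
    visit : ∀ j u → u ∈ derivWord (s , j) w → walks l j t u ≡ forests A (multiplicity u) * (r ! * P * Q)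
    visit j u u∈ = begin
      walks l j t u
        ≡⟨ walks-forests l (walked u∈) (step-keep tr u∈ λ _ eq → contradiction (trans (sym (remaining o≡ u∈)) eq) λ ()) ⟩
      forests A (multiplicity u) * ∏ A (λ v → (outdeg (multiplicity u) v ∸ 1) !) * outdeg (multiplicity u) t !
        ≡⟨ cong₂ (λ a b → forests A (multiplicity u) * a * b)
             (trans (∏-─ p _) (cong₂ (λ a b → (a ∸ 1) ! * b) (remaining o≡ u∈) (step-∏ tr u∈ (A ─ p) (─-∉ unique p))))
             (cong _! (step-outdeg-≢ tr u∈ t t≢s)) ⟩
      forests A (multiplicity u) * (r ! * P) * Q
        ≡⟨ ℕP.*-assoc (forests A (multiplicity u)) (r ! * P) Q ⟩
      forests A (multiplicity u) * (r ! * P * Q) ∎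

-- Closed trails in a hypergraph

χ : ∀ {n} → Subset n → Fin n → ℕ
χ e v = ind (Vec.lookup e v)

members : ∀ {n} → Subset n → List (Fin n)
members {n} e = filterᵇ (Vec.lookup e) (allFin n)

others : ∀ {n} → Subset n → Fin n → List (Fin n)
others {n} e i = filterᵇ (λ j → Vec.lookup e j ∧ not (does (i Fin.≟ j))) (allFin n)

∈-filterᵇ⁺ : ∀ (p : X → Bool) {xs x} → x ∈ xs → p x ≡ true → x ∈ filterᵇ p xs
∈-filterᵇ⁺ p {x ∷ xs} (here refl) eq rewrite eq = here refl
∈-filterᵇ⁺ p {y ∷ xs} (there q)   eq with p y
... | true  = there (∈-filterᵇ⁺ p q eq)
... | false = ∈-filterᵇ⁺ p q eq

∈-filterᵇ⁻ : ∀ (p : X → Bool) xs {x} → x ∈ filterᵇ p xs → p x ≡ true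
∈-filterᵇ⁻ p (y ∷ xs) q with p y in eq
∈-filterᵇ⁻ p (y ∷ xs) (here refl) | true  = eq
∈-filterᵇ⁻ p (y ∷ xs) (there q)   | true  = ∈-filterᵇ⁻ p xs q
∈-filterᵇ⁻ p (y ∷ xs) q           | false = ∈-filterᵇ⁻ p xs q

∑-filterᵇ : ∀ (p : X → Bool) xs (f : X → ℕ) → ∑ (filterᵇ p xs) f ≡ ∑ xs (λ x → ind (p x) * f x)
∑-filterᵇ p []       f = refl
∑-filterᵇ p (x ∷ xs) f with p x
... | true  = cong₂ _+_ (sym (ℕP.*-identityˡ (f x))) (∑-filterᵇ p xs f)
... | false = ∑-filterᵇ p xs f

length-filterᵇ : ∀ (p : X → Bool) xs → length (filterᵇ p xs) ≡ ∑ xs (ind ∘ p)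
length-filterᵇ p []       = refl
length-filterᵇ p (x ∷ xs) with p x
... | true  = cong suc (length-filterᵇ p xs)
... | false = length-filterᵇ p xs

filterᵇ-unique : ∀ (p : X → Bool) {xs} → Unique xs → Unique (filterᵇ p xs)
filterᵇ-unique p = UniqueP.filter⁺ (T? ∘ p)

allFin-suc : ∀ n → allFin (suc n) ≡ Fin.zero ∷ map Fin.suc (allFin n)
allFin-suc n = cong (Fin.zero ∷_) (sym (ListP.map-tabulate id Fin.suc))

∑-allFin-suc : ∀ n (f : Fin (suc n) → ℕ) → ∑ (allFin (suc n)) f ≡ f Fin.zero + ∑ (allFin n) (f ∘ Fin.suc)
∑-allFin-suc n f = trans (cong (λ xs → ∑ xs f) (allFin-suc n)) (cong (f Fin.zero ℕ.+_) (∑-map Fin.suc (allFin n) f))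

∑-χ : ∀ {n} (e : Subset n) → ∑ (allFin n) (χ e) ≡ ∣ e ∣
∑-χ Vec.[] = refl
∑-χ {suc n} (b Vec.∷ e) = trans (∑-allFin-suc n (χ (b Vec.∷ e))) (card b)
  where
  card : ∀ b → ind b + ∑ (allFin n) (χ e) ≡ ∣ b Vec.∷ e ∣
  card true  = cong suc (∑-χ e)
  card false = ∑-χ e

members-unique : ∀ {n} (e : Subset n) → Unique (members e)
members-unique {n} e = filterᵇ-unique (Vec.lookup e) (allFin-unique n)

∈-members⁺ : ∀ {n} (e : Subset n) {v} → Vec.lookup e v ≡ true → v ∈ members e
∈-members⁺ e = ∈-filterᵇ⁺ _ (∈-allFin _)

∈-members⁻ : ∀ {n} (e : Subset n) {v} → v ∈ members e → Vec.lookup e v ≡ true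
∈-members⁻ {n} e = ∈-filterᵇ⁻ _ (allFin n)

length-members : ∀ {n} (e : Subset n) → length (members e) ≡ ∣ e ∣
length-members {n} e = trans (length-filterᵇ (Vec.lookup e) (allFin n)) (∑-χ e)

χ≡1 : ∀ {n} (e : Subset n) {v} → Vec.lookup e v ≡ true → χ e v ≡ 1
χ≡1 e = cong ind

ind-others : ∀ {n} (e : Subset n) i j → ind (Vec.lookup e j ∧ not (does (i Fin.≟ j))) ≡ δ̅ i j * χ e j
ind-others e i j with Vec.lookup e j | does (i Fin.≟ j)
... | true  | true  = refl
... | true  | false = refl
... | false | true  = refl
... | false | false = refl

others-unique : ∀ {n} (e : Subset n) i → Unique (others e i)
others-unique {n} e i = filterᵇ-unique (λ j → Vec.lookup e j ∧ not (does (i Fin.≟ j))) (allFin-unique n)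

∈-others⁺ : ∀ {n} (e : Subset n) i {v} → Vec.lookup e v ≡ true → i ≢ v → v ∈ others e i
∈-others⁺ e i {v} v∈ i≢v = ∈-filterᵇ⁺ (λ j → Vec.lookup e j ∧ not (does (i Fin.≟ j))) (∈-allFin v) holds
  where
  holds : Vec.lookup e v ∧ not (does (i Fin.≟ v)) ≡ true
  holds rewrite v∈ with i Fin.≟ v
  ... | yes eq = contradiction eq i≢v
  ... | no _   = refl

∈-others⁻ : ∀ {n} (e : Subset n) i {v} → v ∈ others e i → Vec.lookup e v ≡ true × i ≢ v
∈-others⁻ {n} e i {v} v∈ with Vec.lookup e v | i Fin.≟ v | ∈-filterᵇ⁻ (λ j → Vec.lookup e j ∧ not (does (i Fin.≟ j))) (allFin n) v∈
... | true  | no i≢v | _ = refl , i≢v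

length-others : ∀ {n} (e : Subset n) i {m} → Vec.lookup e i ≡ true → ∣ e ∣ ≡ suc m → length (others e i) ≡ m
length-others {n} e i {m} i∈ card = ℕP.+-cancelʳ-≡ 1 _ m (begin
  length (others e i) + 1
    ≡⟨ cong₂ _+_ (trans (length-filterᵇ _ (allFin n)) (∑-cong (allFin n) (ind-others e i))) (sym (χ≡1 e i∈)) ⟩
  ∑ (allFin n) (λ j → δ̅ i j * χ e j) + χ e i
    ≡⟨ ∑-δ̅ i (χ e) ⟩
  ∑ (allFin n) (χ e)
    ≡⟨ trans (∑-χ e) card ⟩
  suc m
    ≡⟨ ℕP.+-comm 1 m ⟩
  m + 1 ∎)
  where open ≡-Reasoning

-- The arcs supplied by an adjacency entry of e at i, listed in one fixed order.
star : ∀ {n} → Fin n → Subset n → Word n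
star i e = map (i ,_) (others e i)

multiplicity-map : ∀ {n} (i : Fin n) l a b → multiplicity (map (i ,_) l) a b ≡ δ i a * ∑ l (λ j → δ j b)
multiplicity-map i []      a b = sym (ℕP.*-zeroʳ (δ i a))
multiplicity-map i (j ∷ l) a b = trans (multiplicity-∷ i j (map (i ,_) l) a b)
  (trans (cong (δ i a * δ j b ℕ.+_) (multiplicity-map i l a b)) (sym (ℕP.*-distribˡ-+ (δ i a) (δ j b) _)))

multiplicity-star : ∀ {n} (i : Fin n) e a b → multiplicity (star i e) a b ≡ δ i a * (δ̅ i b * χ e b)
multiplicity-star {n} i e a b = trans (multiplicity-map i (others e i) a b) (cong (δ i a ℕ.*_) (begin
  ∑ (others e i) (λ j → δ j b)
    ≡⟨ ∑-filterᵇ _ (allFin n) (λ j → δ j b) ⟩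
  ∑ (allFin n) (λ j → ind (Vec.lookup e j ∧ not (does (i Fin.≟ j))) * δ j b)
    ≡⟨ ∑-cong (allFin n) (λ j → trans (cong₂ _*_ (ind-others e i j) (δ-sym j b)) (ℕP.*-comm _ (δ b j))) ⟩
  ∑ (allFin n) (λ j → δ b j * (δ̅ i j * χ e j))
    ≡⟨ ∑-δ b (λ j → δ̅ i j * χ e j) ⟩
  δ̅ i b * χ e b ∎))
  where open ≡-Reasoning

-- For t = s this is `cycleWord s p` by definition; the free end t permits induction on p.
pathWord : ∀ {n} → Fin n → List (Fin n) → Fin n → Word n
pathWord s p t = zip (s ∷ p) (p ++ (t ∷ []))

path-first : ∀ {n} (s : Fin n) p t → ∃ λ b → (s , b) ∈ pathWord s p t
path-first s []      t = t , here refl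
path-first s (q ∷ p) t = q , here refl

path-next : ∀ {n} (s : Fin n) p t {i j} → (i , j) ∈ pathWord s p t → j ≡ t ⊎ ∃ λ b → (j , b) ∈ pathWord s p t
path-next s []      t (here refl) = inj₁ refl
path-next s (q ∷ p) t (here refl) with path-first q p t
... | b , b∈ = inj₂ (b , there b∈)
path-next s (q ∷ p) t (there a) with path-next q p t a
... | inj₁ eq       = inj₁ eq
... | inj₂ (b , b∈) = inj₂ (b , there b∈)

path-trapped : ∀ {n} (j : Fin n) p t → (∀ b → (j , b) ∈ pathWord j p t → b ≡ j) →
               ∀ {a b} → (a , b) ∈ pathWord j p t → a ≡ j
path-trapped j []      t loops (here refl) = refl
path-trapped j (q ∷ p) t loops (here refl) = refl
path-trapped j (q ∷ p) t loops (there a) with refl ← loops q (here refl) =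
  path-trapped j p t (λ b b∈ → loops b (there b∈)) a

path-end : ∀ {n} (j s : Fin n) p t → (∀ b → (j , b) ∈ pathWord s p t → b ≡ j) →
           ∀ {b} → (j , b) ∈ pathWord s p t → t ≡ j
path-end j s []      t loops (here refl) = loops t (here refl)
path-end j s (q ∷ p) t loops (here refl) with refl ← loops q (here refl) =
  path-end j j p t (λ b b∈ → loops b (there b∈)) (proj₂ (path-first j p t))
path-end j s (q ∷ p) t loops (there a) = path-end j q p t (λ b b∈ → loops b (there b∈)) a

-- The constant that the derivatives w extract from the trace of A^(l+1): closed trails with a
-- marked start, parallel arcs being distinguished.
closedTrails : ∀ {n} → ℕ → Word n → ℕ
closedTrails {n} l w = ∑ (allFin n) λ s → ∑ (allLists l n) λ p → matchings w (cycleWord s p)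

closedTrails-walks : ∀ {n} l (w : Word n) → closedTrails l w ≡ ∑ (allFin n) (λ s → walks (suc l) s s w)
closedTrails-walks {n} l w = ∑-cong (allFin n) λ s →
  trans (∑-cong (allLists l n) λ p → matchings-sym w (cycleWord s p)) (matchings-walks l s s w)

closedTrails-↭ : ∀ {n} l {w w′ : Word n} → w ↭ w′ → closedTrails l w ≡ closedTrails l w′
closedTrails-↭ {n} l p = ∑-cong (allFin n) λ s → ∑-cong (allLists l n) λ q → matchings-↭ˡ (cycleWord s q) p

closedTrails-zero : ∀ {n} l (w : Word n) → (∀ s p → ¬ (cycleWord s p ↭ w)) → closedTrails l w ≡ 0
closedTrails-zero {n} l w np = ∑-zero (allFin n) λ s → ∑-zero (allLists l n) λ p →
  matchings-zero w (cycleWord s p) (np s p)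

-- A vertex that is entered is also left: either the walk goes on, or it is back at its start, which
-- the first arc leaves.
closedTrails-deadEnd : ∀ {n} l (w : Word n) {i j} → (i , j) ∈ w → (∀ b → (j , b) ∉ w) → closedTrails l w ≡ 0
closedTrails-deadEnd l w ij∈ dead = closedTrails-zero l w λ s p w↭ →
  case path-next s p s (↭P.∈-resp-↭ (↭-sym w↭) ij∈) of λ where
    (inj₁ refl)     → dead _ (↭P.∈-resp-↭ w↭ (proj₂ (path-first s p s)))
    (inj₂ (b , b∈)) → dead b (↭P.∈-resp-↭ w↭ b∈)

-- A trail that visits j stays there and so ends at j. Being closed it also starts at j, and then no
-- arc with another tail is ever used.
closedTrails-trap : ∀ {n} l (w : Word n) {j b a c} → (j , b) ∈ w → (∀ b → (j , b) ∈ w → b ≡ j) →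
                    (a , c) ∈ w → a ≢ j → closedTrails l w ≡ 0
closedTrails-trap l w {j} jb∈ loops ac∈ a≢j = closedTrails-zero l w λ s p w↭ →
  let loops′ : ∀ b → (j , b) ∈ cycleWord s p → b ≡ j
      loops′ b b∈ = loops b (↭P.∈-resp-↭ w↭ b∈)
  in trapped s p loops′ (↭P.∈-resp-↭ (↭-sym w↭) ac∈) (path-end j s p s loops′ (↭P.∈-resp-↭ (↭-sym w↭) jb∈))
  where
  trapped : ∀ s p → (∀ b → (j , b) ∈ cycleWord s p → b ≡ j) → (_ , _) ∈ cycleWord s p → s ≡ j → ⊥
  trapped s p loops′ a∈ refl = a≢j (path-trapped s p s loops′ a∈)

walks-stuck : ∀ {n} l (s t : Fin n) w → outdeg (multiplicity w) s ≡ 0 → walks (suc l) s t w ≡ 0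
walks-stuck {n} l s t w out0 = ∑-zero (allFin n) λ j → empty j (∑≡0⇒ (allFin n) (multiplicity w s) out0 (∈-allFin j))
  where
  empty : ∀ j → length (derivWord (s , j) w) ≡ 0 → ∑ (derivWord (s , j) w) (walks l j t) ≡ 0
  empty j eq with derivWord (s , j) w
  ... | [] = refl

multiplicity-loops : ∀ {n} (i : Fin n) w → All (_≡ (i , i)) w → ∀ a b → multiplicity w a b ≡ δ i a * (δ i b * length w)
multiplicity-loops i []      []         a b = sym (trans (cong (δ i a ℕ.*_) (ℕP.*-zeroʳ (δ i b))) (ℕP.*-zeroʳ (δ i a)))
multiplicity-loops i (_ ∷ w) (refl ∷ al) a b = trans (multiplicity-∷ i i w a b)
  (trans (cong (δ i a * δ i b ℕ.+_) (multiplicity-loops i w al a b)) (collect (δ i a) (δ i b) (length w)))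
  where
  collect : ∀ x y z → x * y + x * (y * z) ≡ x * (y * (1 + z))
  collect = solve-∀

-- The loops may be traversed in any order. In the formula for trails A is empty, so only the
-- factorial of the out-degree of i remains.
closedTrails-loops : ∀ {n} l (i : Fin n) w → All (_≡ (i , i)) w → length w ≡ suc l → closedTrails l w ≡ suc l !
closedTrails-loops {n} l i w al len = begin
  closedTrails l w                              ≡⟨ closedTrails-walks l w ⟩
  ∑ (allFin n) (λ s → walks (suc l) s s w)      ≡⟨ ∑-single (allFin-unique n) (∈-allFin i) (λ s _ s≢i → walks-stuck l s s w (out0 s s≢i)) ⟩
  walks (suc l) i i w                           ≡⟨ walks-forests (suc l) len trail ⟩
  1 * 1 * outdeg (multiplicity w) i !           ≡⟨ cong (λ z → 1 * 1 * z !) (out i) ⟩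
  1 * 1 * (δ i i * length w) !                  ≡⟨ cong (λ z → 1 * 1 * (z * length w) !) (δ-refl i) ⟩
  1 * 1 * (1 * length w) !                      ≡⟨ trans (ℕP.*-identityˡ _) (cong _! (trans (ℕP.*-identityˡ _) len)) ⟩
  suc l ! ∎
  where
  open ≡-Reasoning
  out : ∀ v → outdeg (multiplicity w) v ≡ δ i v * length w
  out v = trans (∑-cong (allFin n) (λ b → trans (multiplicity-loops i w al v b) (commute (δ i v) (δ i b) (length w))))
                (∑-δ i (λ _ → δ i v * length w))
    where
    commute : ∀ x y z → x * (y * z) ≡ y * (x * z)
    commute = solve-∀
  inn : ∀ v → indeg (multiplicity w) v ≡ δ i v * length w
  inn v = trans (∑-cong (allFin n) (λ a → multiplicity-loops i w al a v)) (∑-δ i (λ _ → δ i v * length w))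
  out0 : ∀ s → s ≢ i → outdeg (multiplicity w) s ≡ 0
  out0 s s≢i = trans (out s) (cong (_* length w) (δ-≢ (s≢i ∘ sym)))
  trail : Trail i i [] w
  trail = record
    { unique   = []
    ; t∉A      = λ ()
    ; start    = inj₁ refl
    ; positive = λ _ ()
    ; vanish   = λ v _ v≢i → out0 v v≢i
    ; balanced = λ v → cong (_+ δ i v) (trans (inn v) (sym (out v)))
    }

outside-∈ : ∀ {n} {A : List (Fin n)} {w} → w ∈ A → outside A w ≡ 0
outside-∈ {w = w} (here refl) rewrite δ-refl w = refl
outside-∈ {A = a ∷ A} {w} (there p) rewrite outside-∈ p = ℕP.*-zeroʳ (δ̅ a w)

outside-∉ : ∀ {n} {A : List (Fin n)} {w} → w ∉ A → outside A w ≡ 1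
outside-∉ {A = []}        w∉ = refl
outside-∉ {A = a ∷ A} {w} w∉ rewrite outside-∉ {A = A} {w} (w∉ ∘ there) | δ-≢ {i = a} {w} (λ { refl → w∉ (here refl) }) = refl

∏-const : ∀ (xs : List X) a → ∏ xs (λ _ → a) ≡ a ^ length xs
∏-const []       a = refl
∏-const (x ∷ xs) a = cong (a ℕ.*_) (∏-const xs a)

length-─ : ∀ {A : List X} {x} (p : x ∈ A) → length A ≡ suc (length (A ─ p))
length-─ (here refl) = refl
length-─ (there p)   = cong suc (length-─ p)

-- Each of the k roots contributes k^(k-2) spanning trees.
closedTrails-complete : ∀ {n} l m (e : Subset n) (w : Word n) → ∣ e ∣ ≡ suc (suc m) → length w ≡ suc l →
  (∀ a b → multiplicity w a b ≡ χ e a * (δ̅ a b * χ e b)) →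
  closedTrails l w ≡ suc (suc m) ^ suc m * (m !) ^ suc m * suc m !
closedTrails-complete {n} l m e w card len mult = begin
  closedTrails l w                              ≡⟨ closedTrails-walks l w ⟩
  ∑ (allFin n) (λ s → walks (suc l) s s w)      ≡⟨ ∑-cong (allFin n) tour ⟩
  ∑ (allFin n) (λ s → χ e s * V)                ≡⟨ ∑-*ʳ (allFin n) V (χ e) ⟩
  ∑ (allFin n) (χ e) * V                        ≡⟨ cong (_* V) (trans (∑-χ e) card) ⟩
  k * V                                         ≡⟨ regroup k (k ^ m) ((m !) ^ suc m) (suc m !) ⟩
  k ^ suc m * (m !) ^ suc m * suc m ! ∎
  where
  open ≡-Reasoning
  k V : ℕ
  k = suc (suc m)
  V = k ^ m * (m !) ^ suc m * suc m !
  regroup : ∀ a b c d → a * (b * c * d) ≡ a * b * c * d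
  regroup = solve-∀
  out : ∀ v → outdeg (multiplicity w) v ≡ χ e v * ∑ (allFin n) (λ b → δ̅ v b * χ e b)
  out v = trans (∑-cong (allFin n) (mult v)) (∑-*ˡ (allFin n) (χ e v) _)
  inn : ∀ v → indeg (multiplicity w) v ≡ outdeg (multiplicity w) v
  inn v = ∑-cong (allFin n) λ a → trans (mult a v) (trans (flipped a) (sym (mult v a)))
    where
    flipped : ∀ a → χ e a * (δ̅ a v * χ e v) ≡ χ e v * (δ̅ v a * χ e a)
    flipped a rewrite δ-sym a v = commute (χ e a) (δ̅ v a) (χ e v)
      where
      commute : ∀ x y z → x * (y * z) ≡ z * (y * x)
      commute = solve-∀
  out-∈ : ∀ v → Vec.lookup e v ≡ true → outdeg (multiplicity w) v ≡ suc m
  out-∈ v v∈ = trans (out v) (trans (cong (_* ∑ (allFin n) (λ b → δ̅ v b * χ e b)) (χ≡1 e v∈)) (trans (ℕP.*-identityˡ _)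
    (ℕP.+-cancelʳ-≡ 1 _ (suc m) (trans (cong (∑ (allFin n) (λ b → δ̅ v b * χ e b) ℕ.+_) (sym (χ≡1 e v∈)))
      (trans (∑-δ̅ v (χ e)) (trans (∑-χ e) (trans card (ℕP.+-comm 1 (suc m)))))))))
  out-∉ : ∀ v → Vec.lookup e v ≡ false → outdeg (multiplicity w) v ≡ 0
  out-∉ v v∉ = trans (out v) (cong (λ b → ind b * ∑ (allFin n) (λ b → δ̅ v b * χ e b)) v∉)
  tour : ∀ s → walks (suc l) s s w ≡ χ e s * V
  tour s with Vec.lookup e s in s∈
  ... | false = walks-stuck l s s w (out-∉ s s∈)
  ... | true = begin
    walks (suc l) s s w
      ≡⟨ walks-forests (suc l) len trail ⟩
    forests A (multiplicity w) * ∏ A (λ v → (outdeg (multiplicity w) v ∸ 1) !) * outdeg (multiplicity w) s !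
      ≡⟨ cong₂ _*_ (cong₂ _*_ (trees A refl) product) (cong _! (out-∈ s s∈)) ⟩
    V
      ≡⟨ ℕP.+-identityʳ V ⟨
    1 * V ∎
    where
    p : s ∈ members e
    p = ∈-members⁺ e s∈
    A : List (Fin n)
    A = members e ─ p
    A⁻ : ∀ {v} → v ∈ A → Vec.lookup e v ≡ true
    A⁻ v∈ = ∈-members⁻ e (─-⊆ p v∈)
    uA : Unique A
    uA = ─-unique (members-unique e) p
    lenA : length A ≡ suc m
    lenA = ℕP.suc-injective (trans (sym (length-─ p)) (trans (length-members e) card))
    trail : Trail s s A w
    trail = record
      { unique   = uA
      ; t∉A      = ─-∉ (members-unique e) p
      ; start    = inj₁ refl
      ; positive = λ v v∈ eq → contradiction (trans (sym (out-∈ v (A⁻ v∈))) eq) λ ()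
      ; vanish   = van
      ; balanced = λ v → cong (_+ δ s v) (inn v)
      }
      where
      van : ∀ v → v ∉ A → v ≢ s → outdeg (multiplicity w) v ≡ 0
      van v v∉ v≢s with Vec.lookup e v in v∈
      ... | false = out-∉ v v∈
      ... | true  = contradiction (∈-─ p (∈-members⁺ e v∈) v≢s) v∉
    product : ∏ A (λ v → (outdeg (multiplicity w) v ∸ 1) !) ≡ (m !) ^ suc m
    product = trans (∏-cong-∈ A λ v v∈ → cong (λ z → (z ∸ 1) !) (out-∈ v (A⁻ v∈)))
      (trans (∏-const A (m !)) (cong ((m !) ^_) lenA))
    -- `forests-cayley` needs a first vertex, which the computed list A does not display; the
    -- equation with B supplies it.
    trees : ∀ B → A ≡ B → forests B (multiplicity w) ≡ k ^ m
    trees []      eq = contradiction (trans (sym lenA) (cong length eq)) λ ()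
    trees (v ∷ B) eq = begin
      forests (v ∷ B) (multiplicity w)
        ≡⟨ forests-cayley v B (subst Unique eq uA) (multiplicity w) (χ e) row ⟩
      ∑ (allFin n) (λ w → outside (v ∷ B) w * χ e w) * ∑ (allFin n) (χ e) ^ length B
        ≡⟨ cong₂ _*_ root (cong₂ _^_ (trans (∑-χ e) card) (ℕP.suc-injective (trans (cong length (sym eq)) lenA))) ⟩
      1 * k ^ m
        ≡⟨ ℕP.*-identityˡ (k ^ m) ⟩
      k ^ m ∎
      where
      row : ∀ i → i ∈ v ∷ B → ∀ j → i ≢ j → multiplicity w i j ≡ χ e j
      row i i∈ j i≢j = trans (mult i j) (trans
        (cong₂ (λ a b → a * (b * χ e j)) (χ≡1 e (A⁻ (subst (i ∈_) (sym eq) i∈))) (δ̅-≢ i≢j))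
        (trans (ℕP.*-identityˡ (1 * χ e j)) (ℕP.*-identityˡ (χ e j))))
      -- Only vertices of e carry weight, and s is the only one of them outside A.
      root : ∑ (allFin n) (λ w → outside (v ∷ B) w * χ e w) ≡ 1
      root = trans (∑-single (allFin-unique n) (∈-allFin s) other)
        (cong₂ _*_ (outside-∉ (λ q → ─-∉ (members-unique e) p (subst (s ∈_) (sym eq) q))) (χ≡1 e s∈))
        where
        other : ∀ x → x ∈ allFin n → x ≢ s → outside (v ∷ B) x * χ e x ≡ 0
        other x _ x≢s with Vec.lookup e x in x∈
        ... | false = ℕP.*-zeroʳ (outside (v ∷ B) x)
        ... | true  = cong (_* 1) (outside-∈ (subst (x ∈_) eq (∈-─ p (∈-members⁺ e x∈) x≢s)))

-- Rational coefficients and the polynomial operators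

ℤ→ℚ-+ : ∀ a b → ℤ→ℚ (a ℤ.+ b) ≡ ℤ→ℚ a ℚ.+ ℤ→ℚ b
ℤ→ℚ-+ a b = ℚP.toℚᵘ-injective (begin
  ℚ.toℚᵘ (ℤ→ℚ (a ℤ.+ b))                            ≈⟨ ℚP.toℚᵘ-fromℚᵘ (ℚᵘ.mkℚᵘ (a ℤ.+ b) 0) ⟩
  ℚᵘ.mkℚᵘ (a ℤ.+ b) 0                               ≈⟨ ℚᵘ.*≡* (cong (ℤ._* (+ 1)) (cong₂ ℤ._+_ (sym (ℤP.*-identityʳ a)) (sym (ℤP.*-identityʳ b)))) ⟩
  ℚᵘ.mkℚᵘ a 0 ℚᵘ.+ ℚᵘ.mkℚᵘ b 0                      ≈⟨ ℚᵘP.+-cong (ℚP.toℚᵘ-fromℚᵘ (ℚᵘ.mkℚᵘ a 0)) (ℚP.toℚᵘ-fromℚᵘ (ℚᵘ.mkℚᵘ b 0)) ⟨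
  ℚ.toℚᵘ (ℤ→ℚ a) ℚᵘ.+ ℚ.toℚᵘ (ℤ→ℚ b)                ≈⟨ ℚP.toℚᵘ-homo-+ (ℤ→ℚ a) (ℤ→ℚ b) ⟨
  ℚ.toℚᵘ (ℤ→ℚ a ℚ.+ ℤ→ℚ b)                          ∎)
  where open import Relation.Binary.Reasoning.Setoid ℚᵘP.≃-setoid

ℤ→ℚ-* : ∀ a b → ℤ→ℚ (a ℤ.* b) ≡ ℤ→ℚ a ℚ.* ℤ→ℚ b
ℤ→ℚ-* a b = ℚP.toℚᵘ-injective (begin
  ℚ.toℚᵘ (ℤ→ℚ (a ℤ.* b))                            ≈⟨ ℚP.toℚᵘ-fromℚᵘ (ℚᵘ.mkℚᵘ (a ℤ.* b) 0) ⟩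
  ℚᵘ.mkℚᵘ a 0 ℚᵘ.* ℚᵘ.mkℚᵘ b 0                      ≈⟨ ℚᵘP.*-cong (ℚP.toℚᵘ-fromℚᵘ (ℚᵘ.mkℚᵘ a 0)) (ℚP.toℚᵘ-fromℚᵘ (ℚᵘ.mkℚᵘ b 0)) ⟨
  ℚ.toℚᵘ (ℤ→ℚ a) ℚᵘ.* ℚ.toℚᵘ (ℤ→ℚ b)                ≈⟨ ℚP.toℚᵘ-homo-* (ℤ→ℚ a) (ℤ→ℚ b) ⟨
  ℚ.toℚᵘ (ℤ→ℚ a ℚ.* ℤ→ℚ b)                          ∎)
  where open import Relation.Binary.Reasoning.Setoid ℚᵘP.≃-setoid

ℕ→ℚ-+ : ∀ a b → ℕ→ℚ (a + b) ≡ ℕ→ℚ a ℚ.+ ℕ→ℚ b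
ℕ→ℚ-+ a b = trans (cong ℤ→ℚ (ℤP.pos-+ a b)) (ℤ→ℚ-+ (+ a) (+ b))

ℕ→ℚ-* : ∀ a b → ℕ→ℚ (a * b) ≡ ℕ→ℚ a ℚ.* ℕ→ℚ b
ℕ→ℚ-* a b = trans (cong ℤ→ℚ (ℤP.pos-* a b)) (ℤ→ℚ-* (+ a) (+ b))

1/-inverse : ∀ d .{{_ : ℕ.NonZero d}} → ((+ 1) ℚ./ d) ℚ.* ℕ→ℚ d ≡ 1ℚ
1/-inverse (suc d) = ℚP.toℚᵘ-injective (begin
  ℚ.toℚᵘ (((+ 1) ℚ./ suc d) ℚ.* ℕ→ℚ (suc d))              ≈⟨ ℚP.toℚᵘ-homo-* ((+ 1) ℚ./ suc d) (ℕ→ℚ (suc d)) ⟩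
  ℚ.toℚᵘ ((+ 1) ℚ./ suc d) ℚᵘ.* ℚ.toℚᵘ (ℕ→ℚ (suc d))      ≈⟨ ℚᵘP.*-cong (ℚP.toℚᵘ-fromℚᵘ (ℚᵘ.mkℚᵘ (+ 1) d)) (ℚP.toℚᵘ-fromℚᵘ (ℚᵘ.mkℚᵘ (+ suc d) 0)) ⟩
  ℚᵘ.mkℚᵘ (+ 1) d ℚᵘ.* ℚᵘ.mkℚᵘ (+ suc d) 0                ≈⟨ ℚᵘ.*≡* (cong (+_) (swap1 d)) ⟩
  ℚ.toℚᵘ 1ℚ                                               ∎)
  where
  open import Relation.Binary.Reasoning.Setoid ℚᵘP.≃-setoid
  swap1 : ∀ d → 1 * suc d * 1 ≡ 1 * (suc d * 1)
  swap1 = solve-∀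

inv!-inverse : ∀ m → inv! m ℚ.* ℕ→ℚ (m !) ≡ 1ℚ
inv!-inverse m = 1/-inverse (m !) {{m ℕP.!≢0}}

ℕ→ℚ-∑ : ∀ (xs : List X) f → ℕ→ℚ (∑ xs f) ≡ ∑ℚ xs (ℕ→ℚ ∘ f)
ℕ→ℚ-∑ []       f = refl
ℕ→ℚ-∑ (x ∷ xs) f = trans (ℕ→ℚ-+ (f x) (∑ xs f)) (cong (ℕ→ℚ (f x) ℚ.+_) (ℕ→ℚ-∑ xs f))

-- The linear extension of a functional on words. Polynomials are unreduced lists of terms, so they
-- are compared only through such values.
⟪_,_⟫ : ∀ {n} → (Word n → ℕ) → Poly n → ℚ
⟪ φ , p ⟫ = ∑ℚ p (λ t → proj₁ t ℚ.* ℕ→ℚ (φ (proj₂ t)))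

⟪⟫-cong : ∀ {n} {φ ψ : Word n → ℕ} p → (∀ w → φ w ≡ ψ w) → ⟪ φ , p ⟫ ≡ ⟪ ψ , p ⟫
⟪⟫-cong p eq = ∑ℚ.⨁-cong p λ t → cong (λ z → proj₁ t ℚ.* ℕ→ℚ z) (eq (proj₂ t))

constTerm-⟪⟫ : ∀ {n} (p : Poly n) → constTerm p ≡ ⟪ ind ∘ null , p ⟫
constTerm-⟪⟫ []              = refl
constTerm-⟪⟫ ((c , [])    ∷ p) = cong₂ ℚ._+_ (sym (ℚP.*-identityʳ c)) (constTerm-⟪⟫ p)
constTerm-⟪⟫ ((c , _ ∷ _) ∷ p) = cong₂ ℚ._+_ (sym (ℚP.*-zeroʳ c)) (constTerm-⟪⟫ p)

⟪⟫-derivPoly : ∀ {n} (φ : Word n → ℕ) v p → ⟪ φ , derivPoly v p ⟫ ≡ ⟪ ∂* v φ , p ⟫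
⟪⟫-derivPoly φ v []            = refl
⟪⟫-derivPoly φ v ((c , w) ∷ p) = trans
  (∑ℚ.⨁-++ (map (c ,_) (derivWord v w)) (derivPoly v p) _)
  (cong₂ ℚ._+_ (trans (∑ℚ.⨁-map (c ,_) (derivWord v w) _)
                 (trans (∑ℚ.⨁-*ˡ (derivWord v w) c (ℕ→ℚ ∘ φ)) (cong (c ℚ.*_) (sym (ℕ→ℚ-∑ (derivWord v w) φ)))))
               (⟪⟫-derivPoly φ v p))

⟪⟫-derivs : ∀ {n} (φ : Word n → ℕ) vs p → ⟪ φ , derivs vs p ⟫ ≡ ⟪ foldl (flip ∂*) φ vs , p ⟫
⟪⟫-derivs φ []       p = refl
⟪⟫-derivs φ (v ∷ vs) p = trans (⟪⟫-derivPoly φ v (derivs vs p)) (⟪⟫-derivs (∂* v φ) vs p)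

-- Transposition reverses the order of the derivatives, hence the `foldl`; the number of matchings
-- does not depend on that order.
constTerm-derivs : ∀ {n} (vs : List (Var n)) p → constTerm (derivs vs p) ≡ ⟪ matchings vs , p ⟫
constTerm-derivs vs p = begin
  constTerm (derivs vs p)                          ≡⟨ constTerm-⟪⟫ (derivs vs p) ⟩
  ⟪ ind ∘ null , derivs vs p ⟫                     ≡⟨ ⟪⟫-derivs (ind ∘ null) vs p ⟩
  ⟪ foldl (flip ∂*) (ind ∘ null) vs , p ⟫          ≡⟨ cong ⟪_, p ⟫ (ListP.reverse-foldr ∂* (ind ∘ null) vs) ⟨
  ⟪ matchings (reverse vs) , p ⟫                   ≡⟨ ⟪⟫-cong p (λ w → matchings-↭ˡ w (↭P.↭-reverse vs)) ⟩
  ⟪ matchings vs , p ⟫                             ∎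
  where open ≡-Reasoning

constTerm-trPow : ∀ {n} l (vs : List (Var n)) → constTerm (derivs vs (trPow n (suc l))) ≡ ℕ→ℚ (closedTrails l vs)
constTerm-trPow {n} l vs = begin
  constTerm (derivs vs (trPow n (suc l)))
    ≡⟨ constTerm-derivs vs (trPow n (suc l)) ⟩
  ⟪ matchings vs , trPow n (suc l) ⟫
    ≡⟨ ∑ℚ.⨁-concatMap _ (allFin n) _ ⟩
  ∑ℚ (allFin n) (λ s → ∑ℚ (map (λ p → (1ℚ , cycleWord s p)) (allLists l n)) (λ t → proj₁ t ℚ.* ℕ→ℚ (matchings vs (proj₂ t))))
    ≡⟨ ∑ℚ.⨁-cong (allFin n) (λ s → trans (∑ℚ.⨁-map _ (allLists l n) _)
         (trans (∑ℚ.⨁-cong (allLists l n) λ p → ℚP.*-identityˡ _) (sym (ℕ→ℚ-∑ (allLists l n) _)))) ⟩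
  ∑ℚ (allFin n) (λ s → ℕ→ℚ (∑ (allLists l n) (λ p → matchings vs (cycleWord s p))))
    ≡⟨ ℕ→ℚ-∑ (allFin n) _ ⟨
  ℕ→ℚ (closedTrails l vs) ∎
  where open ≡-Reasoning

⟪⟫-scale : ∀ {n} (φ : Word n → ℕ) c p → ⟪ φ , scale c p ⟫ ≡ c ℚ.* ⟪ φ , p ⟫
⟪⟫-scale φ c []             = sym (ℚP.*-zeroʳ c)
⟪⟫-scale φ c ((c′ , w) ∷ p) = trans
  (cong₂ ℚ._+_ (ℚP.*-assoc c c′ _) (⟪⟫-scale φ c p)) (sym (ℚP.*-distribˡ-+ c _ _))

-- The outermost operator is expanded first, and vs collects the derivatives that act outside p. The
-- remaining operators are then treated by induction without computing any polynomial.
constTerm-opT : ∀ {m n} (𝒯 : Tensor (suc m) n) i vs p → constTerm (derivs vs (opT 𝒯 i p)) ≡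
  ∑ℚ (allVecs m n) (λ y → 𝒯 (i VF.∷ y) ℚ.* constTerm (derivs (vs ++ map (λ j → (i , y j)) (allFin m)) p))
constTerm-opT {m} {n} 𝒯 i vs p = begin
  constTerm (derivs vs (opT 𝒯 i p))
    ≡⟨ constTerm-derivs vs (opT 𝒯 i p) ⟩
  ⟪ matchings vs , opT 𝒯 i p ⟫
    ≡⟨ ∑ℚ.⨁-concatMap _ (allVecs m n) _ ⟩
  ∑ℚ (allVecs m n) (λ y → ⟪ matchings vs , scale (𝒯 (i VF.∷ y)) (derivs (arcs y) p) ⟫)
    ≡⟨ ∑ℚ.⨁-cong (allVecs m n) (λ y → trans (⟪⟫-scale (matchings vs) (𝒯 (i VF.∷ y)) (derivs (arcs y) p))
         (cong (𝒯 (i VF.∷ y) ℚ.*_) (trans (sym (constTerm-derivs vs (derivs (arcs y) p)))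
           (cong constTerm (sym (ListP.foldr-++ derivPoly p vs (arcs y))))))) ⟩
  ∑ℚ (allVecs m n) (λ y → 𝒯 (i VF.∷ y) ℚ.* constTerm (derivs (vs ++ arcs y) p)) ∎
  where
  open ≡-Reasoning
  arcs : Vector (Fin n) m → Word n
  arcs y = map (λ j → (i , y j)) (allFin m)

-- Index vectors are functions; as lists they can be compared by `≡` and permuted by `↭`.
values : ∀ {m n} → Vector (Fin n) m → List (Fin n)
values {m} y = map y (allFin m)

values-∷ : ∀ {m n} (x : Fin n) (y : Vector (Fin n) m) → values (x VF.∷ y) ≡ x ∷ values y
values-∷ {m} x y = trans (cong (map (x VF.∷ y)) (allFin-suc m)) (cong (x ∷_) (sym (ListP.map-∘ (allFin m))))

∑-allVecs : ∀ m n (f : List (Fin n) → ℚ) → ∑ℚ (allVecs m n) (f ∘ values) ≡ ∑ℚ (allLists m n) f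
∑-allVecs zero    n f = refl
∑-allVecs (suc m) n f = begin
  ∑ℚ (allVecs (suc m) n) (f ∘ values)
    ≡⟨ ∑ℚ.⨁-concatMap _ (allFin n) _ ⟩
  ∑ℚ (allFin n) (λ i → ∑ℚ (map (i VF.∷_) (allVecs m n)) (f ∘ values))
    ≡⟨ ∑ℚ.⨁-cong (allFin n) (λ i → trans (∑ℚ.⨁-map (i VF.∷_) (allVecs m n) _)
         (trans (∑ℚ.⨁-cong (allVecs m n) λ y → cong f (values-∷ i y))
           (trans (∑-allVecs m n (λ l → f (i ∷ l))) (sym (∑ℚ.⨁-map (i ∷_) (allLists m n) f))))) ⟩
  ∑ℚ (allFin n) (λ i → ∑ℚ (map (i ∷_) (allLists m n)) f)
    ≡⟨ ∑ℚ.⨁-concatMap _ (allFin n) f ⟨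
  ∑ℚ (allLists (suc m) n) f ∎
  where open ≡-Reasoning

-- Tensor entries indexed by the orderings of an edge

↭-─ : ∀ {A : List X} {x} (p : x ∈ A) → A ↭ x ∷ (A ─ p)
↭-─ (here refl)             = ↭-refl
↭-─ {A = y ∷ A} {x} (there p) = ↭-trans (prep y (↭-─ p)) (swap y x ↭-refl)

unique-⊆ : ∀ {z l : List X} → Unique z → (∀ {x} → x ∈ z → x ∈ l) → ∃ λ r → l ↭ z ++ r
unique-⊆ {z = []}    _        sub = _ , ↭-refl
unique-⊆ {z = x ∷ z} (x∉ ∷ u) sub with unique-⊆ u (λ y∈ → ∈-─ (sub (here refl)) (sub (there y∈)) (λ { refl → All.lookup x∉ y∈ refl }))
... | r , p = r , ↭-trans (↭-─ (sub (here refl))) (prep x p)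

unique-⊆-length : ∀ {z l : List X} → Unique z → (∀ {x} → x ∈ z → x ∈ l) → length z ≤ length l
unique-⊆-length {z = z} {l} u sub with unique-⊆ u sub
... | r , p = ℕP.≤-trans (ℕP.m≤m+n (length z) (length r)) (ℕP.≤-reflexive (sym (trans (↭P.↭-length p) (ListP.length-++ z))))

unique-⊆-↭ : ∀ {z l : List X} → Unique z → (∀ {x} → x ∈ z → x ∈ l) → length l ≤ length z → z ↭ l
unique-⊆-↭ {z = z} {l} u sub le with unique-⊆ u sub
... | []    , p = ↭-sym (↭-trans p (↭-reflexive (ListP.++-identityʳ z)))
... | x ∷ r , p = contradiction le (ℕP.<⇒≱
  (subst (length z <_) (sym (trans (↭P.↭-length p) (ListP.length-++ z))) (ℕP.m<m+n (length z) (s≤s z≤n))))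

support : ∀ {n} → List (Fin n) → Subset n
support l = ⋃ (map ⁅_⁆ l)

∈-support⁻ : ∀ {n} (l : List (Fin n)) {x} → x Subset.∈ support l → x ∈ l
∈-support⁻ []      x∈ = contradiction x∈ SubsetP.∉⊥
∈-support⁻ (y ∷ l) x∈ with SubsetP.x∈p∪q⁻ ⁅ y ⁆ (support l) x∈
... | inj₁ x∈y = here (SubsetP.x∈⁅y⁆⇒x≡y y x∈y)
... | inj₂ x∈l = there (∈-support⁻ l x∈l)

∈-support⁺ : ∀ {n} {l : List (Fin n)} {x} → x ∈ l → x Subset.∈ support l
∈-support⁺ {x = x} (here refl) = SubsetP.x∈p∪q⁺ (inj₁ (SubsetP.x∈⁅x⁆ x))
∈-support⁺         (there p)   = SubsetP.x∈p∪q⁺ (inj₂ (∈-support⁺ p))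

support-≡ : ∀ {n} (l : List (Fin n)) e → (∀ {x} → x ∈ l → Vec.lookup e x ≡ true) →
            (∀ {x} → Vec.lookup e x ≡ true → x ∈ l) → support l ≡ e
support-≡ l e sub sup = SubsetP.⊆-antisym
  (λ {x} x∈ → VecP.lookup⇒[]= x e (sub (∈-support⁻ l x∈)))
  (λ x∈ → ∈-support⁺ (sup (VecP.[]=⇒lookup x∈)))

lookup-support : ∀ {n} {l : List (Fin n)} {x} → x ∈ l → Vec.lookup (support l) x ≡ true
lookup-support x∈ = VecP.[]=⇒lookup (∈-support⁺ x∈)

support-lookup : ∀ {n} (l : List (Fin n)) {x} → Vec.lookup (support l) x ≡ true → x ∈ l
support-lookup l {x} eq = ∈-support⁻ l (VecP.lookup⇒[]= x _ eq)

indexSet-support : ∀ {k n} (f : Vector (Fin n) k) → indexSet f ≡ support (values f)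
indexSet-support {k} f = cong ⋃ (ListP.map-∘ (allFin k))

==ₛ-false : ∀ {n} {s t : Subset n} → s ≢ t → (s ==ₛ t) ≡ false
==ₛ-false {s = s} {t} ne with VecP.≡-dec Data.Bool._≟_ s t
... | yes eq = contradiction eq ne
... | no _   = refl

allLists-length : ∀ m n {l : List (Fin n)} → l ∈ allLists m n → length l ≡ m
allLists-length zero    n (here refl) = refl
allLists-length (suc m) n l∈ with ∈-concat⁻′ (map (λ i → map (i ∷_) (allLists m n)) (allFin n)) l∈
... | ls , l∈ls , ls∈ with ∈-map⁻ (λ i → map (i ∷_) (allLists m n)) ls∈
... | i , _ , refl with ∈-map⁻ (i ∷_) l∈ls
... | l′ , l′∈ , refl = cong suc (allLists-length m n l′∈)

∑-allLists-single : ∀ m n (f : List (Fin n) → ℚ) l₀ → length l₀ ≡ m →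
                    (∀ l → length l ≡ m → l ≢ l₀ → f l ≡ 0ℚ) → ∑ℚ (allLists m n) f ≡ f l₀
∑-allLists-single zero    n f []        _   _  = ℚP.+-identityʳ (f [])
∑-allLists-single (suc m) n f (j₀ ∷ l₀) len eq = begin
  ∑ℚ (allLists (suc m) n) f
    ≡⟨ trans (∑ℚ.⨁-concatMap _ (allFin n) f) (∑ℚ.⨁-cong (allFin n) λ j → ∑ℚ.⨁-map (j ∷_) (allLists m n) f) ⟩
  ∑ℚ (allFin n) (λ j → ∑ℚ (allLists m n) (λ l → f (j ∷ l)))
    ≡⟨ ∑ℚ.⨁-single (allFin-unique n) (∈-allFin j₀) (λ j _ j≢ → ∑ℚ.⨁-ε-∈ (allLists m n) λ l l∈ → eq (j ∷ l) (cong suc (allLists-length m n l∈)) λ { refl → j≢ refl }) ⟩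
  ∑ℚ (allLists m n) (λ l → f (j₀ ∷ l))
    ≡⟨ ∑-allLists-single m n (λ l → f (j₀ ∷ l)) l₀ (ℕP.suc-injective len) (λ l len l≢ → eq (j₀ ∷ l) (cong suc len) λ { refl → l≢ refl }) ⟩
  f (j₀ ∷ l₀) ∎
  where open ≡-Reasoning

matchings-unique : ∀ {n} (w : Word n) → Unique w → matchings w w ≡ 1
matchings-unique []            _        = refl
matchings-unique ((i , j) ∷ w) (v∉ ∷ u) = begin
  ∂* v (matchings w) (v ∷ w)                                          ≡⟨ ∂*-∷ v v w (matchings w) ⟩
  ind (v ==ᵥ v) * matchings w w + ∂* v (matchings w ∘ (v ∷_)) w       ≡⟨ cong₂ _+_ (cong₂ (λ a b → ind a * b) (==ᵥ-refl v) (matchings-unique w u)) (empty (multiplicity-∉ w i j λ v∈ → All.lookup v∉ v∈ refl)) ⟩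
  1 ∎
  where
  open ≡-Reasoning
  v : Var _
  v = i , j
  empty : length (derivWord v w) ≡ 0 → ∂* v (matchings w ∘ (v ∷_)) w ≡ 0
  empty eq with derivWord v w
  ... | [] = refl

outdeg-tails : ∀ {n} (i : Fin n) w → All (λ v → proj₁ v ≡ i) w → outdeg (multiplicity w) i ≡ length w
outdeg-tails {n} i []            []          = ∑-zero (allFin n) λ _ → refl
outdeg-tails {n} i ((_ , b) ∷ w) (refl ∷ al) = begin
  ∑ (allFin n) (multiplicity ((i , b) ∷ w) i)                     ≡⟨ ∑-cong (allFin n) (λ j → multiplicity-∷ i b w i j) ⟩
  ∑ (allFin n) (λ j → δ i i * δ b j + multiplicity w i j)         ≡⟨ ∑-+ (allFin n) _ _ ⟩
  ∑ (allFin n) (λ j → δ i i * δ b j) + outdeg (multiplicity w) i  ≡⟨ cong₂ _+_ (trans (∑-cong (allFin n) λ j → ℕP.*-comm (δ i i) (δ b j)) (trans (∑-δ b (λ _ → δ i i)) (δ-refl i))) (outdeg-tails i w al) ⟩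
  suc (length w) ∎
  where open ≡-Reasoning

-- All letters share the tail i, so each of the m! bijections between positions and letters
-- determines exactly one list l.
∑-matchings : ∀ {n} m (i : Fin n) w → All (λ v → proj₁ v ≡ i) w → length w ≡ m →
              ∑ (allLists m n) (λ l → matchings (map (i ,_) l) w) ≡ m !
∑-matchings zero i [] _ _ = refl
∑-matchings {n} (suc m) i w al len = begin
  ∑ (allLists (suc m) n) (λ l → matchings (map (i ,_) l) w)
    ≡⟨ ∑-allLists m n _ ⟩
  ∑ (allFin n) (λ j → ∑ (allLists m n) (λ l → ∑ (derivWord (i , j) w) (matchings (map (i ,_) l))))
    ≡⟨ ∑-cong (allFin n) (λ j → ∑-swap (allLists m n) (derivWord (i , j) w) _) ⟩
  ∑ (allFin n) (λ j → ∑ (derivWord (i , j) w) (λ u → ∑ (allLists m n) (λ l → matchings (map (i ,_) l) u)))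
    ≡⟨ ∑-arcs-const i w _ (m !) (λ j u u∈ → ∑-matchings m i u
         (All.tail (↭P.All-resp-↭ (derivWord-↭ (i , j) w u u∈) al))
         (ℕP.suc-injective (trans (sym (step-length w u∈)) len))) ⟩
  outdeg (multiplicity w) i * m !
    ≡⟨ cong (_* m !) (trans (outdeg-tails i w al) len) ⟩
  suc m ! ∎
  where open ≡-Reasoning

module _ {n} (m : ℕ) (e : Subset n) (card : ∣ e ∣ ≡ suc m) (i : Fin n) (i∈e : Vec.lookup e i ≡ true) where

  private
    others⇒support : ∀ {l} → l ↭ others e i → support (i ∷ l) ≡ e
    others⇒support {l} p = support-≡ (i ∷ l) e sub sup
      where
      sub : ∀ {x} → x ∈ i ∷ l → Vec.lookup e x ≡ true
      sub (here refl) = i∈e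
      sub (there x∈)  = proj₁ (∈-others⁻ e i (↭P.∈-resp-↭ p x∈))
      sup : ∀ {x} → Vec.lookup e x ≡ true → x ∈ i ∷ l
      sup {x} x∈ with i Fin.≟ x
      ... | yes refl = here refl
      ... | no i≢x   = there (↭P.∈-resp-↭ (↭-sym p) (∈-others⁺ e i x∈ i≢x))

    support⇒others : ∀ l → length l ≡ m → support (i ∷ l) ≡ e → others e i ↭ l
    support⇒others l len eq = unique-⊆-↭ (others-unique e i) sub
      (ℕP.≤-reflexive (trans len (sym (length-others e i i∈e card))))
      where
      sub : ∀ {x} → x ∈ others e i → x ∈ l
      sub x∈ with ∈-others⁻ e i x∈
      ... | lx , i≢x with support-lookup (i ∷ l) (trans (cong (λ s → Vec.lookup s _) eq) lx)
      ... | here refl = contradiction refl i≢x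
      ... | there q   = q

    star-unique : Unique (star i e)
    star-unique = UniqueP.map⁺ (λ { refl → refl }) (others-unique e i)

    -- The letters of `star i e` are distinct, so the count is 0 or 1 and detects the orderings of e
    -- without i. Combined with `∑-matchings` it counts these orderings without enumerating
    -- permutations.
    matchings-support : ∀ l → length l ≡ m →
                        matchings (map (i ,_) l) (star i e) ≡ ind (support (i ∷ l) ==ₛ e)
    matchings-support l len with VecP.≡-dec Data.Bool._≟_ (support (i ∷ l)) e
    ... | yes eq = trans (matchings-↭ˡ (star i e) (↭P.map⁺ (i ,_) (↭-sym (support⇒others l len eq))))
                         (matchings-unique (star i e) star-unique)
    ... | no ne  = matchings-zero (map (i ,_) l) (star i e) λ p → ne (others⇒support (heads (↭-sym p)))
      where
      heads : map (i ,_) l ↭ star i e → l ↭ others e i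
      heads p = subst (λ z → z ↭ others e i) (unmap l) (subst (map proj₂ (map (i ,_) l) ↭_) (unmap (others e i)) (↭P.map⁺ proj₂ p))
        where
        unmap : ∀ z → map proj₂ (map (i ,_) z) ≡ z
        unmap z = trans (sym (ListP.map-∘ z)) (ListP.map-id z)

  -- The m! orderings of e ∖ {i} cancel the factor 1/m! of the adjacency tensor.
  ∑-orderings : (Φ : Word n → ℚ) → (∀ {w w′} → w ↭ w′ → Φ w ≡ Φ w′) →
    ∑ℚ (allLists m n) (λ l → (if support (i ∷ l) ==ₛ e then inv! m else 0ℚ) ℚ.* Φ (map (i ,_) l)) ≡ Φ (star i e)
  ∑-orderings Φ inv = begin
    ∑ℚ (allLists m n) (λ l → (if support (i ∷ l) ==ₛ e then inv! m else 0ℚ) ℚ.* Φ (map (i ,_) l))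
      ≡⟨ ∑ℚ.⨁-cong-∈ (allLists m n) (λ l l∈ → term l (allLists-length m n l∈)) ⟩
    ∑ℚ (allLists m n) (λ l → ℕ→ℚ (matchings (map (i ,_) l) (star i e)) ℚ.* (inv! m ℚ.* Φ (star i e)))
      ≡⟨ ∑ℚ.⨁-*ʳ (allLists m n) (inv! m ℚ.* Φ (star i e)) _ ⟩
    ∑ℚ (allLists m n) (λ l → ℕ→ℚ (matchings (map (i ,_) l) (star i e))) ℚ.* (inv! m ℚ.* Φ (star i e))
      ≡⟨ cong (ℚ._* (inv! m ℚ.* Φ (star i e))) (trans (sym (ℕ→ℚ-∑ (allLists m n) _)) (cong ℕ→ℚ
           (∑-matchings m i (star i e) (AllP.map⁺ (All.tabulate λ _ → refl)) (trans (ListP.length-map (i ,_) (others e i)) (length-others e i i∈e card))))) ⟩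
    ℕ→ℚ (m !) ℚ.* (inv! m ℚ.* Φ (star i e))
      ≡⟨ ℚP.*-assoc (ℕ→ℚ (m !)) (inv! m) (Φ (star i e)) ⟨
    ℕ→ℚ (m !) ℚ.* inv! m ℚ.* Φ (star i e)
      ≡⟨ cong (ℚ._* Φ (star i e)) (trans (ℚP.*-comm (ℕ→ℚ (m !)) (inv! m)) (inv!-inverse m)) ⟩
    1ℚ ℚ.* Φ (star i e)
      ≡⟨ ℚP.*-identityˡ (Φ (star i e)) ⟩
    Φ (star i e) ∎
    where
    open ≡-Reasoning
    term : ∀ l → length l ≡ m → (if support (i ∷ l) ==ₛ e then inv! m else 0ℚ) ℚ.* Φ (map (i ,_) l) ≡
                 ℕ→ℚ (matchings (map (i ,_) l) (star i e)) ℚ.* (inv! m ℚ.* Φ (star i e))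
    term l len rewrite matchings-support l len with VecP.≡-dec Data.Bool._≟_ (support (i ∷ l)) e
    ... | yes eq = trans (cong (inv! m ℚ.*_) (inv (↭P.map⁺ (i ,_) (↭-sym (support⇒others l len eq)))))
                         (sym (ℚP.*-identityˡ (inv! m ℚ.* Φ (star i e))))
    ... | no _   = trans (ℚP.*-zeroˡ (Φ (map (i ,_) l))) (sym (ℚP.*-zeroˡ (inv! m ℚ.* Φ (star i e))))

∑-orderings-∉ : ∀ {n} m (e : Subset n) i a (Φ : Word n → ℚ) → Vec.lookup e i ≡ false →
  ∑ℚ (allLists m n) (λ l → (if support (i ∷ l) ==ₛ e then a else 0ℚ) ℚ.* Φ (map (i ,_) l)) ≡ 0ℚ
∑-orderings-∉ {n} m e i a Φ i∉ = ∑ℚ.⨁-ε (allLists m n) λ l → trans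
  (cong (λ b → (if b then a else 0ℚ) ℚ.* Φ (map (i ,_) l)) (==ₛ-false (distinct l)))
  (ℚP.*-zeroˡ (Φ (map (i ,_) l)))
  where
  distinct : ∀ l → support (i ∷ l) ≢ e
  distinct l eq = contradiction
    (trans (sym (lookup-support {l = i ∷ l} (here refl))) (trans (cong (λ s → Vec.lookup s i) eq) i∉)) λ ()

-- The edges are distinct, so at most one summand is nonzero; there uniformity makes the cardinality
-- test succeed.
isEdge-∑ : ∀ {n} (k : ℕ) (I : Subset n) a es → Unique es → All (λ e → ∣ e ∣ ≡ k) es →
           (if does (∣ I ∣ ℕ.≟ k) ∧ any (I ==ₛ_) es then a else 0ℚ) ≡ ∑ℚ es (λ e → if I ==ₛ e then a else 0ℚ)
isEdge-∑ k I a [] _ _ with does (∣ I ∣ ℕ.≟ k)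
... | true  = refl
... | false = refl
isEdge-∑ k I a (e ∷ es) (e∉ ∷ u) (card ∷ cards) with VecP.≡-dec Data.Bool._≟_ I e
... | no _ = trans (isEdge-∑ k I a es u cards) (sym (ℚP.+-identityˡ _))
... | yes refl = trans
  (cong (λ b → if b ∧ true then a else 0ℚ) (dec-true (∣ I ∣ ℕ.≟ k) card))
  (sym (trans (cong (a ℚ.+_) (∑ℚ.⨁-ε-∈ es λ e′ e′∈ →
          cong (λ b → if b then a else 0ℚ) (==ₛ-false {s = I} {e′} λ { refl → All.lookup e∉ e′∈ refl })))
          (ℚP.+-identityʳ a)))

-- A support of one element forces every index to be i, so the degree tensor contributes only loops.
∑-diagonal : ∀ {n} m (i : Fin n) a (Φ : Word n → ℚ) →
  ∑ℚ (allLists m n) (λ l → (if does (∣ support (i ∷ l) ∣ ℕ.≟ 1) then a else 0ℚ) ℚ.* Φ (map (i ,_) l)) ≡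
  a ℚ.* Φ (replicate m (i , i))
∑-diagonal {n} m i a Φ = trans
  (∑-allLists-single m n _ (replicate m i) (ListP.length-replicate m) off)
  (cong₂ (λ b w → (if b then a else 0ℚ) ℚ.* Φ w) on (ListP.map-replicate (i ,_) m i))
  where
  constant : ∀ {l} → (∀ {x} → x ∈ l → x ≡ i) → l ≡ replicate (length l) i
  constant {[]}    eq = refl
  constant {x ∷ l} eq = cong₂ _∷_ (eq (here refl)) (constant (eq ∘ there))
  on : does (∣ support (i ∷ replicate m i) ∣ ℕ.≟ 1) ≡ true
  on = dec-true (∣ support (i ∷ replicate m i) ∣ ℕ.≟ 1)
    (trans (cong ∣_∣ (SubsetP.⊆-antisym
      (λ x∈ → subst (Subset._∈ ⁅ i ⁆) (sym (single (∈-support⁻ (i ∷ replicate m i) x∈))) (SubsetP.x∈⁅x⁆ i))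
      (λ x∈ → SubsetP.x∈p∪q⁺ (inj₁ x∈)))) (SubsetP.∣⁅x⁆∣≡1 i))
    where
    single : ∀ {x} → x ∈ i ∷ replicate m i → x ≡ i
    single (here eq)  = eq
    single (there x∈) = All.lookup (AllP.replicate⁺ {P = _≡ i} m refl) x∈
  off : ∀ l → length l ≡ m → l ≢ replicate m i →
        (if does (∣ support (i ∷ l) ∣ ℕ.≟ 1) then a else 0ℚ) ℚ.* Φ (map (i ,_) l) ≡ 0ℚ
  off l refl l≢ with ∣ support (i ∷ l) ∣ ℕ.≟ 1
  ... | no ne    = trans
    (cong (λ b → (if b then a else 0ℚ) ℚ.* Φ (map (i ,_) l)) (dec-false (∣ support (i ∷ l) ∣ ℕ.≟ 1) ne))
    (ℚP.*-zeroˡ (Φ (map (i ,_) l)))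
  ... | yes card = contradiction (constant same) l≢
    where
    same : ∀ {x} → x ∈ l → x ≡ i
    same {x} x∈ with x Fin.≟ i
    ... | yes eq = eq
    ... | no x≢i = contradiction
      (subst (2 ≤_) (trans (length-members (support (i ∷ l))) card)
        (unique-⊆-length {z = x ∷ i ∷ []} ((x≢i ∷ []) ∷ [] ∷ []) λ where
          (here refl)         → ∈-members⁺ (support (i ∷ l)) (lookup-support {l = i ∷ l} (there x∈))
          (there (here refl)) → ∈-members⁺ (support (i ∷ l)) (lookup-support {l = i ∷ l} (here refl))))
      λ { (s≤s ()) }

-- Contributions of tensor entries

-- Between sets of equal size an inclusion is an equality. The vertex found is the dead end that
-- rules out a second edge.
∃-edge-∖ : ∀ {n} {e e₀ : Subset n} → ∣ e ∣ ≡ ∣ e₀ ∣ → e ≢ e₀ →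
           ∃ λ v → Vec.lookup e v ≡ true × Vec.lookup e₀ v ≡ false
∃-edge-∖ {n} {e} {e₀} card e≢ with FinP.any? (λ v → (Vec.lookup e v Data.Bool.≟ true) ×-dec (Vec.lookup e₀ v Data.Bool.≟ false))
... | yes found = found
... | no none   = contradiction (SubsetP.⊆-antisym e⊆e₀ e₀⊆e) e≢
  where
  sub : ∀ {v} → v ∈ members e → v ∈ members e₀
  sub {v} v∈ with Vec.lookup e₀ v in eq
  ... | true  = ∈-members⁺ e₀ eq
  ... | false = contradiction (v , ∈-members⁻ e v∈ , eq) none
  p : members e ↭ members e₀
  p = unique-⊆-↭ (members-unique e) sub
        (ℕP.≤-reflexive (trans (length-members e₀) (trans (sym card) (sym (length-members e)))))
  e⊆e₀ : e Subset.⊆ e₀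
  e⊆e₀ {x} x∈ = VecP.lookup⇒[]= x e₀ (∈-members⁻ e₀ (↭P.∈-resp-↭ p (∈-members⁺ e (VecP.[]=⇒lookup x∈))))
  e₀⊆e : e₀ Subset.⊆ e
  e₀⊆e {x} x∈ = VecP.lookup⇒[]= x e (∈-members⁻ e (↭P.∈-resp-↭ (↭-sym p) (∈-members⁺ e₀ (VecP.[]=⇒lookup x∈))))

∈-replicate⁻ : ∀ {x y : X} r → y ∈ replicate r x → y ≡ x
∈-replicate⁻ (suc r) (here eq)  = eq
∈-replicate⁻ (suc r) (there y∈) = ∈-replicate⁻ r y∈

star⁻ : ∀ {n} (i : Fin n) e {a b} → (a , b) ∈ star i e → a ≡ i
star⁻ i e v∈ with ∈-map⁻ (i ,_) v∈
... | _ , _ , refl = refl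

-- The sign s of the adjacency part is a parameter, so that one argument serves both tensors.
-- Writing k = m₁ + 2 makes m positive, so every tensor entry supplies an arc; walks have l + 1
-- arcs.
module Contribution {m₁ n : ℕ} (H : Hypergraph (suc (suc m₁)) n) (s : ℤ) (l : ℕ) where

  m k : ℕ
  m = suc m₁
  k = suc m

  card : ∀ {e} → e ∈ edges H → ∣ e ∣ ≡ k
  card = All.lookup (uniform H)

  neighbour : ∀ {e} → e ∈ edges H → ∀ i → Vec.lookup e i ≡ true → ∃ λ j → j ∈ others e i
  neighbour {e} e∈ i i∈ with others e i | length-others e i i∈ (card e∈)
  ... | j ∷ _ | _ = j , here refl

  loops : Fin n → Word n
  loops i = replicate m (i , i)

  -- The effect of the operators Σ_y t_{iy} ∂/∂a_{iy}, i ∈ is, once the orderings y of each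
  -- edge have been collected; w lists the derivatives that are still to be applied.
  contribution : List (Fin n) → Word n → ℚ
  contribution []       w = ℕ→ℚ (closedTrails l w)
  contribution (i ∷ is) w =
    ℕ→ℚ (degree H i) ℚ.* contribution is (w ++ loops i) ℚ.+
    ℤ→ℚ s ℚ.* ∑ℚ (edges H) (λ e → if Vec.lookup e i then contribution is (w ++ star i e) else 0ℚ)

  contribution-↭ : ∀ is {w w′} → w ↭ w′ → contribution is w ≡ contribution is w′
  contribution-↭ []       p = cong ℕ→ℚ (closedTrails-↭ l p)
  contribution-↭ (i ∷ is) p = cong₂ (λ a b → ℕ→ℚ (degree H i) ℚ.* a ℚ.+ ℤ→ℚ s ℚ.* b)
    (contribution-↭ is (↭P.++⁺ʳ (loops i) p))
    (∑ℚ.⨁-cong (edges H) λ e → cong (λ z → if Vec.lookup e i then z else 0ℚ) (contribution-↭ is (↭P.++⁺ʳ (star i e) p)))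

  module _ (𝒯 : Tensor k n) (𝒯≡ : ∀ f → 𝒯 f ≡ degTensor H f ℚ.+ ℤ→ℚ s ℚ.* adjTensor H f) where

    entry : ∀ i (y : Vector (Fin n) m) → 𝒯 (i VF.∷ y) ≡
      (if does (∣ support (i ∷ values y) ∣ ℕ.≟ 1) then ℕ→ℚ (degree H i) else 0ℚ) ℚ.+
      ℤ→ℚ s ℚ.* ∑ℚ (edges H) (λ e → if support (i ∷ values y) ==ₛ e then inv! m else 0ℚ)
    entry i y = begin
      𝒯 (i VF.∷ y)
        ≡⟨ 𝒯≡ (i VF.∷ y) ⟩
      degTensor H (i VF.∷ y) ℚ.+ ℤ→ℚ s ℚ.* adjTensor H (i VF.∷ y)
        ≡⟨ cong (λ I → (if does (∣ I ∣ ℕ.≟ 1) then ℕ→ℚ (degree H i) else 0ℚ) ℚ.+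
                 ℤ→ℚ s ℚ.* (if does (∣ I ∣ ℕ.≟ k) ∧ isEdge H I then inv! m else 0ℚ))
             (trans (indexSet-support (i VF.∷ y)) (cong support (values-∷ i y))) ⟩
      (if does (∣ support (i ∷ values y) ∣ ℕ.≟ 1) then ℕ→ℚ (degree H i) else 0ℚ) ℚ.+
        ℤ→ℚ s ℚ.* (if does (∣ support (i ∷ values y) ∣ ℕ.≟ k) ∧ isEdge H (support (i ∷ values y)) then inv! m else 0ℚ)
        ≡⟨ cong (λ z → (if does (∣ support (i ∷ values y) ∣ ℕ.≟ 1) then ℕ→ℚ (degree H i) else 0ℚ) ℚ.+ ℤ→ℚ s ℚ.* z)
             (isEdge-∑ k (support (i ∷ values y)) (inv! m) (edges H) (edgesDistinct H) (uniform H)) ⟩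
      _ ∎
      where open ≡-Reasoning

    ∑-entries : ∀ i (Φ : Word n → ℚ) → (∀ {w w′} → w ↭ w′ → Φ w ≡ Φ w′) →
      ∑ℚ (allVecs m n) (λ y → 𝒯 (i VF.∷ y) ℚ.* Φ (map (λ j → (i , y j)) (allFin m))) ≡
      ℕ→ℚ (degree H i) ℚ.* Φ (loops i) ℚ.+
      ℤ→ℚ s ℚ.* ∑ℚ (edges H) (λ e → if Vec.lookup e i then Φ (star i e) else 0ℚ)
    ∑-entries i Φ inv = begin
      ∑ℚ (allVecs m n) (λ y → 𝒯 (i VF.∷ y) ℚ.* Φ (map (λ j → (i , y j)) (allFin m)))
        ≡⟨ ∑ℚ.⨁-cong (allVecs m n) (λ y → cong₂ (λ a w → a ℚ.* Φ w) (entry i y) (ListP.map-∘ (allFin m))) ⟩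
      ∑ℚ (allVecs m n) (F ∘ values)
        ≡⟨ ∑-allVecs m n F ⟩
      ∑ℚ (allLists m n) F
        ≡⟨ ∑ℚ.⨁-cong (allLists m n) (λ z → expand (D z) (ℤ→ℚ s) (A z) (Φ (map (i ,_) z))) ⟩
      ∑ℚ (allLists m n) (λ z → D z ℚ.* Φ (map (i ,_) z) ℚ.+ ℤ→ℚ s ℚ.* (A z ℚ.* Φ (map (i ,_) z)))
        ≡⟨ ∑ℚ.⨁-∙ (allLists m n) _ _ ⟩
      ∑ℚ (allLists m n) (λ z → D z ℚ.* Φ (map (i ,_) z)) ℚ.+ ∑ℚ (allLists m n) (λ z → ℤ→ℚ s ℚ.* (A z ℚ.* Φ (map (i ,_) z)))
        ≡⟨ cong₂ ℚ._+_ (∑-diagonal m i (ℕ→ℚ (degree H i)) Φ) (trans (∑ℚ.⨁-*ˡ (allLists m n) (ℤ→ℚ s) _) (cong (ℤ→ℚ s ℚ.*_) adjacent)) ⟩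
      _ ∎
      where
      open ≡-Reasoning
      D A F : List (Fin n) → ℚ
      D z = if does (∣ support (i ∷ z) ∣ ℕ.≟ 1) then ℕ→ℚ (degree H i) else 0ℚ
      A z = ∑ℚ (edges H) (λ e → if support (i ∷ z) ==ₛ e then inv! m else 0ℚ)
      F z = (D z ℚ.+ ℤ→ℚ s ℚ.* A z) ℚ.* Φ (map (i ,_) z)
      expand : ∀ d t a x → (d ℚ.+ t ℚ.* a) ℚ.* x ≡ d ℚ.* x ℚ.+ t ℚ.* (a ℚ.* x)
      expand d t a x = trans (ℚP.*-distribʳ-+ x d (t ℚ.* a)) (cong (d ℚ.* x ℚ.+_) (ℚP.*-assoc t a x))
      adjacent : ∑ℚ (allLists m n) (λ z → A z ℚ.* Φ (map (i ,_) z)) ≡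
                 ∑ℚ (edges H) (λ e → if Vec.lookup e i then Φ (star i e) else 0ℚ)
      adjacent = begin
        ∑ℚ (allLists m n) (λ z → A z ℚ.* Φ (map (i ,_) z))
          ≡⟨ ∑ℚ.⨁-cong (allLists m n) (λ z → sym (∑ℚ.⨁-*ʳ (edges H) (Φ (map (i ,_) z)) _)) ⟩
        ∑ℚ (allLists m n) (λ z → ∑ℚ (edges H) (λ e → (if support (i ∷ z) ==ₛ e then inv! m else 0ℚ) ℚ.* Φ (map (i ,_) z)))
          ≡⟨ ∑ℚ.⨁-swap (allLists m n) (edges H) _ ⟩
        ∑ℚ (edges H) (λ e → ∑ℚ (allLists m n) (λ z → (if support (i ∷ z) ==ₛ e then inv! m else 0ℚ) ℚ.* Φ (map (i ,_) z)))
          ≡⟨ ∑ℚ.⨁-cong-∈ (edges H) collect ⟩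
        _ ∎
        where
        collect : ∀ e → e ∈ edges H →
          ∑ℚ (allLists m n) (λ z → (if support (i ∷ z) ==ₛ e then inv! m else 0ℚ) ℚ.* Φ (map (i ,_) z)) ≡
          (if Vec.lookup e i then Φ (star i e) else 0ℚ)
        collect e e∈ with Vec.lookup e i in i∈
        ... | true  = ∑-orderings m e (card e∈) i i∈ Φ inv
        ... | false = ∑-orderings-∉ m e i (inv! m) Φ i∈

    constTerm-contribution : ∀ is w → constTerm (derivs w (foldr (opT 𝒯) (trPow n (suc l)) is)) ≡ contribution is w
    constTerm-contribution []       w = constTerm-trPow l w
    constTerm-contribution (i ∷ is) w = trans
      (constTerm-opT 𝒯 i w (foldr (opT 𝒯) (trPow n (suc l)) is))
      (trans (∑ℚ.⨁-cong (allVecs m n) λ y → cong (𝒯 (i VF.∷ y) ℚ.*_)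
                (constTerm-contribution is (w ++ map (λ j → (i , y j)) (allFin m))))
             (∑-entries i (λ w′ → contribution is (w ++ w′)) (λ p → contribution-↭ is (↭P.++⁺ˡ w p))))

  -- One choice of a tensor entry for each operator factor, without coefficients and orderings,
  -- together with its arcs. Vanishing of a contribution is then proved for each choice separately.
  data Selection : List (Fin n) → Word n → Set where
    []   : Selection [] []
    diag : ∀ i {is w} → Selection is w → Selection (i ∷ is) (loops i ++ w)
    edge : ∀ i {is w} e → e ∈ edges H → Vec.lookup e i ≡ true → Selection is w → Selection (i ∷ is) (star i e ++ w)

  contribution-zero : ∀ is w → (∀ w′ → Selection is w′ → closedTrails l (w ++ w′) ≡ 0) → contribution is w ≡ 0ℚ
  contribution-zero []       w zero′ = cong ℕ→ℚ (trans (cong (closedTrails l) (sym (ListP.++-identityʳ w))) (zero′ [] []))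
  contribution-zero (i ∷ is) w zero′ = trans
    (cong₂ (λ a b → ℕ→ℚ (degree H i) ℚ.* a ℚ.+ ℤ→ℚ s ℚ.* b)
      (contribution-zero is (w ++ loops i) λ w′ sel →
        trans (cong (closedTrails l) (ListP.++-assoc w (loops i) w′)) (zero′ _ (diag i sel)))
      (∑ℚ.⨁-ε-∈ (edges H) branch))
    (cong₂ ℚ._+_ (ℚP.*-zeroʳ (ℕ→ℚ (degree H i))) (ℚP.*-zeroʳ (ℤ→ℚ s)))
    where
    branch : ∀ e → e ∈ edges H → (if Vec.lookup e i then contribution is (w ++ star i e) else 0ℚ) ≡ 0ℚ
    branch e e∈ with Vec.lookup e i in i∈
    ... | false = refl
    ... | true  = contribution-zero is (w ++ star i e) λ w′ sel →
      trans (cong (closedTrails l) (ListP.++-assoc w (star i e) w′)) (zero′ _ (edge i e e∈ i∈ sel))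

  selection-tail∈ : ∀ {is w a b} → Selection is w → (a , b) ∈ w → a ∈ is
  selection-tail∈ (diag i sel) v∈ with ∈-++⁻ (loops i) v∈
  ... | inj₁ v∈i = here (cong proj₁ (∈-replicate⁻ m v∈i))
  ... | inj₂ v∈w = there (selection-tail∈ sel v∈w)
  selection-tail∈ (edge i e _ _ sel) v∈ with ∈-++⁻ (star i e) v∈
  ... | inj₁ v∈i = here (star⁻ i e v∈i)
  ... | inj₂ v∈w = there (selection-tail∈ sel v∈w)

  selection-leaves : ∀ {is w i} → Selection is w → i ∈ is → ∃ λ b → (i , b) ∈ w
  selection-leaves (diag i sel) (here refl) = i , here refl
  selection-leaves (diag i sel) (there i∈) with selection-leaves sel i∈
  ... | b , b∈ = b , ∈-++⁺ʳ (loops i) b∈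
  selection-leaves (edge i e e∈ i∈e sel) (here refl) with neighbour e∈ i i∈e
  ... | j , j∈ = j , ∈-++⁺ˡ (∈-map⁺ (i ,_) j∈)
  selection-leaves (edge i e _ _ sel) (there i∈) with selection-leaves sel i∈
  ... | b , b∈ = b , ∈-++⁺ʳ (star i e) b∈

  selection-cases : ∀ {is w} → Selection is w →
    (∃ λ i → ∃ λ e → i ∈ is × e ∈ edges H × Vec.lookup e i ≡ true × (∀ {v} → v ∈ star i e → v ∈ w)) ⊎
    (∀ {a b} → (a , b) ∈ w → b ≡ a)
  selection-cases [] = inj₂ λ ()
  selection-cases (edge i e e∈ i∈e sel) = inj₁ (i , e , here refl , e∈ , i∈e , ∈-++⁺ˡ)
  selection-cases (diag i sel) with selection-cases sel
  ... | inj₁ (i′ , e , i∈ , e∈ , i∈e , sub) = inj₁ (i′ , e , there i∈ , e∈ , i∈e , ∈-++⁺ʳ (loops i) ∘ sub)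
  ... | inj₂ loop = inj₂ λ v∈ → case ∈-++⁻ (loops i) v∈ of λ where
    (inj₁ v∈i) → trans (cong proj₂ (∈-replicate⁻ m v∈i)) (sym (cong proj₁ (∈-replicate⁻ m v∈i)))
    (inj₂ v∈w) → loop v∈w

  -- An edge entry sends an arc to a neighbour of i, a dead end because all arcs start at i. Hence
  -- every factor takes d_i and yields m loops; the length hypothesis makes them l + 1 in total.
  contribution-constant : ∀ i is w → All (_≡ i) is → All (_≡ (i , i)) w → length w + length is * m ≡ suc l →
    contribution is w ≡ ℕ→ℚ (degree H i ^ length is * suc l !)
  contribution-constant i [] w [] aw len =
    cong ℕ→ℚ (trans (closedTrails-loops l i w aw (trans (sym (ℕP.+-identityʳ _)) len)) (sym (ℕP.*-identityˡ (suc l !))))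
  contribution-constant i (_ ∷ is) w (refl ∷ ais) aw len = begin
    ℕ→ℚ (degree H i) ℚ.* contribution is (w ++ loops i) ℚ.+
      ℤ→ℚ s ℚ.* ∑ℚ (edges H) (λ e → if Vec.lookup e i then contribution is (w ++ star i e) else 0ℚ)
      ≡⟨ cong₂ (λ a b → ℕ→ℚ (degree H i) ℚ.* a ℚ.+ ℤ→ℚ s ℚ.* b)
           (contribution-constant i is (w ++ loops i) ais (AllP.++⁺ aw (AllP.replicate⁺ m refl)) len′)
           (∑ℚ.⨁-ε-∈ (edges H) branch) ⟩
    ℕ→ℚ (degree H i) ℚ.* ℕ→ℚ (degree H i ^ length is * suc l !) ℚ.+ ℤ→ℚ s ℚ.* 0ℚ
      ≡⟨ cong₂ ℚ._+_ (sym (ℕ→ℚ-* (degree H i) _)) (ℚP.*-zeroʳ (ℤ→ℚ s)) ⟩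
    ℕ→ℚ (degree H i * (degree H i ^ length is * suc l !)) ℚ.+ 0ℚ
      ≡⟨ trans (ℚP.+-identityʳ _) (cong ℕ→ℚ (sym (ℕP.*-assoc (degree H i) (degree H i ^ length is) (suc l !)))) ⟩
    ℕ→ℚ (degree H i ^ suc (length is) * suc l !) ∎
    where
    open ≡-Reasoning
    len′ : length (w ++ loops i) + length is * m ≡ suc l
    len′ = trans (cong (_+ length is * m) (trans (ListP.length-++ w) (cong (length w ℕ.+_) (ListP.length-replicate m))))
      (trans (ℕP.+-assoc (length w) m (length is * m)) len)
    branch : ∀ e → e ∈ edges H → (if Vec.lookup e i then contribution is (w ++ star i e) else 0ℚ) ≡ 0ℚ
    branch e e∈ with Vec.lookup e i in i∈
    ... | false = refl
    ... | true with neighbour e∈ i i∈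
    ...   | j , j∈ = contribution-zero is (w ++ star i e) λ w′ sel →
      closedTrails-deadEnd l ((w ++ star i e) ++ w′) {i} {j} (∈-++⁺ˡ (∈-++⁺ʳ w (∈-map⁺ (i ,_) j∈))) (dead sel)
      where
      i≢j : i ≢ j
      i≢j = proj₂ (∈-others⁻ e i j∈)
      dead : ∀ {w′} → Selection is w′ → ∀ b → (j , b) ∉ (w ++ star i e) ++ w′
      dead sel b v∈ with ∈-++⁻ (w ++ star i e) v∈
      ... | inj₂ v∈w′ = i≢j (sym (All.lookup ais (selection-tail∈ sel v∈w′)))
      ... | inj₁ v∈₁ with ∈-++⁻ w v∈₁
      ...   | inj₁ v∈w = i≢j (sym (cong proj₁ (All.lookup aw v∈w)))
      ...   | inj₂ v∈s = i≢j (sym (star⁻ i e v∈s))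

  module _ (e₀ : Subset n) (e₀∈ : e₀ ∈ edges H) where

    -- Here `is` holds the vertices of e₀ whose entry is still to be chosen, and w the arcs chosen
    -- so far. Arcs of w start at settled vertices of e₀, and each vertex of e₀ is pending or
    -- already has an exit; this excludes every choice but e₀ at the next vertex.
    contribution-edge : ∀ is w → Unique is → (∀ {v} → v ∈ is → Vec.lookup e₀ v ≡ true) →
      (∀ {a b} → (a , b) ∈ w → Vec.lookup e₀ a ≡ true × a ∉ is) →
      (∀ v → Vec.lookup e₀ v ≡ true → v ∈ is ⊎ ∃ λ b → (v , b) ∈ w) →
      contribution is w ≡ ℤ→ℚ (s ℤ.^ length is) ℚ.* ℕ→ℚ (closedTrails l (w ++ concatMap (λ i → star i e₀) is))
    contribution-edge [] w _ _ _ _ =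
      trans (cong (ℕ→ℚ ∘ closedTrails l) (sym (ListP.++-identityʳ w))) (sym (ℚP.*-identityˡ _))
    contribution-edge (j ∷ is) w (j∉ ∷ u) sub tails covers = begin
      ℕ→ℚ (degree H j) ℚ.* contribution is (w ++ loops j) ℚ.+
        ℤ→ℚ s ℚ.* ∑ℚ (edges H) (λ e → if Vec.lookup e j then contribution is (w ++ star j e) else 0ℚ)
        ≡⟨ cong₂ (λ a b → ℕ→ℚ (degree H j) ℚ.* a ℚ.+ ℤ→ℚ s ℚ.* b) diagonal
             (trans (∑ℚ.⨁-single (edgesDistinct H) e₀∈ other)
                    (cong (λ b → if b then contribution is (w ++ star j e₀) else 0ℚ) j∈e₀)) ⟩
      ℕ→ℚ (degree H j) ℚ.* 0ℚ ℚ.+ ℤ→ℚ s ℚ.* contribution is (w ++ star j e₀)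
        ≡⟨ trans (cong (ℚ._+ (ℤ→ℚ s ℚ.* contribution is (w ++ star j e₀))) (ℚP.*-zeroʳ (ℕ→ℚ (degree H j)))) (ℚP.+-identityˡ _) ⟩
      ℤ→ℚ s ℚ.* contribution is (w ++ star j e₀)
        ≡⟨ cong (ℤ→ℚ s ℚ.*_) (contribution-edge is (w ++ star j e₀) u (sub ∘ there) tails′ covers′) ⟩
      ℤ→ℚ s ℚ.* (ℤ→ℚ (s ℤ.^ length is) ℚ.* ℕ→ℚ (closedTrails l ((w ++ star j e₀) ++ concatMap (λ i → star i e₀) is)))
        ≡⟨ ℚP.*-assoc (ℤ→ℚ s) (ℤ→ℚ (s ℤ.^ length is)) _ ⟨
      ℤ→ℚ s ℚ.* ℤ→ℚ (s ℤ.^ length is) ℚ.* ℕ→ℚ (closedTrails l ((w ++ star j e₀) ++ concatMap (λ i → star i e₀) is))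
        ≡⟨ cong₂ (λ a z → a ℚ.* ℕ→ℚ (closedTrails l z)) (sym (ℤ→ℚ-* s (s ℤ.^ length is)))
             (ListP.++-assoc w (star j e₀) (concatMap (λ i → star i e₀) is)) ⟩
      ℤ→ℚ (s ℤ.^ suc (length is)) ℚ.* ℕ→ℚ (closedTrails l (w ++ concatMap (λ i → star i e₀) (j ∷ is))) ∎
      where
      open ≡-Reasoning
      j∈e₀ : Vec.lookup e₀ j ≡ true
      j∈e₀ = sub (here refl)
      j∉is : j ∉ is
      j∉is j∈ = All.lookup j∉ j∈ refl
      tails′ : ∀ {a b} → (a , b) ∈ w ++ star j e₀ → Vec.lookup e₀ a ≡ true × a ∉ is
      tails′ v∈ with ∈-++⁻ w v∈
      ... | inj₁ v∈w = proj₁ (tails v∈w) , proj₂ (tails v∈w) ∘ there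
      ... | inj₂ v∈s = subst (λ a → Vec.lookup e₀ a ≡ true × a ∉ is) (sym (star⁻ j e₀ v∈s)) (j∈e₀ , j∉is)
      covers′ : ∀ v → Vec.lookup e₀ v ≡ true → v ∈ is ⊎ ∃ λ b → (v , b) ∈ w ++ star j e₀
      covers′ v v∈ with covers v v∈
      ... | inj₁ (here refl) with neighbour e₀∈ j j∈e₀
      ...   | b , b∈ = inj₂ (b , ∈-++⁺ʳ w (∈-map⁺ (j ,_) b∈))
      covers′ v v∈ | inj₁ (there v∈is) = inj₁ v∈is
      covers′ v v∈ | inj₂ (b , b∈)     = inj₂ (b , ∈-++⁺ˡ b∈)
      -- With only loops at j a trail is trapped there, yet an arc starts at a second vertex v of
      -- e₀.
      diagonal : contribution is (w ++ loops j) ≡ 0ℚ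
      diagonal with neighbour e₀∈ j j∈e₀
      ... | v , v∈ = contribution-zero is (w ++ loops j) λ w′ sel →
        closedTrails-trap l ((w ++ loops j) ++ w′) {j} {j} {v} (∈-++⁺ˡ (∈-++⁺ʳ w (here refl))) (trapped sel)
          (proj₂ (exit sel)) (j≢v ∘ sym)
        where
        j≢v : j ≢ v
        j≢v = proj₂ (∈-others⁻ e₀ j v∈)
        trapped : ∀ {w′} → Selection is w′ → ∀ b → (j , b) ∈ (w ++ loops j) ++ w′ → b ≡ j
        trapped sel b b∈ with ∈-++⁻ (w ++ loops j) b∈
        ... | inj₂ b∈w′ = contradiction (selection-tail∈ sel b∈w′) j∉is
        ... | inj₁ b∈₁ with ∈-++⁻ w b∈₁
        ...   | inj₁ b∈w = contradiction (here refl) (proj₂ (tails b∈w))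
        ...   | inj₂ b∈l = cong proj₂ (∈-replicate⁻ m b∈l)
        exit : ∀ {w′} → Selection is w′ → ∃ λ b → (v , b) ∈ (w ++ loops j) ++ w′
        exit sel with covers v (proj₁ (∈-others⁻ e₀ j v∈))
        ... | inj₁ (here refl) = contradiction refl j≢v
        ... | inj₁ (there v∈is) with selection-leaves sel v∈is
        ...   | b , b∈ = b , ∈-++⁺ʳ (w ++ loops j) b∈
        exit sel | inj₂ (b , b∈) = b , ∈-++⁺ˡ (∈-++⁺ˡ b∈)
      -- The edge e has a vertex v outside e₀, and j → v is a dead end because all arcs start in e₀.
      other : ∀ e → e ∈ edges H → e ≢ e₀ → (if Vec.lookup e j then contribution is (w ++ star j e) else 0ℚ) ≡ 0ℚ
      other e e∈ e≢ with Vec.lookup e j in j∈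
      ... | false = refl
      ... | true with ∃-edge-∖ {e = e} {e₀} (trans (card e∈) (sym (card e₀∈))) e≢
      ...   | v , v∈e , v∉e₀ = contribution-zero is (w ++ star j e) λ w′ sel →
        closedTrails-deadEnd l ((w ++ star j e) ++ w′) {j} {v}
          (∈-++⁺ˡ (∈-++⁺ʳ w (∈-map⁺ (j ,_) (∈-others⁺ e j v∈e λ { refl → outsider j∈e₀ })))) (dead sel)
        where
        outsider : Vec.lookup e₀ v ≢ true
        outsider eq = contradiction (trans (sym eq) v∉e₀) λ ()
        dead : ∀ {w′} → Selection is w′ → ∀ b → (v , b) ∉ (w ++ star j e) ++ w′
        dead sel b b∈ with ∈-++⁻ (w ++ star j e) b∈
        ... | inj₂ b∈w′ = outsider (sub (there (selection-tail∈ sel b∈w′)))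
        ... | inj₁ b∈₁ with ∈-++⁻ w b∈₁
        ...   | inj₁ b∈w = outsider (proj₁ (tails b∈w))
        ...   | inj₂ b∈s = outsider (subst (λ a → Vec.lookup e₀ a ≡ true) (sym (star⁻ j e b∈s)) j∈e₀)

-- Summation over the exponents

vertices : ∀ {n} → Vector ℕ n → List (Fin n)
vertices {n} ds = concatMap (λ i → replicate (ds i) i) (allFin n)

opPow-replicate : ∀ {m n} (𝒯 : Tensor (suc m) n) i r p → opPow 𝒯 i r p ≡ foldr (opT 𝒯) p (replicate r i)
opPow-replicate 𝒯 i zero    p = refl
opPow-replicate 𝒯 i (suc r) p = cong (opT 𝒯 i) (opPow-replicate 𝒯 i r p)

applyAll-vertices : ∀ {m n} (𝒯 : Tensor (suc m) n) ds p → applyAll 𝒯 ds p ≡ foldr (opT 𝒯) p (vertices ds)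
applyAll-vertices {n = n} 𝒯 ds p = go (allFin n)
  where
  go : ∀ xs → foldr (λ i q → opPow 𝒯 i (ds i) q) p xs ≡ foldr (opT 𝒯) p (concatMap (λ i → replicate (ds i) i) xs)
  go []       = refl
  go (i ∷ xs) = trans (opPow-replicate 𝒯 i (ds i) _)
    (trans (cong (λ q → foldr (opT 𝒯) q (replicate (ds i) i)) (go xs))
           (sym (ListP.foldr-++ (opT 𝒯) p (replicate (ds i) i) _)))

∈-vertices⁺ : ∀ {n} (ds : Vector ℕ n) {v} → ds v ≢ 0 → v ∈ vertices ds
∈-vertices⁺ ds {v} ne = ∈-concat⁺′ (repl (ds v) ne) (∈-map⁺ (λ i → replicate (ds i) i) (∈-allFin v))
  where
  repl : ∀ r → r ≢ 0 → v ∈ replicate r v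
  repl zero    ne = contradiction refl ne
  repl (suc r) _  = here refl

∈-vertices⁻ : ∀ {n} (ds : Vector ℕ n) {v} → v ∈ vertices ds → ds v ≢ 0
∈-vertices⁻ {n} ds v∈ ds≡0 with ∈-concat⁻′ (map (λ i → replicate (ds i) i) (allFin n)) v∈
... | ls , v∈ls , ls∈ with ∈-map⁻ (λ i → replicate (ds i) i) ls∈
... | i , _ , refl with ∈-replicate⁻ (ds i) v∈ls
... | refl rewrite ds≡0 = contradiction v∈ls λ ()

length-concatMap : ∀ (f : X → List Y) xs → length (concatMap f xs) ≡ ∑ xs (length ∘ f)
length-concatMap f []       = refl
length-concatMap f (x ∷ xs) = trans (ListP.length-++ (f x)) (cong (length (f x) ℕ.+_) (length-concatMap f xs))

length-vertices : ∀ {n} (ds : Vector ℕ n) → length (vertices ds) ≡ ∑ (allFin n) ds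
length-vertices {n} ds = trans (length-concatMap _ (allFin n)) (∑-cong (allFin n) λ i → ListP.length-replicate (ds i))

vertices-χ : ∀ {n} (ds : Vector ℕ n) e → (∀ v → ds v ≡ χ e v) → vertices ds ≡ members e
vertices-χ {n} ds e eq = go (allFin n)
  where
  go : ∀ xs → concatMap (λ i → replicate (ds i) i) xs ≡ filterᵇ (Vec.lookup e) xs
  go []       = refl
  go (i ∷ xs) rewrite eq i | go xs with Vec.lookup e i
  ... | true  = refl
  ... | false = refl

-- Exponent vectors and their indicators

compositions-∑ : ∀ n d {ds : Vector ℕ n} → ds ∈ compositions n d → ∑ (allFin n) ds ≡ d
compositions-∑ zero    zero ds∈ = refl
compositions-∑ (suc n) d ds∈ with ∈-concat⁻′ (map (λ j → map (j VF.∷_) (compositions n (d ∸ j))) (upTo (suc d))) ds∈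
... | ls , ds∈ls , ls∈ with ∈-map⁻ (λ j → map (j VF.∷_) (compositions n (d ∸ j))) ls∈
... | j , j∈ , refl with ∈-map⁻ (j VF.∷_) ds∈ls
... | ds′ , ds′∈ , refl = trans (∑-allFin-suc n (j VF.∷ ds′))
  (trans (cong (j ℕ.+_) (compositions-∑ n (d ∸ j) ds′∈)) (ℕP.m+[n∸m]≡n (ℕP.≤-pred (∈-upTo⁻ j∈))))

-- A numerical indicator of pointwise equality, the form of equality suited to vectors that are
-- functions. The product over coordinates follows the recursion of `compositions`.
agree : ∀ {n} → Vector ℕ n → Vector ℕ n → ℕ
agree {zero}  f g = 1
agree {suc n} f g = ind (does (f Fin.zero ℕ.≟ g Fin.zero)) * agree (f ∘ Fin.suc) (g ∘ Fin.suc)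

agree-≗ : ∀ {n} {f g : Vector ℕ n} → (∀ v → f v ≡ g v) → agree f g ≡ 1
agree-≗ {zero}          eq = refl
agree-≗ {suc n} {f} {g} eq = cong₂ (λ b z → ind b * z)
  (dec-true (f Fin.zero ℕ.≟ g Fin.zero) (eq Fin.zero)) (agree-≗ (eq ∘ Fin.suc))

agree-zero : ∀ {n} {f g : Vector ℕ n} → ¬ (∀ v → f v ≡ g v) → agree f g ≡ 0
agree-zero {zero}          ne = contradiction (λ ()) ne
agree-zero {suc n} {f} {g} ne with f Fin.zero ℕ.≟ g Fin.zero
... | no ¬eq = cong (λ b → ind b * agree (f ∘ Fin.suc) (g ∘ Fin.suc)) (dec-false (f Fin.zero ℕ.≟ g Fin.zero) ¬eq)
... | yes eq = trans
  (cong (ind (does (f Fin.zero ℕ.≟ g Fin.zero)) ℕ.*_)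
    (agree-zero λ eqs → ne λ { Fin.zero → eq ; (Fin.suc v) → eqs v }))
  (ℕP.*-zeroʳ (ind (does (f Fin.zero ℕ.≟ g Fin.zero))))

-- Every vector of total d is listed exactly once up to pointwise equality: the first coordinate
-- selects one branch and the rest is induction.
∑-agree : ∀ n d (x : Vector ℕ n) → ∑ (allFin n) x ≡ d → ∑ (compositions n d) (λ ds → agree ds x) ≡ 1
∑-agree zero    zero    x eq = refl
∑-agree (suc n) d       x eq = begin
  ∑ (compositions (suc n) d) (λ ds → agree ds x)
    ≡⟨ trans (∑-concatMap (λ j → map (j VF.∷_) (compositions n (d ∸ j))) (upTo (suc d)) (λ ds → agree ds x))
         (∑-cong (upTo (suc d)) λ j → ∑-map (j VF.∷_) (compositions n (d ∸ j)) (λ ds → agree ds x)) ⟩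
  ∑ (upTo (suc d)) (λ j → ∑ (compositions n (d ∸ j)) (λ ds → ind (does (j ℕ.≟ x₀)) * agree ds (x ∘ Fin.suc)))
    ≡⟨ ∑-cong (upTo (suc d)) (λ j → ∑-*ˡ (compositions n (d ∸ j)) (ind (does (j ℕ.≟ x₀))) _) ⟩
  ∑ (upTo (suc d)) (λ j → ind (does (j ℕ.≟ x₀)) * ∑ (compositions n (d ∸ j)) (λ ds → agree ds (x ∘ Fin.suc)))
    ≡⟨ ∑-single (UniqueP.upTo⁺ (suc d)) (∈-upTo⁺ (s≤s x₀≤d)) (λ j _ j≢ →
         cong (λ b → ind b * ∑ (compositions n (d ∸ j)) (λ ds → agree ds (x ∘ Fin.suc))) (dec-false (j ℕ.≟ x₀) j≢)) ⟩
  ind (does (x₀ ℕ.≟ x₀)) * ∑ (compositions n (d ∸ x₀)) (λ ds → agree ds (x ∘ Fin.suc))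
    ≡⟨ cong₂ (λ b z → ind b * z) (dec-true (x₀ ℕ.≟ x₀) refl)
         (∑-agree n (d ∸ x₀) (x ∘ Fin.suc) (sym (trans (cong (_∸ x₀) (sym split)) (ℕP.m+n∸m≡n x₀ _)))) ⟩
  1 ∎
  where
  open ≡-Reasoning
  x₀ : ℕ
  x₀ = x Fin.zero
  split : x₀ + ∑ (allFin n) (x ∘ Fin.suc) ≡ d
  split = trans (sym (∑-allFin-suc n x)) eq
  x₀≤d : x₀ ≤ d
  x₀≤d = subst (x₀ ≤_) split (ℕP.m≤m+n x₀ _)

∑-mono : ∀ (xs : List X) {f g : X → ℕ} → (∀ x → g x ≤ f x) → ∑ xs g ≤ ∑ xs f
∑-mono []       le = z≤n
∑-mono (x ∷ xs) le = ℕP.+-mono-≤ (le x) (∑-mono xs le)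

∑-squeeze : ∀ (xs : List X) {f g : X → ℕ} → (∀ x → g x ≤ f x) → ∑ xs f ≤ ∑ xs g → ∀ {x} → x ∈ xs → f x ≡ g x
∑-squeeze (y ∷ xs) {f} {g} le sum≤ (here refl) = ℕP.≤-antisym
  (ℕP.+-cancelʳ-≤ (∑ xs f) (f y) (g y) (ℕP.≤-trans sum≤ (ℕP.+-monoʳ-≤ (g y) (∑-mono xs le)))) (le y)
∑-squeeze (y ∷ xs) {f} {g} le sum≤ (there x∈) = ∑-squeeze xs le
  (ℕP.+-cancelˡ-≤ (f y) (∑ xs f) (∑ xs g) (ℕP.≤-trans sum≤ (ℕP.+-monoˡ-≤ (∑ xs g) (le y)))) x∈

peak : ∀ {n} → ℕ → Fin n → Vector ℕ n
peak d i v = δ i v * d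

peak-≡ : ∀ {n} d (i : Fin n) → peak d i i ≡ d
peak-≡ d i = trans (cong (_* d) (δ-refl i)) (ℕP.*-identityˡ d)

peak-≢ : ∀ {n} d {i v : Fin n} → v ≢ i → peak d i v ≡ 0
peak-≢ d v≢i = cong (_* d) (δ-≢ (v≢i ∘ sym))

χ≤1 : ∀ {n} (e : Subset n) v → χ e v ≤ 1
χ≤1 e v with Vec.lookup e v
... | true  = s≤s z≤n
... | false = z≤n

χ-injective : ∀ {n} {e e′ : Subset n} → (∀ v → χ e v ≡ χ e′ v) → e ≡ e′
χ-injective {e = e} {e′} eq = trans (sym (VecP.tabulate∘lookup e))
  (trans (VecP.tabulate-cong λ v → ind-injective (eq v)) (VecP.tabulate∘lookup e′))
  where
  ind-injective : ∀ {b b′} → ind b ≡ ind b′ → b ≡ b′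
  ind-injective {true}  {true}  _ = refl
  ind-injective {false} {false} _ = refl

*-^ : ∀ a b r → (a * b) ^ r ≡ a ^ r * b ^ r
*-^ a b zero    = refl
*-^ a b (suc r) = trans (cong (a * b ℕ.*_) (*-^ a b r)) (regroup a b (a ^ r) (b ^ r))
  where
  regroup : ∀ a b c d → a * b * (c * d) ≡ a * c * (b * d)
  regroup = solve-∀

power : ℚ → ℕ → ℚ
power a zero    = 1ℚ
power a (suc r) = a ℚ.* power a r

∏-inv! : ∀ {n} m (e : Subset n) xs → ∏ℚ xs (λ i → inv! (χ e i * m)) ≡ power (inv! m) (∑ xs (χ e))
∏-inv! m e []       = refl
∏-inv! m e (i ∷ xs) with Vec.lookup e i
... | true  = cong₂ (λ a b → inv! a ℚ.* b) (ℕP.*-identityˡ m) (∏-inv! m e xs)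
... | false = trans (ℚP.*-identityˡ _) (∏-inv! m e xs)

multiplicity-complete : ∀ {n} (e : Subset n) a b →
  multiplicity (concatMap (λ i → star i e) (members e)) a b ≡ χ e a * (δ̅ a b * χ e b)
multiplicity-complete {n} e a b = begin
  multiplicity (concatMap (λ i → star i e) (members e)) a b
    ≡⟨ flatten (members e) ⟩
  ∑ (members e) (λ i → δ i a * (δ̅ i b * χ e b))
    ≡⟨ ∑-filterᵇ (Vec.lookup e) (allFin n) _ ⟩
  ∑ (allFin n) (λ i → χ e i * (δ i a * (δ̅ i b * χ e b)))
    ≡⟨ ∑-cong (allFin n) (λ i → trans (cong (λ z → χ e i * (z * (δ̅ i b * χ e b))) (δ-sym i a))
         (commute (χ e i) (δ a i) (δ̅ i b * χ e b))) ⟩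
  ∑ (allFin n) (λ i → δ a i * (χ e i * (δ̅ i b * χ e b)))
    ≡⟨ ∑-δ a (λ i → χ e i * (δ̅ i b * χ e b)) ⟩
  χ e a * (δ̅ a b * χ e b) ∎
  where
  open ≡-Reasoning
  commute : ∀ x y z → x * (y * z) ≡ y * (x * z)
  commute = solve-∀
  flatten : ∀ xs → multiplicity (concatMap (λ i → star i e) xs) a b ≡ ∑ xs (λ i → δ i a * (δ̅ i b * χ e b))
  flatten []       = refl
  flatten (i ∷ xs) = trans (multiplicity-++ (star i e) _ a b) (cong₂ _+_ (multiplicity-star i e a b) (flatten xs))

module Trace {m₁ n : ℕ} (H : Hypergraph (suc (suc m₁)) n) (s : ℤ)
             (𝒯 : Tensor (suc (suc m₁)) n)
             (𝒯≡ : ∀ f → 𝒯 f ≡ degTensor H f ℚ.+ ℤ→ℚ s ℚ.* adjTensor H f)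
             (d l : ℕ) (1≤d : 1 ≤ d) (d≤k : d ≤ suc (suc m₁)) (dm≡ : d * suc m₁ ≡ suc l) where

  open Contribution H s l

  value : Vector ℕ n → ℚ
  value ds = prodℚ (map (λ i → inv! (ds i * m)) (allFin n)) ℚ.* constTerm (applyAll 𝒯 ds (trPow n (d * m)))

  circuits : ℕ
  circuits = k ^ m * (m₁ !) ^ m * m !

  -- Each exponent 1 gives `inv! m` and each exponent 0 gives 1; the k adjacency entries give the
  -- sign s^k.
  edgeValue : ℚ
  edgeValue = power (inv! m) k ℚ.* (ℤ→ℚ (s ℤ.^ k) ℚ.* ℕ→ℚ circuits)

  value-contribution : ∀ ds → value ds ≡ ∏ℚ (allFin n) (λ i → inv! (ds i * m)) ℚ.* contribution (vertices ds) []
  value-contribution ds = cong₂ ℚ._*_ (∏ℚ.foldr-map _ (allFin n)) (begin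
    constTerm (applyAll 𝒯 ds (trPow n (d * m)))                  ≡⟨ cong constTerm (applyAll-vertices 𝒯 ds (trPow n (d * m))) ⟩
    constTerm (foldr (opT 𝒯) (trPow n (d * m)) (vertices ds))    ≡⟨ cong (λ L → constTerm (foldr (opT 𝒯) (trPow n L) (vertices ds))) dm≡ ⟩
    constTerm (foldr (opT 𝒯) (trPow n (suc l)) (vertices ds))    ≡⟨ constTerm-contribution 𝒯 𝒯≡ (vertices ds) [] ⟩
    contribution (vertices ds) []                                ∎)
    where open ≡-Reasoning

  module _ (ds : Vector ℕ n) (∑ds : ∑ (allFin n) ds ≡ d) where

    length≡d : length (vertices ds) ≡ d
    length≡d = trans (length-vertices ds) ∑ds

    -- The (l + 1)! orders of the loops cancel the factorial of the single nonzero exponent times m.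
    value-peak : ∀ i → (∀ v → ds v ≡ peak d i v) → value ds ≡ ℕ→ℚ (degree H i ^ d)
    value-peak i eq = begin
      value ds
        ≡⟨ value-contribution ds ⟩
      ∏ℚ (allFin n) (λ v → inv! (ds v * m)) ℚ.* contribution (vertices ds) []
        ≡⟨ cong₂ ℚ._*_ factor contrib ⟩
      inv! (suc l) ℚ.* ℕ→ℚ (degree H i ^ d * suc l !)
        ≡⟨ cong (inv! (suc l) ℚ.*_) (trans (cong ℕ→ℚ (ℕP.*-comm (degree H i ^ d) (suc l !))) (ℕ→ℚ-* (suc l !) (degree H i ^ d))) ⟩
      inv! (suc l) ℚ.* (ℕ→ℚ (suc l !) ℚ.* ℕ→ℚ (degree H i ^ d))
        ≡⟨ ℚP.*-assoc (inv! (suc l)) (ℕ→ℚ (suc l !)) (ℕ→ℚ (degree H i ^ d)) ⟨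
      inv! (suc l) ℚ.* ℕ→ℚ (suc l !) ℚ.* ℕ→ℚ (degree H i ^ d)
        ≡⟨ trans (cong (ℚ._* ℕ→ℚ (degree H i ^ d)) (inv!-inverse (suc l))) (ℚP.*-identityˡ _) ⟩
      ℕ→ℚ (degree H i ^ d) ∎
      where
      open ≡-Reasoning
      factor : ∏ℚ (allFin n) (λ v → inv! (ds v * m)) ≡ inv! (suc l)
      factor = trans
        (∏ℚ.⨁-single (allFin-unique n) (∈-allFin i) λ v _ v≢i →
          cong (λ z → inv! (z * m)) (trans (eq v) (peak-≢ d v≢i)))
        (cong inv! (trans (cong (_* m) (trans (eq i) (peak-≡ d i))) dm≡))
      all-i : All (_≡ i) (vertices ds)
      all-i = All.tabulate λ {v} v∈ → only v (∈-vertices⁻ ds v∈)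
        where
        only : ∀ v → ds v ≢ 0 → v ≡ i
        only v ne with v Fin.≟ i
        ... | yes v≡i = v≡i
        ... | no v≢i  = contradiction (trans (eq v) (peak-≢ d v≢i)) ne
      contrib : contribution (vertices ds) [] ≡ ℕ→ℚ (degree H i ^ d * suc l !)
      contrib = trans (contribution-constant i (vertices ds) [] all-i [] (trans (cong (_* m) length≡d) dm≡))
        (cong (λ r → ℕ→ℚ (degree H i ^ r * suc l !)) length≡d)

    d≡k : ∀ {e} → e ∈ edges H → (∀ v → ds v ≡ χ e v) → d ≡ k
    d≡k {e} e∈ eq = trans (sym ∑ds) (trans (∑-cong (allFin n) eq) (trans (∑-χ e) (card e∈)))

    value-edge : ∀ e → e ∈ edges H → (∀ v → ds v ≡ χ e v) → value ds ≡ edgeValue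
    value-edge e e∈ eq = trans (value-contribution ds) (cong₂ ℚ._*_ factor contrib)
      where
      open ≡-Reasoning
      factor : ∏ℚ (allFin n) (λ v → inv! (ds v * m)) ≡ power (inv! m) k
      factor = trans (∏ℚ.⨁-cong (allFin n) λ v → cong (λ z → inv! (z * m)) (eq v))
        (trans (∏-inv! m e (allFin n)) (cong (power (inv! m)) (trans (∑-χ e) (card e∈))))
      arcs : Word n
      arcs = concatMap (λ i → star i e) (members e)
      length-arcs : length arcs ≡ suc l
      length-arcs = begin
        length arcs
          ≡⟨ length-concatMap (λ i → star i e) (members e) ⟩
        ∑ (members e) (λ i → length (star i e))
          ≡⟨ ∑-cong-∈ (members e) (λ i i∈ → trans (ListP.length-map (i ,_) (others e i)) (length-others e i (∈-members⁻ e i∈) (card e∈))) ⟩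
        ∑ (members e) (λ _ → m)
          ≡⟨ trans (∑-const (members e) m) (cong (_* m) (trans (length-members e) (trans (card e∈) (sym (d≡k e∈ eq))))) ⟩
        d * m
          ≡⟨ dm≡ ⟩
        suc l ∎
      contrib : contribution (vertices ds) [] ≡ ℤ→ℚ (s ℤ.^ k) ℚ.* ℕ→ℚ circuits
      contrib = begin
        contribution (vertices ds) []
          ≡⟨ cong (λ is → contribution is []) (vertices-χ ds e eq) ⟩
        contribution (members e) []
          ≡⟨ contribution-edge e e∈ (members e) [] (members-unique e) (∈-members⁻ e) (λ ()) (λ v v∈ → inj₁ (∈-members⁺ e v∈)) ⟩
        ℤ→ℚ (s ℤ.^ length (members e)) ℚ.* ℕ→ℚ (closedTrails l arcs)
          ≡⟨ cong₂ (λ r z → ℤ→ℚ (s ℤ.^ r) ℚ.* ℕ→ℚ z) (trans (length-members e) (card e∈))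
               (closedTrails-complete l m₁ e arcs (card e∈) length-arcs (multiplicity-complete e)) ⟩
        ℤ→ℚ (s ℤ.^ k) ℚ.* ℕ→ℚ circuits ∎

    -- An edge e among the choices either has a vertex of exponent 0, a dead end, or satisfies χ e ≤
    -- ds, and then d ≤ k forces ds = χ e. If all choices are diagonal, two vertices of positive
    -- exponent trap the trail, and a single one makes ds a peak.
    contribution-other : (∀ i → ¬ (∀ v → ds v ≡ peak d i v)) → (∀ e → e ∈ edges H → ¬ (∀ v → ds v ≡ χ e v)) →
                         contribution (vertices ds) [] ≡ 0ℚ
    contribution-other ¬peak ¬edge = contribution-zero (vertices ds) [] λ w sel → vanish w sel (selection-cases sel)
      where
      occurring : ∃ λ i → i ∈ vertices ds
      occurring with vertices ds | length≡d
      ... | []    | refl = contradiction 1≤d λ ()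
      ... | i ∷ _ | _    = i , here refl
      vanish : ∀ w → Selection (vertices ds) w →
        (∃ λ i → ∃ λ e → i ∈ vertices ds × e ∈ edges H × Vec.lookup e i ≡ true × (∀ {v} → v ∈ star i e → v ∈ w)) ⊎
        (∀ {a b} → (a , b) ∈ w → b ≡ a) → closedTrails l w ≡ 0
      vanish w sel (inj₁ (i , e , i∈ , e∈ , i∈e , sub)) =
        decide (FinP.any? (λ v → (Vec.lookup e v Data.Bool.≟ true) ×-dec (ds v ℕ.≟ 0)))
        where
        below : (∀ v → Vec.lookup e v ≡ true → ds v ≢ 0) → ∀ v → χ e v ≤ ds v
        below pos v with Vec.lookup e v in v∈
        ... | false = z≤n
        ... | true  = ℕP.n≢0⇒n>0 (pos v v∈)
        bound : ∑ (allFin n) ds ≤ ∑ (allFin n) (χ e)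
        bound = subst₂ _≤_ (sym ∑ds) (sym (trans (∑-χ e) (card e∈))) d≤k
        decide : Dec (∃ λ v → Vec.lookup e v ≡ true × ds v ≡ 0) → closedTrails l w ≡ 0
        decide (yes (v , v∈e , dv≡0)) = closedTrails-deadEnd l w {i} {v}
          (sub (∈-map⁺ (i ,_) (∈-others⁺ e i v∈e λ { refl → ∈-vertices⁻ ds i∈ dv≡0 })))
          (λ b b∈ → ∈-vertices⁻ ds (selection-tail∈ sel b∈) dv≡0)
        decide (no none) = contradiction
          (λ v → ∑-squeeze (allFin n) (below λ v v∈ dv≡0 → none (v , v∈ , dv≡0)) bound (∈-allFin v)) (¬edge e e∈)
      vanish w sel (inj₂ loop) = decide (FinP.any? (λ v → ¬? (ds v ℕ.≟ 0) ×-dec ¬? (v Fin.≟ i)))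
        where
        i : Fin n
        i = proj₁ occurring
        pointwise : (∀ v → v ≢ i → ds v ≡ 0) → ∀ v → ds v ≡ peak d i v
        pointwise off v with v Fin.≟ i
        ... | yes refl = trans (sym (∑-single (allFin-unique n) (∈-allFin i) λ x _ → off x)) (trans ∑ds (sym (peak-≡ d i)))
        ... | no v≢i   = trans (off v v≢i) (sym (peak-≢ d v≢i))
        decide : Dec (∃ λ v → ds v ≢ 0 × v ≢ i) → closedTrails l w ≡ 0
        decide (yes (v , dv≢0 , v≢i)) = closedTrails-trap l w {i} (proj₂ (selection-leaves sel (proj₂ occurring))) (λ b → loop)
          (proj₂ (selection-leaves sel (∈-vertices⁺ ds dv≢0))) v≢i
        decide (no none) = contradiction
          (pointwise λ v v≢i → decidable-stable (ds v ℕ.≟ 0) λ dv≢0 → none (v , dv≢0 , v≢i)) (¬peak i)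

    -- At i the indicator would have to take the value d = k ≥ 2.
    peak≢edge : ∀ i e → e ∈ edges H → (∀ v → ds v ≡ peak d i v) → ¬ (∀ v → ds v ≡ χ e v)
    peak≢edge i e e∈ eq eq′ = contradiction
      (subst (_≤ 1) (trans (sym (eq′ i)) (trans (eq i) (trans (peak-≡ d i) (d≡k e∈ eq′)))) (χ≤1 e i)) λ { (s≤s ()) }

    peaks edgeSum : ℚ
    peaks   = ∑ℚ (allFin n) (λ i → ℕ→ℚ (agree ds (peak d i)) ℚ.* ℕ→ℚ (degree H i ^ d))
    edgeSum = ∑ℚ (edges H) (λ e → ℕ→ℚ (agree ds (χ e)) ℚ.* edgeValue)

    private
      ×0 : ∀ {r} a → r ≡ 0 → ℕ→ℚ r ℚ.* a ≡ 0ℚ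
      ×0 a refl = ℚP.*-zeroˡ a
      ×1 : ∀ {r} a → r ≡ 1 → ℕ→ℚ r ℚ.* a ≡ a
      ×1 a refl = ℚP.*-identityˡ a
      peaks-zero : (∀ i → ¬ (∀ v → ds v ≡ peak d i v)) → peaks ≡ 0ℚ
      peaks-zero ¬peak = ∑ℚ.⨁-ε (allFin n) λ i → ×0 _ (agree-zero (¬peak i))
      edges-zero : (∀ e → e ∈ edges H → ¬ (∀ v → ds v ≡ χ e v)) → edgeSum ≡ 0ℚ
      edges-zero ¬edge = ∑ℚ.⨁-ε-∈ (edges H) λ e e∈ → ×0 edgeValue (agree-zero (¬edge e e∈))

    -- The case distinction is written with indicators, so that the sum over ds can be exchanged
    -- with those over vertices and edges.
    value-formula : value ds ≡ peaks ℚ.+ edgeSum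
    value-formula = decide (FinP.any? (λ i → FinP.all? (λ v → ds v ℕ.≟ peak d i v)))
                           (AnyList.any? (λ e → FinP.all? (λ v → ds v ℕ.≟ χ e v)) (edges H))
      where
      atPeak : ∀ i → (∀ v → ds v ≡ peak d i v) → value ds ≡ peaks ℚ.+ edgeSum
      atPeak i eq = trans (value-peak i eq) (sym (trans
        (cong₂ ℚ._+_
          (trans (∑ℚ.⨁-single (allFin-unique n) (∈-allFin i) λ j _ j≢i → ×0 _ (agree-zero λ eq′ →
                    contradiction (trans (sym (peak-≡ d i)) (trans (sym (eq i)) (trans (eq′ i) (peak-≢ d (j≢i ∘ sym)))))
                                  (ℕP.>⇒≢ 1≤d)))
                 (×1 _ (agree-≗ eq)))
          (edges-zero λ e e∈ → peak≢edge i e e∈ eq))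
        (ℚP.+-identityʳ _)))
      atEdge : ∀ e → e ∈ edges H → (∀ v → ds v ≡ χ e v) → value ds ≡ peaks ℚ.+ edgeSum
      atEdge e e∈ eq = trans (value-edge e e∈ eq) (sym (trans
        (cong₂ ℚ._+_
          (peaks-zero λ i eq′ → peak≢edge i e e∈ eq′ eq)
          (trans (∑ℚ.⨁-single (edgesDistinct H) e∈ λ e′ _ e′≢e → ×0 edgeValue (agree-zero λ eq′ →
                    e′≢e (χ-injective λ v → trans (sym (eq′ v)) (eq v))))
                 (×1 edgeValue (agree-≗ eq))))
        (ℚP.+-identityˡ _)))
      elsewhere : (∀ i → ¬ (∀ v → ds v ≡ peak d i v)) → (∀ e → e ∈ edges H → ¬ (∀ v → ds v ≡ χ e v)) →
                  value ds ≡ peaks ℚ.+ edgeSum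
      elsewhere ¬peak ¬edge = trans
        (trans (value-contribution ds) (trans (cong (∏ℚ (allFin n) (λ v → inv! (ds v * m)) ℚ.*_)
          (contribution-other ¬peak ¬edge)) (ℚP.*-zeroʳ (∏ℚ (allFin n) (λ v → inv! (ds v * m))))))
        (sym (cong₂ ℚ._+_ (peaks-zero ¬peak) (edges-zero ¬edge)))
      decide : Dec (∃ λ i → ∀ v → ds v ≡ peak d i v) → Dec (AnyList.Any (λ e → ∀ v → ds v ≡ χ e v) (edges H)) →
               value ds ≡ peaks ℚ.+ edgeSum
      decide (yes (i , eq)) _           = atPeak i eq
      decide (no _)         (yes found) = let e , e∈ , eq = find found in atEdge e e∈ eq
      decide (no ¬peak)     (no ¬edge)  = elsewhere (λ i eq → ¬peak (i , eq)) (λ e e∈ eq → ¬edge (lose e∈ eq))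

  edgeTotal : ℕ → ℚ
  edgeTotal c = ∑ℚ (edges H) (λ _ → ℕ→ℚ c ℚ.* edgeValue)

  -- The number c tells how often the indicator of an edge occurs among the exponent vectors: 0 for
  -- d < k and 1 for d = k.
  trace-formula : ∀ c → (∀ e → e ∈ edges H → ∑ (compositions n d) (λ ds → agree ds (χ e)) ≡ c) →
    Tr k n d 𝒯 ≡ ℕ→ℚ (m ^ (n ∸ 1)) ℚ.* (ℕ→ℚ (degPowSum H d) ℚ.+ edgeTotal c)
  trace-formula c count = cong (ℕ→ℚ (m ^ (n ∸ 1)) ℚ.*_) (begin
    sumℚ (map value (compositions n d))
      ≡⟨ ∑ℚ.foldr-map value (compositions n d) ⟩
    ∑ℚ (compositions n d) value
      ≡⟨ ∑ℚ.⨁-cong-∈ (compositions n d) (λ ds ds∈ → value-formula ds (compositions-∑ n d ds∈)) ⟩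
    ∑ℚ (compositions n d) (λ ds →
        ∑ℚ (allFin n) (λ i → ℕ→ℚ (agree ds (peak d i)) ℚ.* ℕ→ℚ (degree H i ^ d)) ℚ.+
        ∑ℚ (edges H) (λ e → ℕ→ℚ (agree ds (χ e)) ℚ.* edgeValue))
      ≡⟨ ∑ℚ.⨁-∙ (compositions n d) _ _ ⟩
    ∑ℚ (compositions n d) (λ ds → ∑ℚ (allFin n) (λ i → ℕ→ℚ (agree ds (peak d i)) ℚ.* ℕ→ℚ (degree H i ^ d))) ℚ.+
      ∑ℚ (compositions n d) (λ ds → ∑ℚ (edges H) (λ e → ℕ→ℚ (agree ds (χ e)) ℚ.* edgeValue))
      ≡⟨ cong₂ ℚ._+_
           (trans (collect (allFin n) (peak d) (λ i → ℕ→ℚ (degree H i ^ d)) 1 (λ i _ → ∑-agree n d (peak d i) (∑-δ i (λ _ → d))))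
             (trans (∑ℚ.⨁-cong (allFin n) (λ i → ℚP.*-identityˡ (ℕ→ℚ (degree H i ^ d))))
               (trans (sym (ℕ→ℚ-∑ (allFin n) _)) (cong ℕ→ℚ (sym (foldr-map _ (allFin n)))))))
           (collect (edges H) χ (λ _ → edgeValue) c count) ⟩
    ℕ→ℚ (degPowSum H d) ℚ.+ edgeTotal c ∎)
    where
    open ≡-Reasoning
    collect : ∀ {Z : Set} (xs : List Z) (x : Z → Vector ℕ n) (a : Z → ℚ) r →
      (∀ z → z ∈ xs → ∑ (compositions n d) (λ ds → agree ds (x z)) ≡ r) →
      ∑ℚ (compositions n d) (λ ds → ∑ℚ xs (λ z → ℕ→ℚ (agree ds (x z)) ℚ.* a z)) ≡ ∑ℚ xs (λ z → ℕ→ℚ r ℚ.* a z)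
    collect xs x a r cnt = trans (∑ℚ.⨁-swap (compositions n d) xs _)
      (∑ℚ.⨁-cong-∈ xs λ z z∈ → trans (∑ℚ.⨁-*ʳ (compositions n d) (a z) _)
        (cong (ℚ._* a z) (trans (sym (ℕ→ℚ-∑ (compositions n d) _)) (cong ℕ→ℚ (cnt z z∈)))))

  trace-below : d < k → Tr k n d 𝒯 ≡ ℕ→ℚ (m ^ (n ∸ 1) * degPowSum H d)
  trace-below d<k = trans (trace-formula 0 none) (trans (cong (ℕ→ℚ (m ^ (n ∸ 1)) ℚ.*_)
    (trans (cong (ℕ→ℚ (degPowSum H d) ℚ.+_) (∑ℚ.⨁-ε (edges H) λ _ → ℚP.*-zeroˡ edgeValue)) (ℚP.+-identityʳ _)))
    (sym (ℕ→ℚ-* (m ^ (n ∸ 1)) (degPowSum H d))))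
    where
    none : ∀ e → e ∈ edges H → ∑ (compositions n d) (λ ds → agree ds (χ e)) ≡ 0
    none e e∈ = ∑-zero-∈ (compositions n d) λ ds ds∈ → agree-zero λ eq →
      ℕP.<⇒≢ d<k (d≡k ds (compositions-∑ n d ds∈) e∈ eq)

  trace-at : d ≡ k → Tr k n d 𝒯 ≡
    ℤ→ℚ ((s ℤ.^ k) ℤ.* (+ (k ^ m * m ^ (n ∸ k) * numEdges H)) ℤ.+ (+ (m ^ (n ∸ 1) * degPowSum H d)))
  trace-at d≡k′ = begin
    Tr k n d 𝒯
      ≡⟨ trace-formula 1 (λ e e∈ → ∑-agree n d (χ e) (trans (∑-χ e) (trans (card e∈) (sym d≡k′)))) ⟩
    M ℚ.* (ℕ→ℚ (degPowSum H d) ℚ.+ edgeTotal 1)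
      ≡⟨ ℚP.*-distribˡ-+ M _ _ ⟩
    M ℚ.* ℕ→ℚ (degPowSum H d) ℚ.+ M ℚ.* edgeTotal 1
      ≡⟨ cong₂ ℚ._+_ (sym (ℕ→ℚ-* (m ^ (n ∸ 1)) (degPowSum H d))) (sym (∑ℚ.⨁-*ˡ (edges H) M _)) ⟩
    ℕ→ℚ (m ^ (n ∸ 1) * degPowSum H d) ℚ.+ ∑ℚ (edges H) (λ _ → M ℚ.* (1ℚ ℚ.* edgeValue))
      -- The bound k ≤ n comes from the edge under the sum. Without edges both sides vanish, so the
      -- truncation in `n ∸ k` does no harm.
      ≡⟨ cong (ℕ→ℚ (m ^ (n ∸ 1) * degPowSum H d) ℚ.+_)
           (trans (∑ℚ.⨁-cong-∈ (edges H) λ e e∈ → perEdge (subst (_≤ n) (card e∈) (SubsetP.∣p∣≤n e))) (constant (edges H))) ⟩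
    ℕ→ℚ (m ^ (n ∸ 1) * degPowSum H d) ℚ.+ ℤ→ℚ (s ℤ.^ k) ℚ.* ℕ→ℚ (k ^ m * m ^ (n ∸ k) * numEdges H)
      ≡⟨ ℚP.+-comm (ℕ→ℚ (m ^ (n ∸ 1) * degPowSum H d)) _ ⟩
    ℤ→ℚ (s ℤ.^ k) ℚ.* ℕ→ℚ (k ^ m * m ^ (n ∸ k) * numEdges H) ℚ.+ ℕ→ℚ (m ^ (n ∸ 1) * degPowSum H d)
      ≡⟨ cong (ℚ._+ ℕ→ℚ (m ^ (n ∸ 1) * degPowSum H d)) (ℤ→ℚ-* (s ℤ.^ k) (+ (k ^ m * m ^ (n ∸ k) * numEdges H))) ⟨
    ℤ→ℚ ((s ℤ.^ k) ℤ.* (+ (k ^ m * m ^ (n ∸ k) * numEdges H))) ℚ.+ ℕ→ℚ (m ^ (n ∸ 1) * degPowSum H d)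
      ≡⟨ ℤ→ℚ-+ ((s ℤ.^ k) ℤ.* (+ (k ^ m * m ^ (n ∸ k) * numEdges H))) (+ (m ^ (n ∸ 1) * degPowSum H d)) ⟨
    ℤ→ℚ ((s ℤ.^ k) ℤ.* (+ (k ^ m * m ^ (n ∸ k) * numEdges H)) ℤ.+ (+ (m ^ (n ∸ 1) * degPowSum H d))) ∎
    where
    open ≡-Reasoning
    M σ B : ℚ
    M = ℕ→ℚ (m ^ (n ∸ 1))
    σ = ℤ→ℚ (s ℤ.^ k)
    B = ℕ→ℚ (k ^ m * m ^ (n ∸ k))
    power-inverse : ∀ r → power (inv! m) r ℚ.* ℕ→ℚ ((m !) ^ r) ≡ 1ℚ
    power-inverse zero    = ℚP.*-identityˡ 1ℚ
    power-inverse (suc r) = trans (cong (inv! m ℚ.* power (inv! m) r ℚ.*_) (ℕ→ℚ-* (m !) ((m !) ^ r)))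
      (trans (exchange (inv! m) (power (inv! m) r) (ℕ→ℚ (m !)) (ℕ→ℚ ((m !) ^ r)))
             (trans (cong₂ ℚ._*_ (inv!-inverse m) (power-inverse r)) (ℚP.*-identityˡ 1ℚ)))
      where
      exchange : ∀ a b c e → a ℚ.* b ℚ.* (c ℚ.* e) ≡ a ℚ.* c ℚ.* (b ℚ.* e)
      exchange = ∏ℚ.interchange
    -- Splitting n - 1 = m + (n - k) frees m^m, which turns (m₁!)^m into (m!)^m. With the remaining
    -- m! this is the (m!)^k that the k factors `inv! m` cancel.
    counting : k ≤ n → m ^ (n ∸ 1) * circuits ≡ (m !) ^ k * (k ^ m * m ^ (n ∸ k))
    counting k≤n = begin
      m ^ (n ∸ 1) * (k ^ m * (m₁ !) ^ m * m !)
        ≡⟨ cong (λ r → m ^ r * (k ^ m * (m₁ !) ^ m * m !)) (cong (_∸ 1) (sym (ℕP.m+[n∸m]≡n k≤n))) ⟩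
      m ^ (m + (n ∸ k)) * (k ^ m * (m₁ !) ^ m * m !)
        ≡⟨ cong (_* (k ^ m * (m₁ !) ^ m * m !)) (ℕP.^-distribˡ-+-* m m (n ∸ k)) ⟩
      m ^ m * m ^ (n ∸ k) * (k ^ m * (m₁ !) ^ m * m !)
        ≡⟨ regroup (m ^ m) (m ^ (n ∸ k)) (k ^ m) ((m₁ !) ^ m) (m !) ⟩
      m ! * (m ^ m * (m₁ !) ^ m) * (k ^ m * m ^ (n ∸ k))
        ≡⟨ cong (λ z → m ! * z * (k ^ m * m ^ (n ∸ k))) (sym (*-^ m (m₁ !) m)) ⟩
      m ! * (m !) ^ m * (k ^ m * m ^ (n ∸ k)) ∎
      where
      regroup : ∀ a b c x y → a * b * (c * x * y) ≡ y * (a * x) * (c * b)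
      regroup = solve-∀
    perEdge : k ≤ n → M ℚ.* (1ℚ ℚ.* edgeValue) ≡ σ ℚ.* B
    perEdge k≤n = begin
      M ℚ.* (1ℚ ℚ.* edgeValue)
        ≡⟨ cong (M ℚ.*_) (ℚP.*-identityˡ edgeValue) ⟩
      M ℚ.* (power (inv! m) k ℚ.* (σ ℚ.* ℕ→ℚ circuits))
        ≡⟨ solve 4 (λ a b c e → a :* (b :* (c :* e)) := c :* (b :* (a :* e))) refl M (power (inv! m) k) σ (ℕ→ℚ circuits) ⟩
      σ ℚ.* (power (inv! m) k ℚ.* (M ℚ.* ℕ→ℚ circuits))
        ≡⟨ cong (λ z → σ ℚ.* (power (inv! m) k ℚ.* z)) (trans (sym (ℕ→ℚ-* (m ^ (n ∸ 1)) circuits))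
             (trans (cong ℕ→ℚ (counting k≤n)) (ℕ→ℚ-* ((m !) ^ k) (k ^ m * m ^ (n ∸ k))))) ⟩
      σ ℚ.* (power (inv! m) k ℚ.* (ℕ→ℚ ((m !) ^ k) ℚ.* B))
        ≡⟨ cong (σ ℚ.*_) (sym (ℚP.*-assoc (power (inv! m) k) (ℕ→ℚ ((m !) ^ k)) B)) ⟩
      σ ℚ.* (power (inv! m) k ℚ.* ℕ→ℚ ((m !) ^ k) ℚ.* B)
        ≡⟨ cong (σ ℚ.*_) (trans (cong (ℚ._* B) (power-inverse k)) (ℚP.*-identityˡ B)) ⟩
      σ ℚ.* B ∎
      where open +-*-Solver
    constant : ∀ es → ∑ℚ es (λ (_ : Subset n) → σ ℚ.* B) ≡ σ ℚ.* ℕ→ℚ (k ^ m * m ^ (n ∸ k) * length es)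
    constant es = begin
      ∑ℚ es (λ _ → σ ℚ.* B)
        ≡⟨ ∑ℚ.⨁-*ˡ es σ (λ _ → B) ⟩
      σ ℚ.* ∑ℚ es (λ _ → B)
        ≡⟨ cong (σ ℚ.*_) (trans (sym (ℕ→ℚ-∑ es (λ _ → k ^ m * m ^ (n ∸ k))))
             (cong ℕ→ℚ (trans (∑-const es (k ^ m * m ^ (n ∸ k))) (ℕP.*-comm (length es) _)))) ⟩
      σ ℚ.* ℕ→ℚ (k ^ m * m ^ (n ∸ k) * length es) ∎

-- The two Laplacian tensors

1^n≡1 : ∀ r → (+ 1) ℤ.^ r ≡ + 1
1^n≡1 zero    = refl
1^n≡1 (suc r) = trans (ℤP.*-identityˡ _) (1^n≡1 r)

laplacian-split : ∀ {m n} (H : Hypergraph (suc m) n) f →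
                  laplacian H f ≡ degTensor H f ℚ.+ ℤ→ℚ -1ℤ ℚ.* adjTensor H f
laplacian-split H f = cong (degTensor H f ℚ.+_)
  -- `ℤ→ℚ -1ℤ` computes to the constant `ℚ.- 1ℚ`.
  (solve 1 (λ a → :- a := (con (ℚ.- 1ℚ)) :* a) refl (adjTensor H f))
  where open +-*-Solver

signlessLaplacian-split : ∀ {m n} (H : Hypergraph (suc m) n) f →
                          signlessLaplacian H f ≡ degTensor H f ℚ.+ ℤ→ℚ (+ 1) ℚ.* adjTensor H f
signlessLaplacian-split H f = cong (degTensor H f ℚ.+_) (sym (ℚP.*-identityˡ (adjTensor H f)))

theorem2p3 : (k n : ℕ) → 2 ≤ k → (H : Hypergraph k n) →
    ((t : ℕ) → 1 ≤ t → t ≤ k ∸ 1 →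
    (Tr k n t (laplacian H) ≡ ℕ→ℚ ((k ∸ 1) ^ (n ∸ 1) * degPowSum H t))
    × (Tr k n t (signlessLaplacian H) ≡ ℕ→ℚ ((k ∸ 1) ^ (n ∸ 1) * degPowSum H t)))
    × (Tr k n k (laplacian H) ≡
    ℤ→ℚ ((-1ℤ ℤ.^ k) ℤ.* (+ (k ^ (k ∸ 1) * (k ∸ 1) ^ (n ∸ k) * numEdges H))
    ℤ.+ (+ ((k ∸ 1) ^ (n ∸ 1) * degPowSum H k))))
    × (Tr k n k (signlessLaplacian H) ≡
    ℕ→ℚ (k ^ (k ∸ 1) * (k ∸ 1) ^ (n ∸ k) * numEdges H
    + (k ∸ 1) ^ (n ∸ 1) * degPowSum H k))
theorem2p3 (suc zero) n (s≤s ()) H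
theorem2p3 k@(suc (suc m₁)) n 2≤k H = below , at -1ℤ (laplacian H) (laplacian-split H) , signless
  where
  below : (t : ℕ) → 1 ≤ t → t ≤ k ∸ 1 →
    (Tr k n t (laplacian H) ≡ ℕ→ℚ ((k ∸ 1) ^ (n ∸ 1) * degPowSum H t))
    × (Tr k n t (signlessLaplacian H) ≡ ℕ→ℚ ((k ∸ 1) ^ (n ∸ 1) * degPowSum H t))
  -- The successor pattern lets `t * (k ∸ 1)` compute to a successor, so that the walk parameter l
  -- is inferred from `refl`.
  below t@(suc _) 1≤t t≤ =
    Trace.trace-below H -1ℤ (laplacian H) (laplacian-split H) t _ 1≤t (ℕP.m≤n⇒m≤1+n t≤) refl (s≤s t≤) ,
    Trace.trace-below H (+ 1) (signlessLaplacian H) (signlessLaplacian-split H) t _ 1≤t (ℕP.m≤n⇒m≤1+n t≤) refl (s≤s t≤)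
  at : ∀ s (𝒯 : Tensor k n) → (∀ f → 𝒯 f ≡ degTensor H f ℚ.+ ℤ→ℚ s ℚ.* adjTensor H f) → Tr k n k 𝒯 ≡
    ℤ→ℚ ((s ℤ.^ k) ℤ.* (+ (k ^ (k ∸ 1) * (k ∸ 1) ^ (n ∸ k) * numEdges H)) ℤ.+ (+ ((k ∸ 1) ^ (n ∸ 1) * degPowSum H k)))
  at s 𝒯 𝒯≡ = Trace.trace-at H s 𝒯 𝒯≡ k _ (s≤s z≤n) ℕP.≤-refl refl refl
  signless : Tr k n k (signlessLaplacian H) ≡
    ℕ→ℚ (k ^ (k ∸ 1) * (k ∸ 1) ^ (n ∸ k) * numEdges H + (k ∸ 1) ^ (n ∸ 1) * degPowSum H k)
  signless = trans (at (+ 1) (signlessLaplacian H) (signlessLaplacian-split H)) (cong ℤ→ℚ (begin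
    ((+ 1) ℤ.^ k) ℤ.* (+ E) ℤ.+ (+ D) ≡⟨ cong (λ z → z ℤ.* (+ E) ℤ.+ (+ D)) (1^n≡1 k) ⟩
    (+ 1) ℤ.* (+ E) ℤ.+ (+ D)         ≡⟨ cong (ℤ._+ (+ D)) (ℤP.*-identityˡ (+ E)) ⟩
    (+ E) ℤ.+ (+ D)                   ≡⟨ ℤP.pos-+ E D ⟨
    + (E + D)                         ∎))
    where
    open ≡-Reasoning
    E D : ℕ
    E = k ^ (k ∸ 1) * (k ∸ 1) ^ (n ∸ k) * numEdges H
    D = (k ∸ 1) ^ (n ∸ 1) * degPowSum H k
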